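{- A field extension $L|K$ is absolutely co-Galois if and only if the following conditions are fulfilled: 1. The group $\operatorname{T}(L^\times|K^\times)$ generates $L$ as a $K$-algebra, the group extension $K^\times\hookrightarrow \operatorname{T}(L^\times|K^\times)$ is essential, and $(L^\times/K^\times)[\ell^\infty]=1$, i.e. $(L^\times)^\ell\cap K^\times=(K^\times)^\ell$, if $\operatorname{char}K=\ell>0$. 2. If $L^\times$ contains a root of unity $i$ of order $4$, then $i$ already belongs to $K^\times$.
   Context: For a multiplicatively written abelian group $G$ and a prime $p$, $G[p^\infty]$ is its $p$-primary component. An extension $H\subseteq G$ of abelian groups is essential if every subgroup $F\subseteq G$ with $F\cap H=1$ is trivial. For a field extension $L|K$ put $\operatorname{T}(L^\times|K^\times)=\{x\in L^\times: x^n\in K^\times\text{ for some }n\ge1\}$. For a field $K$ and an abelian group $U\supseteq K^\times$ with $D=U/K^\times$ (written additively) and representatives $x_d\in U$ of the classes $d\in D$, $K\langle U\rangle:=\bigoplus_{d\in D}Kx_d$ is the $K$-algebra with $K$-basis $(x_d)$ and multiplication $x_dx_e=a_{d,e}x_{d+e}$, $a_{d,e}\in K^\times$ determined by this equation in $U$ (equivalently, $K\otimes_{\mathbb Z[K^\times]}\mathbb Z[U]$). If $U$ is a subgroup of $B^\times$ for a $K$-algebra $B$ (compatibly with $K^\times$), the inclusion induces a canonical $K$-algebra homomorphism $K\langle U\rangle\to B$. $L|K$ is called absolutely co-Galois if the canonical $K$-algebra homomorphism $K\langle \operatorname{T}(L^\times|K^\times)\rangle\to L$ induced by the inclusion $\operatorname{T}(L^\times|K^\times)\hookrightarrow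 L^\times$ is an isomorphism. -}

module Defs where

open import Level using (Level; _⊔_) renaming (suc to lsuc)
open import Data.Nat.Base as ℕ using (ℕ; zero; suc; _≥_; _>_)
open import Data.Nat.Divisibility using (_∣_)
import Data.Nat.Properties as ℕₚ
open import Data.Product.Base using (_×_; _,_; ∃; ∃-syntax; Σ-syntax; proj₁; proj₂)
open import Data.List.Base using (List; []; _∷_; _++_; [_]; map; concatMap)
open import Data.List.Properties using (++-assoc; ++-identityʳ; map-++; map-∘; concatMap-++)
open import Relation.Unary using (Pred; _∩_)
open import Relation.Binary.Core using (Rel)
open import Relation.Binary.Definitions using (_Respects_)
open import Relation.Binary.PropositionalEquality.Core as ≡ using (_≡_)
import Relation.Binary.Reasoning.Setoid as SetoidReasoning
open import Function.Bundles using (_⇔_)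
open import Algebra.Bundles
open import Algebra.Apartness.Bundles using (HeytingField; HeytingCommutativeRing)
open import Algebra.Morphism.Bundles using (GroupHomomorphism; RingHomomorphism)
open import Algebra.Morphism.Structures using (IsRingHomomorphism; IsRingIsomorphism)
import Algebra.Definitions as AlgebraDefinitions
import Algebra.Definitions.RawMonoid as RawMonoidDefinitions
import Algebra.Properties.AbelianGroup as AbelianGroupProperties
import Algebra.Properties.CommutativeMonoid.Mult as CommutativeMonoidMult
import Algebra.Properties.CommutativeSemigroup as CommutativeSemigroupProperties
import Algebra.Properties.Monoid.Mult as MonoidMult
import Algebra.Properties.Ring as RingProperties

private
  variable
    g ℓ p r ℓr s ℓs : Level

module _ (G : AbelianGroup g ℓ) where
  open AbelianGroup G

  power : Carrier → ℕ → Carrier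
  power x n = n ·× x
    where open RawMonoidDefinitions rawMonoid using () renaming (_×_ to _·×_)

  record IsSubgroup (P : Pred Carrier p) : Set (g ⊔ ℓ ⊔ p) where
    field
      resp      : P Respects _≈_
      ε-closed  : P ε
      ∙-closed  : ∀ {x y} → P x → P y → P (x ∙ y)
      ⁻¹-closed : ∀ {x} → P x → P (x ⁻¹)

  Trivial : Pred Carrier p → Set (g ⊔ ℓ ⊔ p)
  Trivial P = ∀ {x} → P x → x ≈ ε

  -- The universe level of F is that of the data at hand.  Under excluded
  -- middle a predicate can be resized to any level, so this is no restriction.
  Essential : Pred Carrier p → Set (lsuc (g ⊔ ℓ ⊔ p))
  Essential {p} H =
    (F : Pred Carrier (g ⊔ ℓ ⊔ p)) → IsSubgroup F → Trivial (F ∩ H) → Trivial F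

  Primary : ℕ → Pred Carrier ℓ
  Primary l x = ∃[ n ] power x (l ℕ.^ n) ≈ ε

  HasOrder : Carrier → ℕ → Set ℓ
  HasOrder x n = ∀ m → power x m ≈ ε ⇔ n ∣ m

  subgroup : (P : Pred Carrier p) → IsSubgroup P → AbelianGroup (g ⊔ p) ℓ
  subgroup P isSubgroup = record
    { Carrier = ∃ P
    ; _≈_     = λ x y → proj₁ x ≈ proj₁ y
    ; _∙_     = λ x y → proj₁ x ∙ proj₁ y , ∙-closed (proj₂ x) (proj₂ y)
    ; ε       = ε , ε-closed
    ; _⁻¹     = λ x → proj₁ x ⁻¹ , ⁻¹-closed (proj₂ x)
    ; isAbelianGroup = record
      { isGroup = record
        { isMonoid = record
          { isSemigroup = record
            { isMagma = record
              { isEquivalence = record { refl = refl ; sym = sym ; trans = trans }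
              ; ∙-cong        = ∙-cong
              }
            ; assoc = λ _ _ _ → assoc _ _ _
            }
          ; identity = (λ _ → identityˡ _) , (λ _ → identityʳ _)
          }
        ; inverse = (λ _ → inverseˡ _) , (λ _ → inverseʳ _)
        ; ⁻¹-cong = ⁻¹-cong
        }
      ; comm = λ _ _ → comm _ _
      }
    }
    where open IsSubgroup isSubgroup

  quotient : (H : Pred Carrier p) → IsSubgroup H → AbelianGroup g p
  quotient H isSubgroup = record
    { Carrier = Carrier
    ; _≈_     = λ x y → H (x ∙ y ⁻¹)
    ; _∙_     = _∙_
    ; ε       = ε
    ; _⁻¹     = _⁻¹
    ; isAbelianGroup = record
      { isGroup = record
        { isMonoid = record
          { isSemigroup = record
            { isMagma = record
              { isEquivalence = record
                { refl  = ≈⇒∼ refl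
                ; sym   = λ {x} {y} h → resp (flip x y) (⁻¹-closed h)
                ; trans = λ {x} {y} {z} h k → resp (cancel x y z) (∙-closed h k)
                }
              ; ∙-cong = λ {x} {y} {u} {v} h k → resp (regroup x y u v) (∙-closed h k)
              }
            ; assoc = λ _ _ _ → ≈⇒∼ (assoc _ _ _)
            }
          ; identity = (λ _ → ≈⇒∼ (identityˡ _)) , (λ _ → ≈⇒∼ (identityʳ _))
          }
        ; inverse = (λ _ → ≈⇒∼ (inverseˡ _)) , (λ _ → ≈⇒∼ (inverseʳ _))
        ; ⁻¹-cong = λ {x} {y} h → resp (sym (⁻¹-∙-comm x (y ⁻¹))) (⁻¹-closed h)
        }
      ; comm = λ _ _ → ≈⇒∼ (comm _ _)
      }
    }
    where
    open IsSubgroup isSubgroup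
    open AbelianGroupProperties G
    open CommutativeSemigroupProperties commutativeSemigroup using (interchange)
    open SetoidReasoning setoid

    ≈⇒∼ : ∀ {x y} → x ≈ y → H (x ∙ y ⁻¹)
    ≈⇒∼ x≈y = resp (sym (x≈y⇒x∙y⁻¹≈ε x≈y)) ε-closed

    flip : ∀ x y → (x ∙ y ⁻¹) ⁻¹ ≈ y ∙ x ⁻¹
    flip x y = begin
      (x ∙ y ⁻¹) ⁻¹    ≈⟨ ⁻¹-∙-comm x (y ⁻¹) ⟨
      x ⁻¹ ∙ y ⁻¹ ⁻¹   ≈⟨ ∙-congˡ (⁻¹-involutive y) ⟩
      x ⁻¹ ∙ y         ≈⟨ comm _ _ ⟩
      y ∙ x ⁻¹         ∎

    cancel : ∀ x y z → (x ∙ y ⁻¹) ∙ (y ∙ z ⁻¹) ≈ x ∙ z ⁻¹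
    cancel x y z = begin
      (x ∙ y ⁻¹) ∙ (y ∙ z ⁻¹)  ≈⟨ assoc _ _ _ ⟩
      x ∙ (y ⁻¹ ∙ (y ∙ z ⁻¹))  ≈⟨ ∙-congˡ (assoc _ _ _) ⟨
      x ∙ ((y ⁻¹ ∙ y) ∙ z ⁻¹)  ≈⟨ ∙-congˡ (∙-congʳ (inverseˡ y)) ⟩
      x ∙ (ε ∙ z ⁻¹)           ≈⟨ ∙-congˡ (identityˡ _) ⟩
      x ∙ z ⁻¹                 ∎

    regroup : ∀ x y u v → (x ∙ y ⁻¹) ∙ (u ∙ v ⁻¹) ≈ (x ∙ u) ∙ (y ∙ v) ⁻¹
    regroup x y u v = trans (interchange _ _ _ _) (∙-congˡ (⁻¹-∙-comm y v))

HasCharacteristic : CommutativeRing r ℓr → ℕ → Set ℓr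
HasCharacteristic R l = ∀ n → n ·× 1# ≈ 0# ⇔ l ∣ n
  where
  open CommutativeRing R
  open RawMonoidDefinitions +-rawMonoid using () renaming (_×_ to _·×_)

unitGroup : CommutativeRing r ℓr → AbelianGroup (r ⊔ ℓr) ℓr
unitGroup R = record
  { Carrier = ∃ (Invertible 1# _*_)
  ; _≈_     = λ x y → proj₁ x ≈ proj₁ y
  ; _∙_     = λ (x , x′ , x′x , xx′) (y , y′ , y′y , yy′) →
      x * y , x′ * y′ ,
      trans (*-interchange x′ y′ x y) (trans (*-cong x′x y′y) (*-identityˡ 1#)) ,
      trans (*-interchange x y x′ y′) (trans (*-cong xx′ yy′) (*-identityˡ 1#))
  ; ε       = 1# , 1# , *-identityˡ 1# , *-identityˡ 1#
  ; _⁻¹     = λ (x , x′ , x′x , xx′) → x′ , x , xx′ , x′x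
  ; isAbelianGroup = record
    { isGroup = record
      { isMonoid = record
        { isSemigroup = record
          { isMagma = record
            { isEquivalence = record { refl = refl ; sym = sym ; trans = trans }
            ; ∙-cong        = *-cong
            }
          ; assoc = λ _ _ _ → *-assoc _ _ _
          }
        ; identity = (λ _ → *-identityˡ _) , (λ _ → *-identityʳ _)
        }
      ; inverse = (λ (_ , _ , x′x , _) → x′x) , (λ (_ , _ , _ , xx′) → xx′)
      ; ⁻¹-cong = λ {x} {y} → inverse-cong x y
      }
    ; comm = λ _ _ → *-comm _ _
    }
  }
  where
  open CommutativeRing R
  open AlgebraDefinitions _≈_ using (Invertible)
  open CommutativeSemigroupProperties *-commutativeSemigroup
    renaming (interchange to *-interchange)
  open SetoidReasoning setoid

  inverse-cong : (x y : ∃ (Invertible 1# _*_)) → proj₁ x ≈ proj₁ y →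
                 proj₁ (proj₂ x) ≈ proj₁ (proj₂ y)
  inverse-cong (x , x′ , x′x , _) (y , y′ , _ , yy′) x≈y = begin
    x′             ≈⟨ *-identityʳ x′ ⟨
    x′ * 1#        ≈⟨ *-congˡ yy′ ⟨
    x′ * (y * y′)  ≈⟨ *-assoc _ _ _ ⟨
    (x′ * y) * y′  ≈⟨ *-congʳ (*-congˡ x≈y) ⟨
    (x′ * x) * y′  ≈⟨ *-congʳ x′x ⟩
    1# * y′        ≈⟨ *-identityˡ y′ ⟩
    y′             ∎

-- All the algebras needed here are commutative.
record Algebra (R : CommutativeRing r ℓr) (s ℓs : Level)
               : Set (r ⊔ ℓr ⊔ lsuc (s ⊔ ℓs)) where
  field
    commutativeRing : CommutativeRing s ℓs
    structureMap    : RingHomomorphism (CommutativeRing.rawRing R)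
                                       (CommutativeRing.rawRing commutativeRing)

  open CommutativeRing commutativeRing public
  open RingHomomorphism structureMap public
    using () renaming (⟦_⟧ to algebraMap)

module _ {R : CommutativeRing r ℓr} where

  private
    variable
      t ℓt : Level

  record IsAlgebraHomomorphism (A : Algebra R s ℓs) (B : Algebra R t ℓt)
                               (f : Algebra.Carrier A → Algebra.Carrier B)
                               : Set (r ⊔ s ⊔ ℓs ⊔ ℓt) where
    field
      isRingHomomorphism : IsRingHomomorphism (Algebra.rawRing A) (Algebra.rawRing B) f
      algebraMap-homo    : ∀ a → Algebra._≈_ B (f (Algebra.algebraMap A a)) (Algebra.algebraMap B a)

  record IsAlgebraIsomorphism (A : Algebra R s ℓs) (B : Algebra R t ℓt)
                              (f : Algebra.Carrier A → Algebra.Carrier B)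
                              : Set (r ⊔ s ⊔ ℓs ⊔ t ⊔ ℓt) where
    field
      isRingIsomorphism : IsRingIsomorphism (Algebra.rawRing A) (Algebra.rawRing B) f
      algebraMap-homo   : ∀ a → Algebra._≈_ B (f (Algebra.algebraMap A a)) (Algebra.algebraMap B a)

  -- The subalgebra generated by S; closure under negation follows from
  -- that under multiplication by the image of - 1#.
  data Adjoin (A : Algebra R s ℓs) (S : Pred (Algebra.Carrier A) p)
              : Pred (Algebra.Carrier A) (r ⊔ s ⊔ ℓs ⊔ p) where
    generator : ∀ {x} → S x → Adjoin A S x
    scalar    : ∀ a → Adjoin A S (Algebra.algebraMap A a)
    add       : ∀ {x y} → Adjoin A S x → Adjoin A S y → Adjoin A S (Algebra._+_ A x y)
    multiply  : ∀ {x y} → Adjoin A S x → Adjoin A S y → Adjoin A S (Algebra._*_ A x y)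
    resp      : ∀ {x y} → Algebra._≈_ A x y → Adjoin A S x → Adjoin A S y

  Generates : (A : Algebra R s ℓs) → Pred (Algebra.Carrier A) p → Set (r ⊔ s ⊔ ℓs ⊔ p)
  Generates A S = ∀ x → Adjoin A S x

  unitMap : (A : Algebra R s ℓs) →
            GroupHomomorphism (AbelianGroup.rawGroup (unitGroup R))
                              (AbelianGroup.rawGroup (unitGroup (Algebra.commutativeRing A)))
  unitMap A = record
    { ⟦_⟧ = λ (x , x′ , x′x , xx′) →
        algebraMap x , algebraMap x′ ,
        trans (sym (*-homo x′ x)) (trans (⟦⟧-cong x′x) 1#-homo) ,
        trans (sym (*-homo x x′)) (trans (⟦⟧-cong xx′) 1#-homo)
    ; isGroupHomomorphism = record
      { isMonoidHomomorphism = record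
        { isMagmaHomomorphism = record
          { isRelHomomorphism = record { cong = ⟦⟧-cong }
          ; homo = λ _ _ → *-homo _ _
          }
        ; ε-homo = 1#-homo
        }
      ; ⁻¹-homo = λ _ → refl
      }
    }
    where
    open Algebra A
    open RingHomomorphism structureMap using (⟦⟧-cong; *-homo; 1#-homo)

-- K⟨U⟩ = K ⊗_{ℤ[Kˣ]} ℤ[U] for an extension j : Kˣ → U of abelian groups,
-- presented by generators a ⊗ u and relations.  This avoids choosing
-- representatives of U / Kˣ: any such choice (x_d) gives a K-basis 1 ⊗ x_d
-- with (1 ⊗ x_d) (1 ⊗ x_e) = 1 ⊗ (j a_{d,e} x_{d+e}) = a_{d,e} ⊗ x_{d+e}.
-- Injectivity of j plays no role in the construction.
module CrossedGroupAlgebra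
  {k ℓk u ℓu : Level}
  (K : CommutativeRing k ℓk)
  (U : AbelianGroup u ℓu)
  (j : GroupHomomorphism (AbelianGroup.rawGroup (unitGroup K)) (AbelianGroup.rawGroup U))
  where

  private
    module K = CommutativeRing K
    module Kˣ = AbelianGroup (unitGroup K)
    module U = AbelianGroup U
    module j = GroupHomomorphism j

  -- The list (a₁ , u₁) ∷ … ∷ (aₙ , uₙ) ∷ [] denotes Σᵢ aᵢ ⊗ uᵢ.
  FormalSum : Set (k ⊔ u)
  FormalSum = List (K.Carrier × U.Carrier)

  infix 4 _∼_

  data _∼_ : Rel FormalSum (k ⊔ ℓk ⊔ u ⊔ ℓu) where
    ∼-refl   : ∀ {x} → x ∼ x
    ∼-sym    : ∀ {x y} → x ∼ y → y ∼ x
    ∼-trans  : ∀ {x y z} → x ∼ y → y ∼ z → x ∼ z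
    ++-cong  : ∀ {x x′ y y′} → x ∼ x′ → y ∼ y′ → x ++ y ∼ x′ ++ y′
    ++-comm  : ∀ x y → x ++ y ∼ y ++ x
    ⊗-cong   : ∀ {a b v w} → a K.≈ b → v U.≈ w → [ a , v ] ∼ [ b , w ]
    ⊗-+      : ∀ a b v → [ a K.+ b , v ] ∼ [ a , v ] ++ [ b , v ]
    ⊗-0      : ∀ v → [ K.0# , v ] ∼ []
    balanced : ∀ a (c : Kˣ.Carrier) v → [ a K.* proj₁ c , v ] ∼ [ a , j.⟦ c ⟧ U.∙ v ]

  private
    +-commutativeMonoid : CommutativeMonoid (k ⊔ u) (k ⊔ ℓk ⊔ u ⊔ ℓu)
    +-commutativeMonoid = record
      { Carrier = FormalSum
      ; _≈_     = _∼_
      ; _∙_     = _++_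
      ; ε       = []
      ; isCommutativeMonoid = record
        { isMonoid = record
          { isSemigroup = record
            { isMagma = record
              { isEquivalence = record { refl = ∼-refl ; sym = ∼-sym ; trans = ∼-trans }
              ; ∙-cong        = ++-cong
              }
            ; assoc = λ x y z → ≡⇒∼ (++-assoc x y z)
            }
          ; identity = (λ _ → ∼-refl) , (λ x → ≡⇒∼ (++-identityʳ x))
          }
        ; comm = ++-comm
        }
      }
      where
      ≡⇒∼ : ∀ {x y} → x ≡ y → x ∼ y
      ≡⇒∼ ≡.refl = ∼-refl

    open CommutativeMonoid +-commutativeMonoid
      using (setoid; reflexive; commutativeSemigroup)
      renaming (identityʳ to ++-idʳ; assoc to ++-ass; ∙-congˡ to ++-congˡ; ∙-congʳ to ++-congʳ)
    open CommutativeSemigroupProperties commutativeSemigroup using (interchange)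
    open SetoidReasoning setoid

    Term : Set (k ⊔ u)
    Term = K.Carrier × U.Carrier

  infixl 7 _⊛_
  infix  8 ⊖_

  _·_ : Term → Term → Term
  (a , v) · (b , w) = a K.* b , v U.∙ w

  _⊛_ : FormalSum → FormalSum → FormalSum
  x ⊛ y = concatMap (λ t → map (t ·_) y) x

  ⊖_ : FormalSum → FormalSum
  ⊖_ = map λ (a , v) → K.- a , v

  1⊗1 : FormalSum
  1⊗1 = [ K.1# , U.ε ]

  private
    map-pointwise : ∀ {f h : Term → Term} → (∀ t → [ f t ] ∼ [ h t ]) → ∀ y → map f y ∼ map h y
    map-pointwise f∼h []      = ∼-refl
    map-pointwise f∼h (t ∷ y) = ++-cong (f∼h t) (map-pointwise f∼h y)

    map-id∼ : ∀ {f : Term → Term} → (∀ t → [ f t ] ∼ [ t ]) → ∀ y → map f y ∼ y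
    map-id∼ f∼ []      = ∼-refl
    map-id∼ f∼ (t ∷ y) = ++-cong (f∼ t) (map-id∼ f∼ y)

    map-additive : ∀ {f h i : Term → Term} → (∀ t → [ f t ] ∼ [ h t ] ++ [ i t ]) →
                   ∀ y → map f y ∼ map h y ++ map i y
    map-additive f∼ []      = ∼-refl
    map-additive {f} {h} {i} f∼ (t ∷ y) = begin
      [ f t ] ++ map f y                         ≈⟨ ++-cong (f∼ t) (map-additive f∼ y) ⟩
      ([ h t ] ++ [ i t ]) ++ (map h y ++ map i y) ≈⟨ interchange [ h t ] [ i t ] (map h y) (map i y) ⟩
      ([ h t ] ++ map h y) ++ ([ i t ] ++ map i y) ∎

    map-zero : ∀ {f : Term → Term} → (∀ t → [ f t ] ∼ []) → ∀ y → map f y ∼ []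
    map-zero f∼ []      = ∼-refl
    map-zero f∼ (t ∷ y) = ++-cong (f∼ t) (map-zero f∼ y)

    singleton-⊛ : ∀ t y → [ t ] ⊛ y ∼ map (t ·_) y
    singleton-⊛ t y = ++-idʳ (map (t ·_) y)

    ⊛-++ʳ : ∀ x x′ y → (x ++ x′) ⊛ y ∼ x ⊛ y ++ x′ ⊛ y
    ⊛-++ʳ x x′ y = reflexive (concatMap-++ (λ t → map (t ·_) y) x x′)

    ·-comm : ∀ s t → [ s · t ] ∼ [ t · s ]
    ·-comm (a , v) (b , w) = ⊗-cong (K.*-comm a b) (U.comm v w)

    ⊛-zeroʳ : ∀ x → x ⊛ [] ∼ []
    ⊛-zeroʳ []      = ∼-refl
    ⊛-zeroʳ (t ∷ x) = ⊛-zeroʳ x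

    ⊛-∷ : ∀ x t y → x ⊛ (t ∷ y) ∼ map (t ·_) x ++ x ⊛ y
    ⊛-∷ []      t y = ∼-refl
    ⊛-∷ (s ∷ x) t y = begin
      ([ s · t ] ++ map (s ·_) y) ++ x ⊛ (t ∷ y)
        ≈⟨ ++-cong (++-congʳ (·-comm s t)) (⊛-∷ x t y) ⟩
      ([ t · s ] ++ map (s ·_) y) ++ (map (t ·_) x ++ x ⊛ y)
        ≈⟨ interchange [ t · s ] (map (s ·_) y) (map (t ·_) x) (x ⊛ y) ⟩
      ([ t · s ] ++ map (t ·_) x) ++ (map (s ·_) y ++ x ⊛ y) ∎

    ⊛-comm : ∀ x y → x ⊛ y ∼ y ⊛ x
    ⊛-comm []      y = ∼-sym (⊛-zeroʳ y)
    ⊛-comm (t ∷ x) y = begin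
      map (t ·_) y ++ x ⊛ y  ≈⟨ ++-congˡ (⊛-comm x y) ⟩
      map (t ·_) y ++ y ⊛ x  ≈⟨ ⊛-∷ y t x ⟨
      y ⊛ (t ∷ x)            ∎

    ⊛-congʳ : ∀ {x x′} y → x ∼ x′ → x ⊛ y ∼ x′ ⊛ y
    ⊛-congʳ y ∼-refl        = ∼-refl
    ⊛-congʳ y (∼-sym e)     = ∼-sym (⊛-congʳ y e)
    ⊛-congʳ y (∼-trans e f) = ∼-trans (⊛-congʳ y e) (⊛-congʳ y f)
    ⊛-congʳ y (++-cong {x} {x′} {z} {z′} e f) = begin
      (x ++ z) ⊛ y      ≈⟨ ⊛-++ʳ x z y ⟩
      x ⊛ y ++ z ⊛ y    ≈⟨ ++-cong (⊛-congʳ y e) (⊛-congʳ y f) ⟩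
      x′ ⊛ y ++ z′ ⊛ y  ≈⟨ ⊛-++ʳ x′ z′ y ⟨
      (x′ ++ z′) ⊛ y    ∎
    ⊛-congʳ y (++-comm x z) = begin
      (x ++ z) ⊛ y      ≈⟨ ⊛-++ʳ x z y ⟩
      x ⊛ y ++ z ⊛ y    ≈⟨ ++-comm (x ⊛ y) (z ⊛ y) ⟩
      z ⊛ y ++ x ⊛ y    ≈⟨ ⊛-++ʳ z x y ⟨
      (z ++ x) ⊛ y      ∎
    ⊛-congʳ y (⊗-cong a≈b v≈w) =
      ++-congʳ (map-pointwise (λ _ → ⊗-cong (K.*-congʳ a≈b) (U.∙-congʳ v≈w)) y)
    ⊛-congʳ y (⊗-+ a b v) = begin
      [ a K.+ b , v ] ⊛ y
        ≈⟨ singleton-⊛ _ y ⟩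
      map ((a K.+ b , v) ·_) y
        ≈⟨ map-additive (λ (c , w) → ∼-trans (⊗-cong (K.distribʳ c a b) U.refl) (⊗-+ _ _ _)) y ⟩
      map ((a , v) ·_) y ++ map ((b , v) ·_) y
        ≈⟨ ++-congˡ {map ((a , v) ·_) y} (singleton-⊛ (b , v) y) ⟨
      ([ a , v ] ++ [ b , v ]) ⊛ y ∎
    ⊛-congʳ y (⊗-0 v) = begin
      [ K.0# , v ] ⊛ y       ≈⟨ singleton-⊛ _ y ⟩
      map ((K.0# , v) ·_) y  ≈⟨ map-zero (λ (c , w) → ∼-trans (⊗-cong (K.zeroˡ c) U.refl) (⊗-0 _)) y ⟩
      []                     ∎
    ⊛-congʳ y (balanced a c v) = ++-congʳ (map-pointwise step y)
      where
      step : ∀ t → [ (a K.* proj₁ c , v) · t ] ∼ [ (a , j.⟦ c ⟧ U.∙ v) · t ]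
      step (b , w) = begin
        [ (a K.* proj₁ c) K.* b , v U.∙ w ]
          ≈⟨ ⊗-cong (K.trans (K.*-assoc _ _ _) (K.trans (K.*-congˡ (K.*-comm _ _)) (K.sym (K.*-assoc _ _ _)))) U.refl ⟩
        [ (a K.* b) K.* proj₁ c , v U.∙ w ]
          ≈⟨ balanced (a K.* b) c (v U.∙ w) ⟩
        [ a K.* b , j.⟦ c ⟧ U.∙ (v U.∙ w) ]
          ≈⟨ ⊗-cong K.refl (U.assoc _ _ _) ⟨
        [ a K.* b , (j.⟦ c ⟧ U.∙ v) U.∙ w ] ∎

    ⊛-cong : ∀ {x x′ y y′} → x ∼ x′ → y ∼ y′ → x ⊛ y ∼ x′ ⊛ y′
    ⊛-cong {x} {x′} {y} {y′} e f = begin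
      x ⊛ y    ≈⟨ ⊛-congʳ y e ⟩
      x′ ⊛ y   ≈⟨ ⊛-comm x′ y ⟩
      y ⊛ x′   ≈⟨ ⊛-congʳ x′ f ⟩
      y′ ⊛ x′  ≈⟨ ⊛-comm y′ x′ ⟩
      x′ ⊛ y′  ∎

    map-⊛ : ∀ t y z → map (t ·_) y ⊛ z ∼ map (t ·_) (y ⊛ z)
    map-⊛ t []      z = ∼-refl
    map-⊛ t (s ∷ y) z = begin
      map ((t · s) ·_) z ++ map (t ·_) y ⊛ z
        ≈⟨ ++-cong (map-pointwise (λ _ → ⊗-cong (K.*-assoc _ _ _) (U.assoc _ _ _)) z) (map-⊛ t y z) ⟩
      map (λ r → t · (s · r)) z ++ map (t ·_) (y ⊛ z)
        ≈⟨ ++-congʳ (reflexive (map-∘ z)) ⟩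
      map (t ·_) (map (s ·_) z) ++ map (t ·_) (y ⊛ z)
        ≈⟨ reflexive (map-++ (t ·_) (map (s ·_) z) (y ⊛ z)) ⟨
      map (t ·_) ((s ∷ y) ⊛ z) ∎

    ⊛-assoc : ∀ x y z → (x ⊛ y) ⊛ z ∼ x ⊛ (y ⊛ z)
    ⊛-assoc []      y z = ∼-refl
    ⊛-assoc (t ∷ x) y z = begin
      (map (t ·_) y ++ x ⊛ y) ⊛ z         ≈⟨ ⊛-++ʳ (map (t ·_) y) (x ⊛ y) z ⟩
      map (t ·_) y ⊛ z ++ (x ⊛ y) ⊛ z     ≈⟨ ++-cong (map-⊛ t y z) (⊛-assoc x y z) ⟩
      map (t ·_) (y ⊛ z) ++ x ⊛ (y ⊛ z)   ∎

    ⊛-identityˡ : ∀ x → 1⊗1 ⊛ x ∼ x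
    ⊛-identityˡ x = ∼-trans (singleton-⊛ _ x)
      (map-id∼ (λ _ → ⊗-cong (K.*-identityˡ _) (U.identityˡ _)) x)

    ⊛-++ˡ : ∀ x y z → x ⊛ (y ++ z) ∼ x ⊛ y ++ x ⊛ z
    ⊛-++ˡ x y z = begin
      x ⊛ (y ++ z)    ≈⟨ ⊛-comm x (y ++ z) ⟩
      (y ++ z) ⊛ x    ≈⟨ ⊛-++ʳ y z x ⟩
      y ⊛ x ++ z ⊛ x  ≈⟨ ++-cong (⊛-comm y x) (⊛-comm z x) ⟩
      x ⊛ y ++ x ⊛ z  ∎

    open RingProperties K.ring using (-0#≈0#; -‿+-comm; -‿distribˡ-*)

    ⊖-cong : ∀ {x y} → x ∼ y → ⊖ x ∼ ⊖ y
    ⊖-cong ∼-refl        = ∼-refl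
    ⊖-cong (∼-sym e)     = ∼-sym (⊖-cong e)
    ⊖-cong (∼-trans e f) = ∼-trans (⊖-cong e) (⊖-cong f)
    ⊖-cong (++-cong {x} {x′} {y} {y′} e f) = begin
      ⊖ (x ++ y)      ≈⟨ reflexive (map-++ _ x y) ⟩
      ⊖ x ++ ⊖ y      ≈⟨ ++-cong (⊖-cong e) (⊖-cong f) ⟩
      ⊖ x′ ++ ⊖ y′    ≈⟨ reflexive (map-++ _ x′ y′) ⟨
      ⊖ (x′ ++ y′)    ∎
    ⊖-cong (++-comm x y) = begin
      ⊖ (x ++ y)  ≈⟨ reflexive (map-++ _ x y) ⟩
      ⊖ x ++ ⊖ y  ≈⟨ ++-comm (⊖ x) (⊖ y) ⟩
      ⊖ y ++ ⊖ x  ≈⟨ reflexive (map-++ _ y x) ⟨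
      ⊖ (y ++ x)  ∎
    ⊖-cong (⊗-cong a≈b v≈w)  = ⊗-cong (K.-‿cong a≈b) v≈w
    ⊖-cong (⊗-+ a b v)       = ∼-trans (⊗-cong (K.sym (-‿+-comm a b)) U.refl) (⊗-+ _ _ v)
    ⊖-cong (⊗-0 v)           = ∼-trans (⊗-cong -0#≈0# U.refl) (⊗-0 v)
    ⊖-cong (balanced a c v)  = ∼-trans (⊗-cong (-‿distribˡ-* a (proj₁ c)) U.refl) (balanced (K.- a) c v)

    ⊖-inverseˡ : ∀ x → ⊖ x ++ x ∼ []
    ⊖-inverseˡ []            = ∼-refl
    ⊖-inverseˡ ((a , v) ∷ x) = begin
      ([ K.- a , v ] ++ ⊖ x) ++ ([ a , v ] ++ x)  ≈⟨ interchange [ K.- a , v ] (⊖ x) [ a , v ] x ⟩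
      ([ K.- a , v ] ++ [ a , v ]) ++ (⊖ x ++ x)  ≈⟨ ++-cong cancel (⊖-inverseˡ x) ⟩
      []                                          ∎
      where
      cancel : [ K.- a , v ] ++ [ a , v ] ∼ []
      cancel = ∼-trans (∼-sym (⊗-+ (K.- a) a v))
                 (∼-trans (⊗-cong (K.-‿inverseˡ a) U.refl) (⊗-0 v))

  commutativeRing : CommutativeRing (k ⊔ u) (k ⊔ ℓk ⊔ u ⊔ ℓu)
  commutativeRing = record
    { Carrier = FormalSum
    ; _≈_     = _∼_
    ; _+_     = _++_
    ; _*_     = _⊛_
    ; -_      = ⊖_
    ; 0#      = []
    ; 1#      = 1⊗1
    ; isCommutativeRing = record
      { isRing = record
        { +-isAbelianGroup = record
          { isGroup = record
            { isMonoid = CommutativeMonoid.isMonoid +-commutativeMonoid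
            ; inverse  = ⊖-inverseˡ , (λ x → ∼-trans (++-comm x (⊖ x)) (⊖-inverseˡ x))
            ; ⁻¹-cong  = ⊖-cong
            }
          ; comm = ++-comm
          }
        ; *-cong     = ⊛-cong
        ; *-assoc    = ⊛-assoc
        ; *-identity = ⊛-identityˡ , (λ x → ∼-trans (⊛-comm x 1⊗1) (⊛-identityˡ x))
        ; distrib    = ⊛-++ˡ , (λ x y z → ⊛-++ʳ y z x)
        }
      ; *-comm = ⊛-comm
      }
    }

  K⟨U⟩ : Algebra K (k ⊔ u) (k ⊔ ℓk ⊔ u ⊔ ℓu)
  K⟨U⟩ = record
    { commutativeRing = commutativeRing
    ; structureMap    = record
      { ⟦_⟧ = λ a → [ a , U.ε ]
      ; isRingHomomorphism = record
        { isSemiringHomomorphism = record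
          { isNearSemiringHomomorphism = record
            { +-isMonoidHomomorphism = record
              { isMagmaHomomorphism = record
                { isRelHomomorphism = record { cong = λ a≈b → ⊗-cong a≈b U.refl }
                ; homo              = λ a b → ⊗-+ a b U.ε
                }
              ; ε-homo = ⊗-0 U.ε
              }
            ; *-homo = λ _ _ → ⊗-cong K.refl (U.sym (U.identityˡ U.ε))
            }
          ; 1#-homo = ∼-refl
          }
        ; -‿homo = λ _ → ∼-refl
        }
      }
    }

-- The canonical homomorphism K⟨U⟩ → B for ι : U → Bˣ compatible with Kˣ.
module Canonical
  {k ℓk u ℓu s ℓs : Level}
  (K : CommutativeRing k ℓk)
  (U : AbelianGroup u ℓu)
  (j : GroupHomomorphism (AbelianGroup.rawGroup (unitGroup K)) (AbelianGroup.rawGroup U))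
  (B : Algebra K s ℓs)
  (ι : GroupHomomorphism (AbelianGroup.rawGroup U)
                         (AbelianGroup.rawGroup (unitGroup (Algebra.commutativeRing B))))
  where

  open CrossedGroupAlgebra K U j

  private
    module K = CommutativeRing K
    module U = AbelianGroup U
    module j = GroupHomomorphism j
    module B = Algebra B
    module φ = RingHomomorphism B.structureMap
    module ι = GroupHomomorphism ι

  canonical : FormalSum → B.Carrier
  canonical []            = B.0#
  canonical ((a , v) ∷ x) = φ.⟦ a ⟧ B.* proj₁ ι.⟦ v ⟧ B.+ canonical x

  module _
    (compatible : ∀ c → proj₁ ι.⟦ j.⟦ c ⟧ ⟧ B.≈ φ.⟦ proj₁ c ⟧)
    where

    private
      open SetoidReasoning B.setoid
      open RingProperties (CommutativeRing.ring B.commutativeRing)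
        using (-0#≈0#) renaming (-‿+-comm to B-‿+-comm; -‿distribˡ-* to B-‿distribˡ-*)
      open CommutativeSemigroupProperties
        (CommutativeRing.*-commutativeSemigroup B.commutativeRing)
        renaming (interchange to *-interchange)

      value : K.Carrier × U.Carrier → B.Carrier
      value (a , v) = φ.⟦ a ⟧ B.* proj₁ ι.⟦ v ⟧

      canonical-++ : ∀ x y → canonical (x ++ y) B.≈ canonical x B.+ canonical y
      canonical-++ []      y = B.sym (B.+-identityˡ _)
      canonical-++ (t ∷ x) y = B.trans (B.+-congˡ (canonical-++ x y)) (B.sym (B.+-assoc _ _ _))

      value-cong : ∀ {a b v w} → a K.≈ b → v U.≈ w → value (a , v) B.≈ value (b , w)
      value-cong a≈b v≈w = B.*-cong (φ.⟦⟧-cong a≈b) (ι.⟦⟧-cong v≈w)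

      value-balanced : ∀ a c v → value (a K.* proj₁ c , v) B.≈ value (a , j.⟦ c ⟧ U.∙ v)
      value-balanced a c v = begin
        φ.⟦ a K.* proj₁ c ⟧ B.* proj₁ ι.⟦ v ⟧
          ≈⟨ B.*-congʳ (φ.*-homo _ _) ⟩
        (φ.⟦ a ⟧ B.* φ.⟦ proj₁ c ⟧) B.* proj₁ ι.⟦ v ⟧
          ≈⟨ B.*-congʳ (B.*-congˡ (compatible c)) ⟨
        (φ.⟦ a ⟧ B.* proj₁ ι.⟦ j.⟦ c ⟧ ⟧) B.* proj₁ ι.⟦ v ⟧
          ≈⟨ B.*-assoc _ _ _ ⟩
        φ.⟦ a ⟧ B.* (proj₁ ι.⟦ j.⟦ c ⟧ ⟧ B.* proj₁ ι.⟦ v ⟧)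
          ≈⟨ B.*-congˡ (ι.homo _ _) ⟨
        φ.⟦ a ⟧ B.* proj₁ ι.⟦ j.⟦ c ⟧ U.∙ v ⟧ ∎

      canonical-cong : ∀ {x y} → x ∼ y → canonical x B.≈ canonical y
      canonical-cong ∼-refl        = B.refl
      canonical-cong (∼-sym e)     = B.sym (canonical-cong e)
      canonical-cong (∼-trans e f) = B.trans (canonical-cong e) (canonical-cong f)
      canonical-cong (++-cong {x} {x′} {y} {y′} e f) = begin
        canonical (x ++ y)                ≈⟨ canonical-++ x y ⟩
        canonical x B.+ canonical y       ≈⟨ B.+-cong (canonical-cong e) (canonical-cong f) ⟩
        canonical x′ B.+ canonical y′     ≈⟨ canonical-++ x′ y′ ⟨
        canonical (x′ ++ y′)              ∎
      canonical-cong (++-comm x y) = begin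
        canonical (x ++ y)           ≈⟨ canonical-++ x y ⟩
        canonical x B.+ canonical y  ≈⟨ B.+-comm _ _ ⟩
        canonical y B.+ canonical x  ≈⟨ canonical-++ y x ⟨
        canonical (y ++ x)           ∎
      canonical-cong (⊗-cong a≈b v≈w) = B.+-congʳ (value-cong a≈b v≈w)
      canonical-cong (⊗-+ a b v) = begin
        value (a K.+ b , v) B.+ B.0#
          ≈⟨ B.+-congʳ (B.trans (B.*-congʳ (φ.+-homo a b)) (B.distribʳ _ _ _)) ⟩
        (value (a , v) B.+ value (b , v)) B.+ B.0#
          ≈⟨ B.+-assoc _ _ _ ⟩
        value (a , v) B.+ (value (b , v) B.+ B.0#) ∎
      canonical-cong (⊗-0 v) =
        B.trans (B.+-identityʳ _) (B.trans (B.*-congʳ φ.0#-homo) (B.zeroˡ _))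
      canonical-cong (balanced a c v) = B.+-congʳ (value-balanced a c v)

      value-· : ∀ s t → value (s · t) B.≈ value s B.* value t
      value-· (a , v) (b , w) =
        B.trans (B.*-cong (φ.*-homo a b) (ι.homo v w)) (*-interchange _ _ _ _)

      canonical-map : ∀ t y → canonical (map (t ·_) y) B.≈ value t B.* canonical y
      canonical-map t []      = B.sym (B.zeroʳ _)
      canonical-map t (s ∷ y) = begin
        value (t · s) B.+ canonical (map (t ·_) y)         ≈⟨ B.+-cong (value-· t s) (canonical-map t y) ⟩
        value t B.* value s B.+ value t B.* canonical y    ≈⟨ B.distribˡ _ _ _ ⟨
        value t B.* (value s B.+ canonical y)              ∎

      canonical-⊛ : ∀ x y → canonical (x ⊛ y) B.≈ canonical x B.* canonical y
      canonical-⊛ []      y = B.sym (B.zeroˡ _)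
      canonical-⊛ (t ∷ x) y = begin
        canonical (map (t ·_) y ++ x ⊛ y)
          ≈⟨ canonical-++ (map (t ·_) y) (x ⊛ y) ⟩
        canonical (map (t ·_) y) B.+ canonical (x ⊛ y)
          ≈⟨ B.+-cong (canonical-map t y) (canonical-⊛ x y) ⟩
        value t B.* canonical y B.+ canonical x B.* canonical y
          ≈⟨ B.distribʳ _ _ _ ⟨
        (value t B.+ canonical x) B.* canonical y ∎

      canonical-⊖ : ∀ x → canonical (⊖ x) B.≈ B.- canonical x
      canonical-⊖ []            = B.sym -0#≈0#
      canonical-⊖ ((a , v) ∷ x) = begin
        value (K.- a , v) B.+ canonical (⊖ x)
          ≈⟨ B.+-cong (B.trans (B.*-congʳ (φ.-‿homo a)) (B.sym (B-‿distribˡ-* _ _))) (canonical-⊖ x) ⟩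
        B.- value (a , v) B.+ B.- canonical x
          ≈⟨ B-‿+-comm _ _ ⟩
        B.- (value (a , v) B.+ canonical x) ∎

      canonical-scalar : ∀ a → canonical [ a , U.ε ] B.≈ φ.⟦ a ⟧
      canonical-scalar a =
        B.trans (B.+-identityʳ _) (B.trans (B.*-congˡ ι.ε-homo) (B.*-identityʳ _))

    canonical-isAlgebraHomomorphism : IsAlgebraHomomorphism K⟨U⟩ B canonical
    canonical-isAlgebraHomomorphism = record
      { isRingHomomorphism = record
        { isSemiringHomomorphism = record
          { isNearSemiringHomomorphism = record
            { +-isMonoidHomomorphism = record
              { isMagmaHomomorphism = record
                { isRelHomomorphism = record { cong = canonical-cong }
                ; homo              = canonical-++
                }
              ; ε-homo = B.refl
              }
            ; *-homo = canonical-⊛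
            }
          ; 1#-homo = B.trans (canonical-scalar K.1#) φ.1#-homo
          }
        ; -‿homo = canonical-⊖
        }
      ; algebraMap-homo = canonical-scalar
      }

-- Fields are Heyting fields; when excluded middle is available, x # y is
-- equivalent to ¬ x ≈ y, so that these are just the classical fields.
fieldRing : ∀ {c ℓ₁ ℓ₂} → HeytingField c ℓ₁ ℓ₂ → CommutativeRing c ℓ₁
fieldRing F = HeytingCommutativeRing.commutativeRing (HeytingField.heytingCommutativeRing F)

-- L|K is given by a ring homomorphism K → L, which is automatically injective.
module FieldExtension
  {k ℓk k′ l ℓl l′ : Level}
  (K : HeytingField k ℓk k′)
  (L : HeytingField l ℓl l′)
  (φ : RingHomomorphism (CommutativeRing.rawRing (fieldRing K))
                        (CommutativeRing.rawRing (fieldRing L)))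
  where

  algebra : Algebra (fieldRing K) l ℓl
  algebra = record { commutativeRing = fieldRing L ; structureMap = φ }

  Kˣ : AbelianGroup (k ⊔ ℓk) ℓk
  Kˣ = unitGroup (fieldRing K)

  Lˣ : AbelianGroup (l ⊔ ℓl) ℓl
  Lˣ = unitGroup (fieldRing L)

  private
    module Kˣ = AbelianGroup Kˣ
    module Lˣ = AbelianGroup Lˣ
    module φˣ = GroupHomomorphism (unitMap algebra)

  InKˣ : Pred Lˣ.Carrier (k ⊔ ℓk ⊔ ℓl)
  InKˣ x = Σ[ a ∈ Kˣ.Carrier ] φˣ.⟦ a ⟧ Lˣ.≈ x

  InKˣ-isSubgroup : IsSubgroup Lˣ InKˣ
  InKˣ-isSubgroup = record
    { resp      = λ {x} {y} x≈y (a , e) → a , Lˣ.trans {φˣ.⟦ a ⟧} {x} {y} e x≈y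
    ; ε-closed  = Kˣ.ε , φˣ.ε-homo
    ; ∙-closed  = λ {x} {y} (a , e) (b , f) → a Kˣ.∙ b ,
        Lˣ.trans {φˣ.⟦ a Kˣ.∙ b ⟧} {φˣ.⟦ a ⟧ Lˣ.∙ φˣ.⟦ b ⟧} {x Lˣ.∙ y}
          (φˣ.homo a b) (Lˣ.∙-cong {φˣ.⟦ a ⟧} {x} {φˣ.⟦ b ⟧} {y} e f)
    ; ⁻¹-closed = λ {x} (a , e) → a Kˣ.⁻¹ , Lˣ.⁻¹-cong {φˣ.⟦ a ⟧} {x} e
    }

  Lˣ/Kˣ : AbelianGroup (l ⊔ ℓl) (k ⊔ ℓk ⊔ ℓl)
  Lˣ/Kˣ = quotient Lˣ InKˣ InKˣ-isSubgroup

  InT : Pred Lˣ.Carrier (k ⊔ ℓk ⊔ ℓl)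
  InT x = ∃[ n ] n ≥ 1 × InKˣ (power Lˣ x n)

  InT-isSubgroup : IsSubgroup Lˣ InT
  InT-isSubgroup = record
    { resp      = λ {x} {y} x≈y (n , n≥1 , h) →
        n , n≥1 , H.resp {power Lˣ x n} {power Lˣ y n} (×-congʳ n {x} {y} x≈y) h
    ; ε-closed  = 1 , ℕₚ.≤-refl ,
        H.resp {Lˣ.ε} {power Lˣ Lˣ.ε 1} (Lˣ.sym {power Lˣ Lˣ.ε 1} {Lˣ.ε} (Lˣ.identityʳ Lˣ.ε)) H.ε-closed
    ; ∙-closed  = λ {x} {y} (m , m≥1 , h) (n , n≥1 , h′) →
        m ℕ.* n , ℕₚ.*-mono-≤ m≥1 n≥1 ,
        H.resp {power Lˣ x (m ℕ.* n) Lˣ.∙ power Lˣ y (m ℕ.* n)} {power Lˣ (x Lˣ.∙ y) (m ℕ.* n)}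
          (Lˣ.sym {power Lˣ (x Lˣ.∙ y) (m ℕ.* n)} {power Lˣ x (m ℕ.* n) Lˣ.∙ power Lˣ y (m ℕ.* n)}
            (×-distrib-+ x y (m ℕ.* n)))
          (H.∙-closed {power Lˣ x (m ℕ.* n)} {power Lˣ y (m ℕ.* n)}
            (≡.subst (λ i → InKˣ (power Lˣ x i)) (ℕₚ.*-comm n m) (multiple x n m h))
            (multiple y m n h′))
    ; ⁻¹-closed = λ {x} (n , n≥1 , h) → n , n≥1 ,
        H.resp {power Lˣ x n Lˣ.⁻¹} {power Lˣ (x Lˣ.⁻¹) n}
          (Lˣ.sym {power Lˣ (x Lˣ.⁻¹) n} {power Lˣ x n Lˣ.⁻¹} (power-⁻¹ x n))
          (H.⁻¹-closed {power Lˣ x n} h)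
    }
    where
    module H = IsSubgroup InKˣ-isSubgroup
    open MonoidMult Lˣ.monoid using (×-congʳ; ×-assocˡ)
    open CommutativeMonoidMult Lˣ.commutativeMonoid using (×-distrib-+)
    open AbelianGroupProperties Lˣ using (⁻¹-∙-comm; ε⁻¹≈ε)

    power-closed : ∀ x m → InKˣ x → InKˣ (power Lˣ x m)
    power-closed x zero    h = H.ε-closed
    power-closed x (suc m) h = H.∙-closed {x} {power Lˣ x m} h (power-closed x m h)

    multiple : ∀ x m n → InKˣ (power Lˣ x n) → InKˣ (power Lˣ x (m ℕ.* n))
    multiple x m n h =
      H.resp {power Lˣ (power Lˣ x n) m} {power Lˣ x (m ℕ.* n)} (×-assocˡ x m n)
        (power-closed (power Lˣ x n) m h)

    power-⁻¹ : ∀ x n → power Lˣ (x Lˣ.⁻¹) n Lˣ.≈ power Lˣ x n Lˣ.⁻¹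
    power-⁻¹ x zero    = Lˣ.sym {Lˣ.ε Lˣ.⁻¹} {Lˣ.ε} ε⁻¹≈ε
    power-⁻¹ x (suc n) =
      Lˣ.trans {x Lˣ.⁻¹ Lˣ.∙ power Lˣ (x Lˣ.⁻¹) n} {x Lˣ.⁻¹ Lˣ.∙ power Lˣ x n Lˣ.⁻¹}
        {(x Lˣ.∙ power Lˣ x n) Lˣ.⁻¹}
        (Lˣ.∙-congˡ {x Lˣ.⁻¹} {power Lˣ (x Lˣ.⁻¹) n} {power Lˣ x n Lˣ.⁻¹} (power-⁻¹ x n))
        (⁻¹-∙-comm x (power Lˣ x n))

  T : AbelianGroup (k ⊔ ℓk ⊔ l ⊔ ℓl) ℓl
  T = subgroup Lˣ InT InT-isSubgroup

  private
    module T = AbelianGroup T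

  KˣinT : Pred T.Carrier (k ⊔ ℓk ⊔ ℓl)
  KˣinT x = InKˣ (proj₁ x)

  TinL : Pred (HeytingField.Carrier L) (k ⊔ ℓk ⊔ l ⊔ ℓl)
  TinL y = Σ[ x ∈ T.Carrier ] HeytingField._≈_ L (proj₁ (proj₁ x)) y

  Kˣ→T : GroupHomomorphism Kˣ.rawGroup T.rawGroup
  Kˣ→T = record
    { ⟦_⟧ = λ a → φˣ.⟦ a ⟧ , 1 , ℕₚ.≤-refl , a ,
        Lˣ.sym {power Lˣ φˣ.⟦ a ⟧ 1} {φˣ.⟦ a ⟧} (Lˣ.identityʳ φˣ.⟦ a ⟧)
    ; isGroupHomomorphism = record
      { isMonoidHomomorphism = record
        { isMagmaHomomorphism = record
          { isRelHomomorphism = record { cong = λ {a} {b} → φˣ.⟦⟧-cong {a} {b} }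
          ; homo = φˣ.homo
          }
        ; ε-homo = φˣ.ε-homo
        }
      ; ⁻¹-homo = φˣ.⁻¹-homo
      }
    }

  T→Lˣ : GroupHomomorphism T.rawGroup Lˣ.rawGroup
  T→Lˣ = record
    { ⟦_⟧ = proj₁
    ; isGroupHomomorphism = record
      { isMonoidHomomorphism = record
        { isMagmaHomomorphism = record
          { isRelHomomorphism = record { cong = λ e → e }
          ; homo = λ x y → Lˣ.refl {proj₁ x Lˣ.∙ proj₁ y}
          }
        ; ε-homo = Lˣ.refl {Lˣ.ε}
        }
      ; ⁻¹-homo = λ x → Lˣ.refl {proj₁ x Lˣ.⁻¹}
      }
    }

  open CrossedGroupAlgebra (fieldRing K) T Kˣ→T public
    using () renaming (K⟨U⟩ to K⟨T⟩)

  open Canonical (fieldRing K) T Kˣ→T algebra T→Lˣ public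
    using () renaming (canonical to K⟨T⟩→L)

  K⟨T⟩→L-isAlgebraHomomorphism : IsAlgebraHomomorphism K⟨T⟩ algebra K⟨T⟩→L
  K⟨T⟩→L-isAlgebraHomomorphism =
    Canonical.canonical-isAlgebraHomomorphism (fieldRing K) T Kˣ→T algebra T→Lˣ
      (λ a → HeytingField.refl L)

  AbsolutelyCoGalois : Set (k ⊔ ℓk ⊔ l ⊔ ℓl)
  AbsolutelyCoGalois = IsAlgebraIsomorphism K⟨T⟩ algebra K⟨T⟩→L

{-# OPTIONS --safe #-}

-- If K⟨T⟩ → L is an isomorphism, elements of T in distinct classes modulo Kˣ
-- are linearly independent over K.  For a root of unity ζ ∉ K of prime order p
-- this contradicts 1 + ζ + ⋯ + ζᵖ⁻¹ = 0; for x ∈ T outside K it contradicts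
-- 1 + x - (1 + x) = 0 as soon as 1 + x ∈ T, which is the case for x = i, where
-- (1 + i)⁴ = -4, and for xᵖ ∈ K in characteristic p.
--
-- Conversely (a theorem of Kneser), the elements of T occurring in a relation
-- lie in the top of a tower of steps M ⊆ M(y) with y ∈ T ∖ M, yᵖ ∈ M and p prime,
-- and a relation splits into its parts in the classes modulo Mˣ, by descent
-- along the tower.  One step of the descent needs that 1, y, …, yᵖ⁻¹ are
-- independent over M and that T ∩ M(y) ⊆ ⟨y⟩M.  The first assertion follows from
-- a norm: if y has degree d over M, then yᵈ is an element of M up to a p-th root
-- of unity, all of which lie in K.  For the second, let z ∈ T ∩ M(y), z ∉ M and
-- z^q ∈ ⟨y⟩M with q prime.  Then M(z) = M(y), and taking norms shows that zᵖ ∈ M,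
-- where i ∈ K is needed for p = 2; comparing the traces of z yʲ in the bases of
-- powers of y and of z yʲ yields z ∈ ⟨y⟩M.

module Submission where

open import Defs
open import Data.Nat.Base using (ℕ; _>_)
open import Data.Product.Base using (_×_)
open import Function.Bundles using (_⇔_)
open import Algebra.Bundles using (AbelianGroup; CommutativeRing)
open import Algebra.Apartness.Bundles using (HeytingField)
open import Algebra.Morphism.Bundles using (RingHomomorphism)
open import Axiom.ExcludedMiddle using (ExcludedMiddle)

open import Level using (Level; _⊔_; Lift; lift) renaming (suc to lsuc)
open import Algebra.Bundles using (CommutativeSemiring; Monoid)
open import Algebra.Morphism.Structures using (IsRingHomomorphism; IsRingIsomorphism)
open import Data.Empty using (⊥-elim)
open import Data.Fin.Base as Fin using (Fin; zero; suc; toℕ; inject₁; fromℕ; punchIn)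
open import Data.Fin.Properties as Finₚ using (toℕ-inject₁; toℕ-fromℕ; toℕ<n; punchInᵢ≢i)
open import Data.Fin.Relation.Unary.Top using (view; ‵fromℕ; ‵inject₁)
open import Data.List.Base using (List; []; _∷_; _++_; [_]; map; length; tabulate)
open import Data.List.Properties using (++-assoc; tabulate-cong)
open import Data.List.Relation.Unary.All as All using (All; []; _∷_)
open import Data.Nat.Base as ℕ using (zero; suc; _≤_; _<_; z≤n; s≤s; z<s; s<s)
open import Data.Nat.Combinatorics using (nC1≡n; nCn≡1; nCk+nC[k+1]≡[n+1]C[k+1]) renaming (_C_ to _choose_)
open import Data.Nat.Coprimality using (Coprime; prime⇒coprime; coprime⇒GCD≡1)
open import Data.Nat.Divisibility using (_∣_; divides; _∣?_; ∣-refl; ∣-antisym; ∣⇒≤; m∣m*n; ∣m+n∣m⇒∣n)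
open import Data.Nat.DivMod using (_%_; _/_; m≡m%n+[m/n]*n; m%n<n)
open import Data.Nat.GCD using (module Bézout)
open import Data.Nat.Induction using (<-rec)
open import Data.Nat.ListAction using (product)
open import Data.Nat.Primality as Primality using (Prime; prime[2]; euclidsLemma; prime⇒irreducible; irreducible⇒prime; prime⇒nonTrivial)
open import Data.Nat.Primality.Factorisation using (factorise; PrimeFactorisation)
import Data.Nat.Properties as ℕₚ
open import Data.Nat.Solver using (module +-*-Solver)
open import Data.Product.Base using (_,_; ∃-syntax; Σ-syntax; proj₁; proj₂)
open import Data.Sum.Base using (inj₁; inj₂)
open import Data.Vec.Functional using (Vector; insertAt; tail; init; last) renaming (_∷_ to _∷ᵛ_)
open import Data.Vec.Functional.Properties using (insertAt-lookup; insertAt-punchIn)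
open import Function.Base using (_∘_; id; case_of_)
open import Function.Bundles using (mk⇔; Equivalence)
open import Relation.Binary.PropositionalEquality as ≡ using (_≡_; _≢_)
open import Relation.Nullary using (¬_; Dec; yes; no)
open import Relation.Nullary.Decidable using (decidable-stable)
open import Relation.Unary using (Pred; _∩_)
import Algebra.Properties.CommutativeSemiring.Binomial as Binomial
import Algebra.Properties.CommutativeSemiring.Exp as Exp
import Algebra.Properties.Group as GroupProperties
import Algebra.Properties.Monoid.Mult as MonoidMult
import Algebra.Properties.Ring as RingProperties
import Algebra.Properties.Semiring.Mult as SemiringMult
import Algebra.Properties.Semiring.Sum as Sum
import Algebra.Solver.Ring.NaturalCoefficients.Default as SemiringSolver
import Relation.Binary.Reasoning.Setoid as SetoidReasoning

-- Alternating forms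

-- All fields in the argument are subfields of `L`, and linear maps are given by coordinates.
-- Conjugation over M becomes a relation, the graph of y ↦ y′ on expressions in y; the norm of y
-- becomes a determinant of coordinate vectors, compared with y ^ d only through powers: N ^ m = (y
-- ^ d) ^ m once y ^ m ∈ M. The resulting ambiguity is an m-th root of unity, and this is what
-- essentiality controls, since it puts all roots of unity of prime order of `L` into `K`. The
-- exponent m = d² is the one place where prime orders do not suffice. There the product over all
-- conjugates settles odd d, because d divides 0 + 1 + ⋯ + (d-1), and for d = 2 the fourth roots of
-- unity are used. The condition on the ℓ-primary component keeps d nonzero in the field; otherwise
-- d a₀ = 0 would carry no information.
--
-- K⟨T⟩ is presented by generators and relations, so its elements are tested by class sums: these
-- respect the relations, and a formal sum all of whose class sums vanish is zero.

module AlternatingForms {c ℓ} (R : CommutativeRing c ℓ) (d : ℕ) where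
  open CommutativeRing R hiding (zero)
  open SemiringSolver commutativeSemiring using (solve; _:+_; _:*_; _:=_; con)
  open Exp commutativeSemiring using (_^_; ^-congˡ)
  open Sum semiring using (sum)
  open SetoidReasoning setoid

  V : Set c
  V = Vector Carrier d

  -- Arguments form a list of any length: expansion along the first argument changes their number,
  -- and a position is addressed as `us ++ v ∷ vs` without casts.
  Form : Set c
  Form = List V → Carrier

  infix 4 _≐_+_·_
  -- Vectors are functions without extensionality. Linearity in this relational form also makes a
  -- form respect pointwise equality, as `scale` shows.
  _≐_+_·_ : V → V → Carrier → V → Set ℓ
  v ≐ w + a · x = ∀ i → v i ≈ w i + a * x i

  record IsAlternating (F : Form) : Set (c ⊔ ℓ) where
    field
      linear      : ∀ us vs {v w a x} → v ≐ w + a · x →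
                    F (us ++ v ∷ vs) ≈ F (us ++ w ∷ vs) + a * F (us ++ x ∷ vs)
      alternating : ∀ us v vs → F (us ++ v ∷ v ∷ vs) ≈ 0#

  -- The sign -1 as an atom: the solver works in semirings, and 1 + ε = 0 is supplied by hand.
  ε : Carrier
  ε = - 1#

  1+ε≈0 : 1# + ε ≈ 0#
  1+ε≈0 = -‿inverseʳ 1#

  x+εx≈0 : ∀ x → x + ε * x ≈ 0#
  x+εx≈0 x = begin
    x + ε * x        ≈⟨ solve 2 (λ x e → x :+ e :* x := (con 1 :+ e) :* x) refl x ε ⟩
    (1# + ε) * x     ≈⟨ *-congʳ 1+ε≈0 ⟩
    0# * x           ≈⟨ zeroˡ x ⟩
    0#               ∎

  -- wedge i F [] is the product of the i-th coordinate form with F,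
  -- expanded along the first argument.
  wedge : Fin d → Form → List V → Form
  wedge i F us []       = 0#
  wedge i F us (v ∷ vs) = v i * F (us ++ vs) + ε * wedge i F (us ++ [ v ]) vs

  module _ {F : Form} (altF : IsAlternating F) (i : Fin d) where
    open IsAlternating altF

    private
      W = wedge i F

      W-snoc : ∀ us v xs ys → W ((us ++ v ∷ xs) ++ [ ys ]) ≡ W (us ++ v ∷ (xs ++ [ ys ]))
      W-snoc us v xs ys = ≡.cong W (++-assoc us (v ∷ xs) [ ys ])

    wedge-linearˡ : ∀ us ws vs {v w a x} → v ≐ w + a · x →
                    W (us ++ v ∷ ws) vs ≈ W (us ++ w ∷ ws) vs + a * W (us ++ x ∷ ws) vs
    wedge-linearˡ us ws [] {a = a} e = sym (trans (+-identityˡ _) (zeroʳ a))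
    wedge-linearˡ us ws (u ∷ vs) {v} {w} {a} {x} e
      rewrite W-snoc us v ws u | W-snoc us w ws u | W-snoc us x ws u
            | ++-assoc us (v ∷ ws) vs | ++-assoc us (w ∷ ws) vs | ++-assoc us (x ∷ ws) vs = begin
      u i * F (us ++ v ∷ (ws ++ vs)) + ε * W (us ++ v ∷ (ws ++ [ u ])) vs
        ≈⟨ +-cong (*-congˡ (linear us (ws ++ vs) e)) (*-congˡ (wedge-linearˡ us (ws ++ [ u ]) vs e)) ⟩
      u i * (A + a * B) + ε * (C + a * D)
        ≈⟨ solve 7 (λ u A B C D a e → u :* (A :+ a :* B) :+ e :* (C :+ a :* D)
                      := (u :* A :+ e :* C) :+ a :* (u :* B :+ e :* D)) refl (u i) A B C D a ε ⟩
      (u i * A + ε * C) + a * (u i * B + ε * D) ∎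
      where
      A = F (us ++ w ∷ (ws ++ vs))
      B = F (us ++ x ∷ (ws ++ vs))
      C = W (us ++ w ∷ (ws ++ [ u ])) vs
      D = W (us ++ x ∷ (ws ++ [ u ])) vs

    wedge-linearʳ : ∀ us xs vs {v w a x} → v ≐ w + a · x →
                    W us (xs ++ v ∷ vs) ≈ W us (xs ++ w ∷ vs) + a * W us (xs ++ x ∷ vs)
    wedge-linearʳ us [] vs {v} {w} {a} {x} e = begin
      v i * A + ε * W (us ++ [ v ]) vs
        ≈⟨ +-cong (*-congʳ (e i)) (*-congˡ (wedge-linearˡ us [] vs e)) ⟩
      (w i + a * x i) * A + ε * (B + a * C)
        ≈⟨ solve 7 (λ w x A B C a e → (w :+ a :* x) :* A :+ e :* (B :+ a :* C)
                      := (w :* A :+ e :* B) :+ a :* (x :* A :+ e :* C)) refl (w i) (x i) A B C a ε ⟩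
      (w i * A + ε * B) + a * (x i * A + ε * C) ∎
      where
      A = F (us ++ vs)
      B = W (us ++ [ w ]) vs
      C = W (us ++ [ x ]) vs
    wedge-linearʳ us (y ∷ xs) vs {v} {w} {a} {x} e
      rewrite ≡.sym (++-assoc us xs (v ∷ vs)) | ≡.sym (++-assoc us xs (w ∷ vs))
            | ≡.sym (++-assoc us xs (x ∷ vs)) = begin
      y i * F ((us ++ xs) ++ v ∷ vs) + ε * W (us ++ [ y ]) (xs ++ v ∷ vs)
        ≈⟨ +-cong (*-congˡ (linear (us ++ xs) vs e)) (*-congˡ (wedge-linearʳ (us ++ [ y ]) xs vs e)) ⟩
      y i * (A + a * B) + ε * (C + a * D)
        ≈⟨ solve 7 (λ u A B C D a e → u :* (A :+ a :* B) :+ e :* (C :+ a :* D)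
                      := (u :* A :+ e :* C) :+ a :* (u :* B :+ e :* D)) refl (y i) A B C D a ε ⟩
      (y i * A + ε * C) + a * (y i * B + ε * D) ∎
      where
      A = F ((us ++ xs) ++ w ∷ vs)
      B = F ((us ++ xs) ++ x ∷ vs)
      C = W (us ++ [ y ]) (xs ++ w ∷ vs)
      D = W (us ++ [ y ]) (xs ++ x ∷ vs)

    private
      both-zero : ∀ a {x y} → x ≈ 0# → y ≈ 0# → a * x + ε * y ≈ 0#
      both-zero a {x} {y} x≈0 y≈0 = begin
        a * x + ε * y   ≈⟨ +-cong (*-congˡ x≈0) (*-congˡ y≈0) ⟩
        a * 0# + ε * 0# ≈⟨ +-cong (zeroʳ a) (zeroʳ ε) ⟩
        0# + 0#         ≈⟨ +-identityˡ 0# ⟩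
        0#              ∎

    wedge-alternatingˡ : ∀ us v ws vs → W (us ++ v ∷ v ∷ ws) vs ≈ 0#
    wedge-alternatingˡ us v ws []       = refl
    wedge-alternatingˡ us v ws (u ∷ vs)
      rewrite W-snoc us v (v ∷ ws) u | ++-assoc us (v ∷ v ∷ ws) vs =
      both-zero (u i) (alternating us v (ws ++ vs)) (wedge-alternatingˡ us v (ws ++ [ u ]) vs)

    -- The two terms that pull out one of the equal neighbours have opposite signs and cancel; in
    -- the remaining term both are arguments of `F`.
    wedge-alternatingʳ : ∀ us xs v vs → W us (xs ++ v ∷ v ∷ vs) ≈ 0#
    wedge-alternatingʳ us [] v vs
      rewrite ++-assoc us [ v ] vs | ++-assoc us [ v ] [ v ] = begin
      v i * A + ε * (v i * A + ε * W (us ++ v ∷ v ∷ []) vs)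
        ≈⟨ +-congˡ (*-congˡ (+-congˡ (*-congˡ (wedge-alternatingˡ us v [] vs)))) ⟩
      v i * A + ε * (v i * A + ε * 0#)
        ≈⟨ +-congˡ (*-congˡ (trans (+-congˡ (zeroʳ ε)) (+-identityʳ _))) ⟩
      v i * A + ε * (v i * A)
        ≈⟨ x+εx≈0 _ ⟩
      0# ∎
      where A = F (us ++ v ∷ vs)
    wedge-alternatingʳ us (x ∷ xs) v vs rewrite ≡.sym (++-assoc us xs (v ∷ v ∷ vs)) =
      both-zero (x i) (alternating (us ++ xs) v vs) (wedge-alternatingʳ (us ++ [ x ]) xs v vs)

    wedge-isAlternating : IsAlternating (wedge i F [])
    wedge-isAlternating = record
      { linear      = wedge-linearʳ []
      ; alternating = wedge-alternatingʳ []
      }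

  wedge-zero : ∀ F i us {m} (w : Fin m → V) → (∀ j → w j i ≈ 0#) → wedge i F us (tabulate w) ≈ 0#
  wedge-zero F i us {zero}  w w≈0 = refl
  wedge-zero F i us {suc m} w w≈0 = begin
    w zero i * _ + ε * _   ≈⟨ +-cong (*-congʳ (w≈0 zero)) (*-congˡ (wedge-zero F i _ (w ∘ suc) (w≈0 ∘ suc))) ⟩
    0# * _ + ε * 0#        ≈⟨ +-cong (zeroˡ _) (zeroʳ ε) ⟩
    0# + 0#                ≈⟨ +-identityˡ 0# ⟩
    0#                     ∎

  -- The m × m minor on the coordinates `f`. It vanishes on lists of any other length, which makes
  -- it alternating on all lists.
  minor : ∀ m → (Fin m → Fin d) → Form
  minor zero    f []      = 1#
  minor zero    f (_ ∷ _) = 0#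
  minor (suc m) f         = wedge (f zero) (minor m (f ∘ suc)) []

  minor-isAlternating : ∀ m f → IsAlternating (minor m f)
  minor-isAlternating zero f = record
    { linear      = λ { []       vs {a = a} e → sym (trans (+-identityˡ _) (zeroʳ a))
                      ; (_ ∷ us) vs {a = a} e → sym (trans (+-identityˡ _) (zeroʳ a)) }
    ; alternating = λ { [] v vs → refl ; (_ ∷ us) v vs → refl }
    }
  minor-isAlternating (suc m) f = wedge-isAlternating (minor-isAlternating m (f ∘ suc)) (f zero)

  minor-identity : ∀ m (f : Fin m → Fin d) (w : Fin m → V) →
                   (∀ i → w i (f i) ≈ 1#) → (∀ i j → i ≢ j → w j (f i) ≈ 0#) →
                   minor m f (tabulate w) ≈ 1#
  minor-identity zero    f w diag off = refl
  minor-identity (suc m) f w diag off = begin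
    w zero (f zero) * minor m (f ∘ suc) (tabulate (w ∘ suc)) + ε * _
      ≈⟨ +-cong (*-cong (diag zero) (minor-identity m (f ∘ suc) (w ∘ suc) (diag ∘ suc)
                  (λ i j i≢j → off (suc i) (suc j) (λ { ≡.refl → i≢j ≡.refl }))))
                (*-congˡ (wedge-zero _ (f zero) _ (w ∘ suc) (λ j → off zero (suc j) λ ()))) ⟩
    1# * 1# + ε * 0#  ≈⟨ +-cong (*-identityˡ 1#) (zeroʳ ε) ⟩
    1# + 0#           ≈⟨ +-identityʳ 1# ⟩
    1#                ∎

  module _ {F : Form} (altF : IsAlternating F) where
    open IsAlternating altF

    private
      _⊕_ : V → V → V
      (v ⊕ w) i = v i + w i

      ⊕-≐ : ∀ v w → v ⊕ w ≐ v + 1# · w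
      ⊕-≐ v w i = +-congˡ (sym (*-identityˡ (w i)))

    -- Polarisation: expand the value 0 at the equal neighbours v + w, v + w.
    swap : ∀ us v w vs → F (us ++ v ∷ w ∷ vs) ≈ ε * F (us ++ w ∷ v ∷ vs)
    swap us v w vs = begin
      A                      ≈⟨ +-identityʳ A ⟨
      A + 0#                 ≈⟨ +-congˡ (x+εx≈0 B) ⟨
      A + (B + ε * B)        ≈⟨ +-assoc A B _ ⟨
      (A + B) + ε * B        ≈⟨ +-congʳ A+B≈0 ⟩
      0# + ε * B             ≈⟨ +-identityˡ _ ⟩
      ε * B                  ∎
      where
      A = F (us ++ v ∷ w ∷ vs)
      B = F (us ++ w ∷ v ∷ vs)

      second : ∀ u → F (us ++ u ∷ (v ⊕ w) ∷ vs) ≈ F (us ++ u ∷ v ∷ vs) + 1# * F (us ++ u ∷ w ∷ vs)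
      second u rewrite ≡.sym (++-assoc us [ u ] ((v ⊕ w) ∷ vs)) | ≡.sym (++-assoc us [ u ] (v ∷ vs))
                     | ≡.sym (++-assoc us [ u ] (w ∷ vs)) = linear (us ++ [ u ]) vs (⊕-≐ v w)

      A+B≈0 : A + B ≈ 0#
      A+B≈0 = begin
        A + B
          ≈⟨ solve 2 (λ a b → a :+ b := (con 0 :+ con 1 :* a) :+ con 1 :* (b :+ con 1 :* con 0)) refl A B ⟩
        (0# + 1# * A) + 1# * (B + 1# * 0#)
          ≈⟨ +-cong (+-congʳ (alternating us v vs)) (*-congˡ (+-congˡ (*-congˡ (alternating us w vs)))) ⟨
        (F (us ++ v ∷ v ∷ vs) + 1# * A) + 1# * (B + 1# * F (us ++ w ∷ w ∷ vs))
          ≈⟨ +-cong (second v) (*-congˡ (second w)) ⟨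
        F (us ++ v ∷ (v ⊕ w) ∷ vs) + 1# * F (us ++ w ∷ (v ⊕ w) ∷ vs)
          ≈⟨ linear us _ (⊕-≐ v w) ⟨
        F (us ++ (v ⊕ w) ∷ (v ⊕ w) ∷ vs)
          ≈⟨ alternating us (v ⊕ w) vs ⟩
        0# ∎

    repeated : ∀ us v ws vs → F (us ++ v ∷ (ws ++ v ∷ vs)) ≈ 0#
    repeated us v []       vs = alternating us v vs
    repeated us v (w ∷ ws) vs = begin
      F (us ++ v ∷ w ∷ (ws ++ v ∷ vs))          ≈⟨ swap us v w _ ⟩
      ε * F (us ++ w ∷ v ∷ (ws ++ v ∷ vs))      ≡⟨ ≡.cong (λ t → ε * F t) (++-assoc us [ w ] _) ⟨
      ε * F ((us ++ [ w ]) ++ v ∷ (ws ++ v ∷ vs)) ≈⟨ *-congˡ (repeated (us ++ [ w ]) v ws vs) ⟩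
      ε * 0#                                    ≈⟨ zeroʳ ε ⟩
      0#                                        ∎

    rotate : ∀ us v {m} (w : Fin m → V) → F (us ++ (tabulate w ++ [ v ])) ≈ ε ^ m * F (us ++ v ∷ tabulate w)
    rotate us v {zero}  w = sym (*-identityˡ _)
    rotate us v {suc m} w = begin
      F (us ++ w zero ∷ (ws ++ [ v ]))             ≡⟨ ≡.cong F (++-assoc us [ w zero ] _) ⟨
      F ((us ++ [ w zero ]) ++ (ws ++ [ v ]))      ≈⟨ rotate (us ++ [ w zero ]) v (w ∘ suc) ⟩
      ε ^ m * F ((us ++ [ w zero ]) ++ v ∷ ws)     ≡⟨ ≡.cong (λ t → ε ^ m * F t) (++-assoc us [ w zero ] _) ⟩
      ε ^ m * F (us ++ w zero ∷ v ∷ ws)            ≈⟨ *-congˡ (swap us (w zero) v ws) ⟩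
      ε ^ m * (ε * F (us ++ v ∷ w zero ∷ ws))      ≈⟨ solve 3 (λ a b c → a :* (b :* c) := (b :* a) :* c) refl (ε ^ m) ε _ ⟩
      ε * ε ^ m * F (us ++ v ∷ w zero ∷ ws)        ∎
      where ws = tabulate (w ∘ suc)

    repeated-last : ∀ us {m} (w : Fin m → V) j → F (us ++ (tabulate w ++ [ w j ])) ≈ 0#
    repeated-last us w zero    = repeated us (w zero) (tabulate (w ∘ suc)) []
    repeated-last us w (suc j) = begin
      F (us ++ w zero ∷ (ws ++ [ w (suc j) ]))        ≡⟨ ≡.cong F (++-assoc us [ w zero ] _) ⟨
      F ((us ++ [ w zero ]) ++ (ws ++ [ w (suc j) ])) ≈⟨ repeated-last (us ++ [ w zero ]) (w ∘ suc) j ⟩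
      0#                                              ∎
      where ws = tabulate (w ∘ suc)

    scale : ∀ us vs {v a x} → (∀ i → v i ≈ a * x i) → F (us ++ v ∷ vs) ≈ a * F (us ++ x ∷ vs)
    scale us vs {v} {a} {x} v≈ax = begin
      F (us ++ v ∷ vs)                        ≈⟨ linear us vs (λ i → trans (v≈ax i) (sym (+-identityˡ _))) ⟩
      F (us ++ z ∷ vs) + a * F (us ++ x ∷ vs) ≈⟨ +-congʳ zeroF ⟩
      0# + a * F (us ++ x ∷ vs)               ≈⟨ +-identityˡ _ ⟩
      a * F (us ++ x ∷ vs)                    ∎
      where
      z : V
      z _ = 0#

      -- The zero vector is z + (-1) z, so its value satisfies B = B - B.
      zeroF : F (us ++ z ∷ vs) ≈ 0#
      zeroF = begin
        B                      ≈⟨ linear us vs {w = z} {a = ε} {x = z} (λ _ → sym (trans (+-identityˡ _) (zeroʳ ε))) ⟩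
        B + ε * B              ≈⟨ x+εx≈0 B ⟩
        0#                     ∎
        where B = F (us ++ z ∷ vs)

    scale-all : ∀ us {m} {a} {v w : Fin m → V} → (∀ j i → v j i ≈ a * w j i) →
                F (us ++ tabulate v) ≈ a ^ m * F (us ++ tabulate w)
    scale-all us {zero}  e = sym (*-identityˡ _)
    scale-all us {suc m} {a} {v} {w} e = begin
      F (us ++ v zero ∷ vs)            ≈⟨ scale us vs (e zero) ⟩
      a * F (us ++ w zero ∷ vs)        ≡⟨ ≡.cong (λ t → a * F t) (++-assoc us [ w zero ] _) ⟨
      a * F ((us ++ [ w zero ]) ++ vs) ≈⟨ *-congˡ (scale-all (us ++ [ w zero ]) (e ∘ suc)) ⟩
      a * (a ^ m * F ((us ++ [ w zero ]) ++ ws)) ≡⟨ ≡.cong (λ t → a * (a ^ m * F t)) (++-assoc us [ w zero ] _) ⟩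
      a * (a ^ m * F (us ++ w zero ∷ ws))        ≈⟨ *-assoc _ _ _ ⟨
      a * a ^ m * F (us ++ w zero ∷ ws)          ∎
      where
      vs = tabulate (v ∘ suc)
      ws = tabulate (w ∘ suc)

    add-last : ∀ us {m} (a : Fin m → Carrier) (x : Fin m → V) v w →
               (∀ j → F (us ++ [ x j ]) ≈ 0#) →
               (∀ i → w i ≈ v i + sum (λ j → a j * x j i)) →
               F (us ++ [ w ]) ≈ F (us ++ [ v ])
    add-last us {zero} a x v w Fx≈0 e = begin
      F (us ++ [ w ])       ≈⟨ scale us [] {a = 1#} (λ i → trans (e i) (trans (+-identityʳ _) (sym (*-identityˡ _)))) ⟩
      1# * F (us ++ [ v ])  ≈⟨ *-identityˡ _ ⟩
      F (us ++ [ v ])       ∎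
    add-last us {suc m} a x v w Fx≈0 e = begin
      F (us ++ [ w ])
        ≈⟨ add-last us (a ∘ suc) (x ∘ suc) v′ w (Fx≈0 ∘ suc) (λ i → trans (e i) (sym (+-assoc _ _ _))) ⟩
      F (us ++ [ v′ ])
        ≈⟨ linear us [] {w = v} {a = a zero} {x = x zero} (λ i → refl) ⟩
      F (us ++ [ v ]) + a zero * F (us ++ [ x zero ])
        ≈⟨ +-congˡ (trans (*-congˡ (Fx≈0 zero)) (zeroʳ _)) ⟩
      F (us ++ [ v ]) + 0#
        ≈⟨ +-identityʳ _ ⟩
      F (us ++ [ v ]) ∎
      where
      v′ : V
      v′ i = v i + a zero * x zero i

-- Least elements, coprimality and elementary arithmetic

module _ (em : ∀ {a} → ExcludedMiddle a) where

  least : ∀ {a} {P : Pred ℕ a} n → P n → ∃[ d ] d ≤ n × P d × (∀ {m} → m < d → ¬ P m)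
  least {P = P} = <-rec (λ n → P n → ∃[ d ] d ≤ n × P d × (∀ {m} → m < d → ¬ P m)) λ n rec Pn → case em {P = ∃[ m ] m < n × P m} of λ where
    (yes (m , m<n , Pm)) → let d , d≤m , r = rec m<n Pm in d , ℕₚ.≤-trans d≤m (ℕₚ.<⇒≤ m<n) , r
    (no ¬P)              → n , ℕₚ.≤-refl , Pn , λ {m} m<n Pm → ¬P (m , m<n , Pm)

module _ {c ℓ} (M : Monoid c ℓ) where
  open Monoid M
  open MonoidMult M using (×-congˡ; ×-congʳ; ×-assocˡ) renaming (_×_ to _·×_)
  open SetoidReasoning setoid

  ×-ε : ∀ n → n ·× ε ≈ ε
  ×-ε zero    = refl
  ×-ε (suc n) = trans (identityˡ _) (×-ε n)

  coprime-orders : ∀ {x m n} → Coprime m n → m ·× x ≈ ε → n ·× x ≈ ε → x ≈ ε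
  coprime-orders {x} coprime mx≈ε nx≈ε = case Bézout.identity (coprime⇒GCD≡1 coprime) of λ where
      (Bézout.+- a b eq) → cancel a b eq mx≈ε nx≈ε
      (Bézout.-+ a b eq) → cancel b a eq nx≈ε mx≈ε
    where
    multiple : ∀ k {j} → j ·× x ≈ ε → (k ℕ.* j) ·× x ≈ ε
    multiple k {j} h = trans (sym (×-assocˡ x k j)) (trans (×-congʳ k h) (×-ε k))

    cancel : ∀ a b {m n} → 1 ℕ.+ b ℕ.* n ≡ a ℕ.* m → m ·× x ≈ ε → n ·× x ≈ ε → x ≈ ε
    cancel a b {m} {n} eq mx≈ε nx≈ε = begin
      x                       ≈⟨ identityʳ x ⟨
      x ∙ ε                   ≈⟨ ∙-congˡ (multiple b nx≈ε) ⟨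
      x ∙ (b ℕ.* n) ·× x      ≈⟨ ×-congˡ eq ⟩
      (a ℕ.* m) ·× x          ≈⟨ multiple a mx≈ε ⟩
      ε                       ∎

tabulate-∷ʳ : ∀ {a} {A : Set a} {n} (f : Fin (suc n) → A) → tabulate f ≡ tabulate (f ∘ inject₁) ++ [ f (fromℕ n) ]
tabulate-∷ʳ {n = zero}  f = ≡.refl
tabulate-∷ʳ {n = suc n} f = ≡.cong (f zero ∷_) (tabulate-∷ʳ (f ∘ suc))

distinct-primes : ∀ {p q} → Prime p → Prime q → p ≢ q → Coprime p q
distinct-primes {p} {q} p-prime q-prime p≢q (d∣p , d∣q) with prime⇒irreducible p-prime d∣p | prime⇒irreducible q-prime d∣q
... | inj₁ d≡1    | _           = d≡1
... | inj₂ _      | inj₁ d≡1    = d≡1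
... | inj₂ ≡.refl | inj₂ p≡q    = ⊥-elim (p≢q p≡q)

-- The exponent of ζ in the product of the ζ ^ i y over i < n.
triangular : ℕ → ℕ
triangular zero    = 0
triangular (suc n) = triangular n ℕ.+ n

triangular-double : ∀ n → (triangular n ℕ.+ triangular n) ℕ.+ n ≡ n ℕ.* n
triangular-double zero    = ≡.refl
triangular-double (suc n) = begin
  ((t + n) + (t + n)) + suc n   ≡⟨ solve 2 (λ t n → ((t :+ n) :+ (t :+ n)) :+ (con 1 :+ n) := con 1 :+ n :+ n :+ ((t :+ t) :+ n)) ≡.refl t n ⟩
  suc n + n + ((t + t) + n)     ≡⟨ ≡.cong (suc n + n +_) (triangular-double n) ⟩
  suc n + n + n * n             ≡⟨ solve 1 (λ n → con 1 :+ n :+ n :+ n :* n := (con 1 :+ n) :* (con 1 :+ n)) ≡.refl n ⟩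
  suc n * suc n                 ∎
  where
  open import Data.Nat.Base using (_+_; _*_)
  open +-*-Solver
  open ≡.≡-Reasoning
  t = triangular n

-- By `triangular-double` p divides 2 · triangular p. For p = 2 the value is 1, which is why degree
-- 2 needs an argument of its own.
odd-prime∣triangular : ∀ {p} → Prime p → p ≢ 2 → p ∣ triangular p
odd-prime∣triangular {p} p-prime p≢2 with euclidsLemma 2 (triangular p) p-prime
  (≡.subst (p ∣_) (≡.cong (triangular p ℕ.+_) (≡.sym (ℕₚ.+-identityʳ _)))
    (∣m+n∣m⇒∣n {m = p} (≡.subst (p ∣_) (≡.trans (≡.sym (triangular-double p)) (ℕₚ.+-comm _ p)) (m∣m*n p)) ∣-refl))
... | inj₂ p∣t = p∣t
... | inj₁ p∣2 = ⊥-elim (p≢2 (ℕₚ.≤-antisym (∣⇒≤ p∣2) (ℕ.nonTrivial⇒n>1 p {{prime⇒nonTrivial p-prime}})))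

-- Subfields and simple extensions

record IsField {c ℓ} (L : CommutativeRing c ℓ) : Set (c ⊔ ℓ) where
  open CommutativeRing L
  field
    1≉0     : ¬ 1# ≈ 0#
    inverse : ∀ {x} → ¬ x ≈ 0# → ∃[ x′ ] x * x′ ≈ 1#

-- The level u is slack, for subfields such as the image of another field.
module FieldTheory
  (em : ∀ {a} → ExcludedMiddle a)
  {c ℓ} (L : CommutativeRing c ℓ) (isField : IsField L) (u : Level)
  where

  open CommutativeRing L hiding (zero)
  open IsField isField
  open RingProperties ring
    using (-‿distribʳ-*; -‿distribˡ-*) public
  open SemiringSolver commutativeSemiring using (solve; _:+_; _:*_; _:=_; con)
  open Exp commutativeSemiring using (_^_; ^-congˡ; ^-congʳ; ^-homo-*; ^-assocʳ; ^-distrib-*) public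
  open SemiringMult semiring using (×-assoc-*; ×-congʳ) renaming (_×_ to _·×_) public
  open Sum semiring using (sum; sum-cong-≋; ∑-distrib-+; ∑-comm; *-distribˡ-sum; *-distribʳ-sum; sum-remove; sum-init-last; sum-replicate; sum-replicate-zero) public
  open SetoidReasoning setoid

  stable : ∀ {a} {P : Set a} → ¬ ¬ P → P
  stable = decidable-stable em

  domain : ∀ {x y} → ¬ x ≈ 0# → x * y ≈ 0# → y ≈ 0#
  domain {x} {y} x≉0 xy≈0 = let x′ , xx′≈1 = inverse x≉0 in begin
    y            ≈⟨ *-identityˡ y ⟨
    1# * y       ≈⟨ *-congʳ xx′≈1 ⟨
    x * x′ * y   ≈⟨ solve 3 (λ x x′ y → x :* x′ :* y := x′ :* (x :* y)) refl x x′ y ⟩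
    x′ * (x * y) ≈⟨ *-congˡ xy≈0 ⟩
    x′ * 0#      ≈⟨ zeroʳ x′ ⟩
    0#           ∎

  *-≉0 : ∀ {x y} → ¬ x ≈ 0# → ¬ y ≈ 0# → ¬ x * y ≈ 0#
  *-≉0 x≉0 y≉0 = y≉0 ∘ domain x≉0

  *-≉0⁻ˡ : ∀ {x y} → ¬ x * y ≈ 0# → ¬ x ≈ 0#
  *-≉0⁻ˡ xy≉0 x≈0 = xy≉0 (trans (*-congʳ x≈0) (zeroˡ _))

  ≈1⇒≉0 : ∀ {x} → x ≈ 1# → ¬ x ≈ 0#
  ≈1⇒≉0 x≈1 x≈0 = 1≉0 (trans (sym x≈1) x≈0)

  ^-≉0 : ∀ {x} n → ¬ x ≈ 0# → ¬ x ^ n ≈ 0#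
  ^-≉0 zero    x≉0 = 1≉0
  ^-≉0 (suc n) x≉0 = *-≉0 x≉0 (^-≉0 n x≉0)

  ^-zeroˡ : ∀ n → 1# ^ n ≈ 1#
  ^-zeroˡ = ×-ε *-monoid

  *-cancelˡ : ∀ {x y z} → ¬ x ≈ 0# → x * y ≈ x * z → y ≈ z
  *-cancelˡ {x} {y} {z} x≉0 e = let x′ , xx′≈1 = inverse x≉0 in begin
    y            ≈⟨ *-identityˡ y ⟨
    1# * y       ≈⟨ *-congʳ xx′≈1 ⟨
    x * x′ * y   ≈⟨ solve 3 (λ x x′ y → x :* x′ :* y := x′ :* (x :* y)) refl x x′ y ⟩
    x′ * (x * y) ≈⟨ *-congˡ e ⟩
    x′ * (x * z) ≈⟨ solve 3 (λ x x′ y → x :* x′ :* y := x′ :* (x :* y)) refl x x′ z ⟨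
    x * x′ * z   ≈⟨ *-congʳ xx′≈1 ⟩
    1# * z       ≈⟨ *-identityˡ z ⟩
    z            ∎

  +≈0⇒≈- : ∀ {x y} → x + y ≈ 0# → y ≈ - x
  +≈0⇒≈- {x} {y} e = begin
    y                ≈⟨ +-identityˡ y ⟨
    0# + y           ≈⟨ +-congʳ (-‿inverseˡ x) ⟨
    (- x + x) + y    ≈⟨ +-assoc _ _ _ ⟩
    - x + (x + y)    ≈⟨ +-congˡ e ⟩
    - x + 0#         ≈⟨ +-identityʳ _ ⟩
    - x              ∎

  sum-zero : ∀ {n} {f : Vector Carrier n} → (∀ i → f i ≈ 0#) → sum f ≈ 0#
  sum-zero {n} f≈0 = trans (sum-cong-≋ f≈0) (sum-replicate-zero n)

  record Subfield : Set (lsuc (c ⊔ ℓ ⊔ u)) where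
    field
      In   : Pred Carrier (c ⊔ ℓ ⊔ u)
      ∈-resp : ∀ {x y} → x ≈ y → In x → In y
      1∈   : In 1#
      +∈   : ∀ {x y} → In x → In y → In (x + y)
      *∈   : ∀ {x y} → In x → In y → In (x * y)
      -∈   : ∀ {x} → In x → In (- x)
      inv∈ : ∀ {x y} → x * y ≈ 1# → In x → In y

    0∈ : In 0#
    0∈ = ∈-resp (-‿inverseʳ 1#) (+∈ 1∈ (-∈ 1∈))

    sum∈ : ∀ {n} {f : Vector Carrier n} → (∀ i → In (f i)) → In (sum f)
    sum∈ {zero}  f∈ = 0∈
    sum∈ {suc n} f∈ = +∈ (f∈ zero) (sum∈ (f∈ ∘ suc))

    ^∈ : ∀ {x} n → In x → In (x ^ n)
    ^∈ zero    x∈ = 1∈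
    ^∈ (suc n) x∈ = *∈ x∈ (^∈ n x∈)

    div∈ : ∀ {x y} → ¬ x ≈ 0# → In x → In (x * y) → In y
    div∈ {x} {y} x≉0 x∈ xy∈ = let x′ , xx′≈1 = inverse x≉0 in
      ∈-resp (begin
        x′ * (x * y)  ≈⟨ solve 3 (λ x x′ y → x′ :* (x :* y) := x :* x′ :* y) refl x x′ y ⟩
        x * x′ * y    ≈⟨ *-congʳ xx′≈1 ⟩
        1# * y        ≈⟨ *-identityˡ y ⟩
        y             ∎) (*∈ (inv∈ xx′≈1 x∈) xy∈)

    -- By Bézout x is a quotient of a power of x ^ m and a power of x ^ n, in one order or the
    -- other.
    coprime-powers : ∀ {x m n} → ¬ x ≈ 0# → Coprime m n → In (x ^ m) → In (x ^ n) → In x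
    coprime-powers {x} x≉0 coprime xᵐ∈ xⁿ∈ = case Bézout.identity (coprime⇒GCD≡1 coprime) of λ where
        (Bézout.+- a b eq) → divide a b eq xᵐ∈ xⁿ∈
        (Bézout.-+ a b eq) → divide b a eq xⁿ∈ xᵐ∈
      where
      multiple : ∀ k {j} → In (x ^ j) → In (x ^ (k ℕ.* j))
      multiple k {j} h = ∈-resp (trans (^-assocʳ x j k) (^-congʳ x (ℕₚ.*-comm j k))) (^∈ k h)

      divide : ∀ a b {m n} → 1 ℕ.+ b ℕ.* n ≡ a ℕ.* m → In (x ^ m) → In (x ^ n) → In x
      divide a b {n = n} eq xᵐ∈ xⁿ∈ = div∈ (^-≉0 (b ℕ.* n) x≉0) (multiple b xⁿ∈)
        (∈-resp (trans (^-congʳ x (≡.sym eq)) (*-comm _ _)) (multiple a xᵐ∈))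

  -- Coordinates with respect to the powers of an element

  eval : ∀ {n} → Vector Carrier n → Carrier → Carrier
  eval a y = sum λ i → a i * y ^ toℕ i

  eval-suc : ∀ {n} (a : Vector Carrier (suc n)) y → eval a y ≈ a zero + y * eval (tail a) y
  eval-suc a y = +-cong (*-identityʳ _) (begin
    sum (λ i → a (suc i) * (y * y ^ toℕ i))
      ≈⟨ sum-cong-≋ (λ i → solve 3 (λ a y z → a :* (y :* z) := y :* (a :* z)) refl (a (suc i)) y (y ^ toℕ i)) ⟩
    sum (λ i → y * (a (suc i) * y ^ toℕ i))
      ≈⟨ *-distribˡ-sum y (λ i → a (suc i) * y ^ toℕ i) ⟨
    y * eval (tail a) y ∎)

  eval-last : ∀ {n} (a : Vector Carrier (suc n)) y → eval a y ≈ eval (init a) y + last a * y ^ n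
  eval-last {n} a y = trans (sum-init-last (λ i → a i * y ^ toℕ i))
    (+-cong (sum-cong-≋ (λ i → *-congˡ {a (inject₁ i)} (^-congʳ y (toℕ-inject₁ i)))) (*-congˡ {last a} (^-congʳ y (toℕ-fromℕ n))))

  eval-cong : ∀ {n} {a b : Vector Carrier n} {y} → (∀ i → a i ≈ b i) → eval a y ≈ eval b y
  eval-cong e = sum-cong-≋ (λ i → *-congʳ (e i))

  eval-+ : ∀ {n} (a b : Vector Carrier n) y → eval (λ i → a i + b i) y ≈ eval a y + eval b y
  eval-+ {n} a b y = trans (sum-cong-≋ {n} (λ i → distribʳ (y ^ toℕ i) (a i) (b i)))
    (∑-distrib-+ {n} (λ i → a i * y ^ toℕ i) (λ i → b i * y ^ toℕ i))

  eval-* : ∀ {n} r (a : Vector Carrier n) y → eval (λ i → r * a i) y ≈ r * eval a y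
  eval-* {n} r a y = trans (sum-cong-≋ {n} (λ i → *-assoc r (a i) (y ^ toℕ i)))
    (sym (*-distribˡ-sum {n} r (λ i → a i * y ^ toℕ i)))

  eval-zero : ∀ {n} {a : Vector Carrier n} {y} → (∀ i → a i ≈ 0#) → eval a y ≈ 0#
  eval-zero a≈0 = sum-zero (λ i → trans (*-congʳ (a≈0 i)) (zeroˡ _))

  eval-constant : ∀ {n} {a : Vector Carrier (suc n)} {y} → (∀ i → a (suc i) ≈ 0#) → eval a y ≈ a zero
  eval-constant {a = a} {y} a≈0 = begin
    eval a y                       ≈⟨ eval-suc a y ⟩
    a zero + y * eval (tail a) y   ≈⟨ +-congˡ (*-congˡ (eval-zero {y = y} a≈0)) ⟩
    a zero + y * 0#                ≈⟨ +-congˡ (zeroʳ y) ⟩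
    a zero + 0#                    ≈⟨ +-identityʳ _ ⟩
    a zero                         ∎

  constant : ∀ {n} → Carrier → Vector Carrier (suc n)
  constant x zero    = x
  constant x (suc _) = 0#

  -- shift r is multiplication by y in the basis 1, y, …, yⁿ when yⁿ⁺¹ = Σ r i yⁱ.
  shift : ∀ {n} → Vector Carrier (suc n) → Vector Carrier (suc n) → Vector Carrier (suc n)
  shift r a zero    = r zero * last a
  shift r a (suc i) = a (inject₁ i) + r (suc i) * last a

  eval-shift : ∀ {n} (r a : Vector Carrier (suc n)) {y} → y ^ suc n ≈ eval r y →
               eval (shift r a) y ≈ y * eval a y
  eval-shift {n} r a {y} rel = begin
    eval (shift r a) y
      ≈⟨ eval-suc (shift r a) y ⟩
    r zero * l + y * eval (λ i → init a i + r (suc i) * l) y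
      ≈⟨ +-congˡ (*-congˡ (trans (eval-+ (init a) _ y) (+-congˡ (trans (eval-cong {y = y} (λ i → *-comm (r (suc i)) l)) (eval-* l (tail r) y))))) ⟩
    r zero * l + y * (eval (init a) y + l * eval (tail r) y)
      ≈⟨ solve 5 (λ r l y e f → r :* l :+ y :* (e :+ l :* f) := l :* (r :+ y :* f) :+ y :* e) refl _ l y _ _ ⟩
    l * (r zero + y * eval (tail r) y) + y * eval (init a) y
      ≈⟨ +-congʳ (*-congˡ (trans (sym (eval-suc r y)) (sym rel))) ⟩
    l * (y * y ^ n) + y * eval (init a) y
      ≈⟨ solve 4 (λ l y z e → l :* (y :* z) :+ y :* e := y :* (e :+ l :* z)) refl l y (y ^ n) _ ⟩
    y * (eval (init a) y + l * y ^ n)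
      ≈⟨ *-congˡ (eval-last a y) ⟨
    y * eval a y ∎
    where l = last a

  -- Independence, degree and dimension over a subfield

  module Extension (M : Subfield) where
    open Subfield M

    AllIn : ∀ {n} → Vector Carrier n → Set (c ⊔ ℓ ⊔ u)
    AllIn a = ∀ i → In (a i)

    Span : ℕ → Carrier → Pred Carrier (c ⊔ ℓ ⊔ u)
    Span n y x = Σ[ a ∈ Vector Carrier n ] AllIn a × x ≈ eval a y

    Independent : ℕ → Pred Carrier (c ⊔ ℓ ⊔ u)
    Independent n y = (a : Vector Carrier n) → AllIn a → eval a y ≈ 0# → ∀ i → a i ≈ 0#

    constant∈ : ∀ {n x} → In x → AllIn (constant {n} x)
    constant∈ x∈ zero    = x∈
    constant∈ x∈ (suc i) = 0∈

    shift∈ : ∀ {n} {r a : Vector Carrier (suc n)} → AllIn r → AllIn a → AllIn (shift r a)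
    shift∈ r∈ a∈ zero    = *∈ (r∈ zero) (a∈ _)
    shift∈ r∈ a∈ (suc i) = +∈ (a∈ _) (*∈ (r∈ (suc i)) (a∈ _))

    scalar-span : ∀ {n x} y → In x → Span (suc n) y x
    scalar-span {n} {x} y x∈ = constant x , constant∈ x∈ , sym (eval-constant {n} {constant x} {y} (λ _ → refl))

    independent-unique : ∀ {n y} → Independent n y → {a b : Vector Carrier n} → AllIn a → AllIn b →
                         eval a y ≈ eval b y → ∀ i → a i ≈ b i
    independent-unique {n} {y} ind {a} {b} a∈ b∈ e i = begin
      a i                       ≈⟨ +-identityʳ _ ⟨
      a i + 0#                  ≈⟨ +-congˡ (-‿inverseˡ (b i)) ⟨
      a i + (- b i + b i)       ≈⟨ +-assoc _ _ _ ⟨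
      (a i + - b i) + b i       ≈⟨ +-congʳ (+-congˡ (trans (-‿cong (sym (*-identityˡ _))) (-‿distribˡ-* 1# (b i)))) ⟩
      (a i + (- 1#) * b i) + b i  ≈⟨ +-congʳ (ind _ (λ i → +∈ (a∈ i) (*∈ (-∈ 1∈) (b∈ i))) eval≈0 i) ⟩
      0# + b i                  ≈⟨ +-identityˡ _ ⟩
      b i                       ∎
      where
      eval≈0 : eval (λ i → a i + (- 1#) * b i) y ≈ 0#
      eval≈0 = begin
        eval (λ i → a i + (- 1#) * b i) y  ≈⟨ trans (eval-+ a _ y) (+-congˡ (eval-* (- 1#) b y)) ⟩
        eval a y + (- 1#) * eval b y       ≈⟨ +-cong e (trans (sym (-‿distribˡ-* 1# _)) (-‿cong (*-identityˡ _))) ⟩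
        eval b y + - eval b y              ≈⟨ -‿inverseʳ _ ⟩
        0#                                 ∎

    -- A nonzero leading coefficient could be inverted, which would express y ^ m by lower powers;
    -- so it vanishes, and induction treats the others.
    independent-below : ∀ {d y} → (∀ {k} → k < d → ¬ Span k y (y ^ k)) → ∀ {m} → m ≤ d → Independent m y
    independent-below {d} {y} minimal {zero}  m≤d a a∈ e ()
    independent-below {d} {y} minimal {suc m} m<d a a∈ e i = coordinates i
      where
      l = last a

      l≈0 : l ≈ 0#
      l≈0 = stable λ l≉0 → let l′ , ll′≈1 = inverse l≉0 in
        minimal m<d
          ( (λ j → - l′ * a (inject₁ j))
          , (λ j → *∈ (-∈ (inv∈ ll′≈1 (a∈ _))) (a∈ _))
          , (begin
              y ^ m                        ≈⟨ *-identityˡ _ ⟨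
              1# * y ^ m                   ≈⟨ *-congʳ ll′≈1 ⟨
              l * l′ * y ^ m               ≈⟨ solve 3 (λ l l′ z → l :* l′ :* z := l′ :* (l :* z)) refl l l′ _ ⟩
              l′ * (l * y ^ m)             ≈⟨ *-congˡ (+≈0⇒≈- (trans (sym (eval-last a y)) e)) ⟩
              l′ * - eval (init a) y       ≈⟨ -‿distribʳ-* l′ _ ⟨
              - (l′ * eval (init a) y)     ≈⟨ -‿distribˡ-* l′ _ ⟩
              - l′ * eval (init a) y       ≈⟨ eval-* (- l′) (init a) y ⟨
              eval (λ j → - l′ * init a j) y ∎))

      init≈0 : ∀ j → a (inject₁ j) ≈ 0#
      init≈0 = independent-below minimal (ℕₚ.<⇒≤ m<d) (init a) (a∈ ∘ inject₁) (begin
        eval (init a) y              ≈⟨ +-identityʳ _ ⟨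
        eval (init a) y + 0#         ≈⟨ +-congˡ (trans (*-congʳ l≈0) (zeroˡ _)) ⟨
        eval (init a) y + l * y ^ m  ≈⟨ eval-last a y ⟨
        eval a y                     ≈⟨ e ⟩
        0#                           ∎)

      coordinates : ∀ i → a i ≈ 0#
      coordinates i with view i
      ... | ‵fromℕ     = l≈0
      ... | ‵inject₁ j = init≈0 j

    -- The degree is taken as the least d with y ^ d in the span of the lower powers, from which
    -- independence follows directly. Storing its predecessor gives every coordinate vector a
    -- constant entry `a zero`.
    record Degree (y : Carrier) : Set (c ⊔ ℓ ⊔ u) where
      field
        d-1      : ℕ
        relation : Span (suc d-1) y (y ^ suc d-1)
        minimal  : ∀ {k} → k < suc d-1 → ¬ Span k y (y ^ k)

      d : ℕ
      d = suc d-1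

      r : Vector Carrier d
      r = proj₁ relation

      r∈ : AllIn r
      r∈ = proj₁ (proj₂ relation)

      yᵈ : y ^ d ≈ eval r y
      yᵈ = proj₂ (proj₂ relation)

      independent : Independent d y
      independent = independent-below minimal ℕₚ.≤-refl

      unique : {a b : Vector Carrier d} → AllIn a → AllIn b → eval a y ≈ eval b y → ∀ i → a i ≈ b i
      unique = independent-unique independent

    degree : ∀ {y n} → Span n y (y ^ n) → Σ[ D ∈ Degree y ] Degree.d D ≤ n
    degree {y} {n} s with least em {P = λ k → Span k y (y ^ k)} n s
    -- Degree 0 would make y ^ 0 = 1 an empty sum.
    ... | zero  , _   , (_ , _ , 1≈0) , _   = ⊥-elim (1≉0 1≈0)
    ... | suc d , d≤n , rel           , min = record { relation = rel ; minimal = min } , d≤n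

    degree-power : ∀ {y n} → In (y ^ suc n) → Σ[ D ∈ Degree y ] Degree.d D ≤ suc n
    degree-power {y} h = degree (scalar-span y h)

    -- Gaussian elimination on the first coordinate. Without a pivot the vector `v zero` gets
    -- coefficient 0; with a pivot `k` the other vectors are reduced by multiples of `v k`, and `s`
    -- is what these multiples add up to.
    dependent : ∀ n (v : Fin (suc n) → Vector Carrier n) → (∀ i → AllIn (v i)) →
                Σ[ a ∈ Vector Carrier (suc n) ] AllIn a × (∃[ i ] ¬ a i ≈ 0#) ×
                (∀ j → sum (λ i → a i * v i j) ≈ 0#)
    dependent zero    v v∈ = (λ _ → 1#) , (λ _ → 1∈) , (zero , 1≉0) , λ ()
    dependent (suc n) v v∈ with em {P = ∃[ k ] ¬ v k zero ≈ 0#}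
    ... | no all-zero =
      let a , a∈ , (i , aᵢ≉0) , e = dependent n (tail ∘ v ∘ suc) (λ i → v∈ (suc i) ∘ suc) in
      (0# ∷ᵛ a) , (λ { zero → 0∈ ; (suc i) → a∈ i }) , (suc i , aᵢ≉0) ,
      λ { zero    → sum-zero {suc (suc n)} (λ i → trans (*-congˡ {(0# ∷ᵛ a) i} (v≈0 i)) (zeroʳ _))
        ; (suc j) → trans (+-cong (zeroˡ _) (e j)) (+-identityˡ 0#) }
      where
      v≈0 : ∀ i → v i zero ≈ 0#
      v≈0 i = stable λ vᵢ≉0 → all-zero (i , vᵢ≉0)
    ... | yes (k , vₖ≉0) =
      insertAt a k s , inserted∈ , (punchIn k (proj₁ a≉0) , λ e → proj₂ a≉0 (trans (reflexive (≡.sym (insertAt-punchIn a k s _))) e)) ,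
      relation
      where
      q  = proj₁ (inverse vₖ≉0)
      qe = proj₂ (inverse vₖ≉0)

      t : Fin (suc n) → Carrier
      t i = - (v (punchIn k i) zero * q)

      t∈ : AllIn t
      t∈ i = -∈ (*∈ (v∈ _ _) (inv∈ qe (v∈ k zero)))

      w : Fin (suc n) → Vector Carrier (suc n)
      w i j = t i * v k j + v (punchIn k i) j

      w₀≈0 : ∀ i → w i zero ≈ 0#
      w₀≈0 i = begin
        - (x * q) * v k zero + x    ≈⟨ +-cong (sym (-‿distribˡ-* _ _)) (sym (*-identityʳ x)) ⟩
        - (x * q * v k zero) + x * 1#  ≈⟨ +-cong (-‿cong (*-assoc _ _ _)) (*-congˡ (sym (trans (*-comm _ _) qe))) ⟩
        - (x * (q * v k zero)) + x * (q * v k zero) ≈⟨ -‿inverseˡ _ ⟩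
        0# ∎
        where x = v (punchIn k i) zero

      ih = dependent n (tail ∘ w) (λ i j → +∈ (*∈ (t∈ i) (v∈ k (suc j))) (v∈ _ (suc j)))
      a   = proj₁ ih
      a∈  = proj₁ (proj₂ ih)
      a≉0 = proj₁ (proj₂ (proj₂ ih))

      Σaw≈0 : ∀ j → sum (λ i → a i * w i j) ≈ 0#
      Σaw≈0 zero    = sum-zero {f = λ i → a i * w i zero} (λ i → trans (*-congˡ (w₀≈0 i)) (zeroʳ _))
      Σaw≈0 (suc j) = proj₂ (proj₂ (proj₂ ih)) j

      s : Carrier
      s = sum λ i → a i * t i

      inserted∈ : AllIn (insertAt a k s)
      inserted∈ i with i Finₚ.≟ k
      ... | yes ≡.refl = ≡.subst In (≡.sym (insertAt-lookup a k s)) (sum∈ (λ i → *∈ (a∈ i) (t∈ i)))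
      ... | no  i≢k    = ≡.subst (In ∘ insertAt a k s) (Finₚ.punchIn-punchOut (i≢k ∘ ≡.sym))
                           (≡.subst In (≡.sym (insertAt-punchIn a k s _)) (a∈ (Fin.punchOut (i≢k ∘ ≡.sym))))

      relation : ∀ j → sum (λ i → insertAt a k s i * v i j) ≈ 0#
      relation j = begin
        sum (λ i → insertAt a k s i * v i j)
          ≈⟨ sum-remove {i = k} (λ i → insertAt a k s i * v i j) ⟩
        insertAt a k s k * v k j + sum (λ i → insertAt a k s (punchIn k i) * v (punchIn k i) j)
          ≈⟨ +-cong (*-congʳ (reflexive (insertAt-lookup a k s)))
               (sum-cong-≋ {suc n} (λ i → *-congʳ {v (punchIn k i) j} (reflexive (insertAt-punchIn a k s i)))) ⟩
        s * v k j + sum (λ i → a i * v (punchIn k i) j)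
          ≈⟨ +-congʳ (*-distribʳ-sum (v k j) (λ i → a i * t i)) ⟩
        sum (λ i → a i * t i * v k j) + sum (λ i → a i * v (punchIn k i) j)
          ≈⟨ ∑-distrib-+ {suc n} (λ i → a i * t i * v k j) (λ i → a i * v (punchIn k i) j) ⟨
        sum (λ i → a i * t i * v k j + a i * v (punchIn k i) j)
          ≈⟨ sum-cong-≋ (λ i → solve 4 (λ a t v w → a :* t :* v :+ a :* w := a :* (t :* v :+ w)) refl (a i) (t i) (v k j) (v (punchIn k i) j)) ⟩
        sum (λ i → a i * w i j)
          ≈⟨ Σaw≈0 j ⟩
        0# ∎

    dependent-span : ∀ n y (v : Fin (suc n) → Carrier) → (∀ i → Span n y (v i)) →
                     Σ[ a ∈ Vector Carrier (suc n) ] AllIn a × (∃[ i ] ¬ a i ≈ 0#) × sum (λ i → a i * v i) ≈ 0#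
    dependent-span n y v v∈ =
      let a , a∈ , a≉0 , e = dependent n (proj₁ ∘ v∈) (proj₁ ∘ proj₂ ∘ v∈) in
      a , a∈ , a≉0 , (begin
        sum (λ i → a i * v i)
          ≈⟨ sum-cong-≋ {suc n} (λ i → trans (*-congˡ (proj₂ (proj₂ (v∈ i))))
                (*-distribˡ-sum {n} (a i) (λ j → proj₁ (v∈ i) j * y ^ toℕ j))) ⟩
        sum (λ i → sum (λ j → a i * (proj₁ (v∈ i) j * y ^ toℕ j)))
          ≈⟨ ∑-comm (λ i j → a i * (proj₁ (v∈ i) j * y ^ toℕ j)) ⟩
        sum (λ j → sum (λ i → a i * (proj₁ (v∈ i) j * y ^ toℕ j)))
          ≈⟨ sum-cong-≋ {n} (λ j → trans (sum-cong-≋ {suc n} (λ i → sym (*-assoc (a i) (proj₁ (v∈ i) j) (y ^ toℕ j))))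
                                 (sym (*-distribʳ-sum {suc n} (y ^ toℕ j) (λ i → a i * proj₁ (v∈ i) j)))) ⟩
        sum (λ j → sum (λ i → a i * proj₁ (v∈ i) j) * y ^ toℕ j)
          ≈⟨ eval-zero {y = y} e ⟩
        0# ∎)

    degree-≤ : ∀ {n y z} (D : Degree z) → (∀ k → Span n y (z ^ k)) → Degree.d D ≤ n
    degree-≤ {n} {y} {z} D span = ℕₚ.≮⇒≥ λ n<d →
      let a , a∈ , (i , aᵢ≉0) , e = dependent-span n y (λ i → z ^ toℕ i) (span ∘ toℕ) in
      aᵢ≉0 (independent-below (Degree.minimal D) n<d a a∈ e i)

  sum-single : ∀ {n} (f : Vector Carrier n) i → (∀ j → i ≢ j → f j ≈ 0#) → sum f ≈ f i
  sum-single {suc n} f i off = begin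
    sum f                           ≈⟨ sum-remove {i = i} f ⟩
    f i + sum (f ∘ punchIn i)       ≈⟨ +-congˡ (sum-zero {n} (λ j → off _ (punchInᵢ≢i i j ∘ ≡.sym))) ⟩
    f i + 0#                        ≈⟨ +-identityʳ _ ⟩
    f i                             ∎

  unit : ∀ {n} → Fin n → Vector Carrier n
  unit i j with i Finₚ.≟ j
  ... | yes _ = 1#
  ... | no  _ = 0#

  unit-diagonal : ∀ {n} (i : Fin n) → unit i i ≈ 1#
  unit-diagonal i with i Finₚ.≟ i
  ... | yes _   = refl
  ... | no  i≢i = ⊥-elim (i≢i ≡.refl)

  unit-off : ∀ {n} {i j : Fin n} → i ≢ j → unit i j ≈ 0#
  unit-off {i = i} {j} i≢j with i Finₚ.≟ j
  ... | yes i≡j = ⊥-elim (i≢j i≡j)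
  ... | no  _   = refl

  eval-unit : ∀ {n} (i : Fin n) y → eval (unit i) y ≈ y ^ toℕ i
  eval-unit {n} i y = begin
    eval (unit i) y            ≈⟨ sum-single {n} (λ j → unit i j * y ^ toℕ j) i (λ j i≢j → trans (*-congʳ (unit-off i≢j)) (zeroˡ _)) ⟩
    unit i i * y ^ toℕ i       ≈⟨ *-congʳ (unit-diagonal i) ⟩
    1# * y ^ toℕ i             ≈⟨ *-identityˡ _ ⟩
    y ^ toℕ i                  ∎

  -- Norms, conjugates and the adjunction of an element

  module Simple (M : Subfield) where
    open Subfield M
    open Extension M

    unit∈ : ∀ {n} (i : Fin n) → AllIn (unit i)
    unit∈ i j with i Finₚ.≟ j
    ... | yes _ = 1∈
    ... | no  _ = 0∈

    module Coordinates {y} (D : Degree y) where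
      open Degree D

      coordinates : ℕ → Vector Carrier d
      coordinates zero    = constant 1#
      coordinates (suc k) = shift r (coordinates k)

      coordinates∈ : ∀ k → AllIn (coordinates k)
      coordinates∈ zero    = constant∈ 1∈
      coordinates∈ (suc k) = shift∈ r∈ (coordinates∈ k)

      eval-coordinates : ∀ k → eval (coordinates k) y ≈ y ^ k
      eval-coordinates zero    = eval-constant {d-1} {constant 1#} {y} (λ _ → refl)
      eval-coordinates (suc k) = trans (eval-shift r (coordinates k) yᵈ) (*-congˡ (eval-coordinates k))

    -- E k is the determinant of the coordinate vectors of yᵏ, …, yᵏ⁺ᵈ⁻¹.  By
    -- the relation for yᵈ it is multiplied by N when k increases by 1, and it
    -- is multiplied by (yᵐ)ᵈ when k increases by m, provided that yᵐ ∈ M.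
    module _ {y} (D : Degree y) where
      open Degree D
      open Coordinates D
      open AlternatingForms L d using (ε; minor; minor-isAlternating; minor-identity; add-last; scale; scale-all; rotate; repeated-last)

      private
        F = minor d id
        F-alternating = minor-isAlternating d id

        E : ℕ → Carrier
        E k = F (tabulate {n = d} (λ j → coordinates (toℕ j ℕ.+ k)))

        N : Carrier
        N = r zero * ε ^ d-1

        -- In y^(d+k) = Σ rⱼ y^(j+k) the terms with j ≥ 1 repeat arguments already present; the one
        -- with j = 0 is moved to the front past d - 1 others.
        E-suc : ∀ k → E (suc k) ≈ N * E k
        E-suc k = begin
          F (tabulate {n = d} (λ j → coordinates (toℕ j ℕ.+ suc k)))
            ≡⟨ ≡.cong F (≡.trans (tabulate-∷ʳ {n = d-1} (λ j → coordinates (toℕ j ℕ.+ suc k))) (≡.cong₂ (λ us w → us ++ [ coordinates w ])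
                 (tabulate-cong {n = d-1} (λ j → ≡.cong coordinates (≡.trans (≡.cong (ℕ._+ suc k) (toℕ-inject₁ j)) (ℕₚ.+-suc (toℕ j) k))))
                 (≡.trans (≡.cong (ℕ._+ suc k) (toℕ-fromℕ d-1)) (ℕₚ.+-suc d-1 k)))) ⟩
          F (us ++ [ coordinates (d ℕ.+ k) ])
            ≈⟨ add-last F-alternating us (tail r) x v (coordinates (d ℕ.+ k)) (repeated-last F-alternating [] x) expand ⟩
          F (us ++ [ v ])
            ≈⟨ scale F-alternating us [] (λ _ → refl) ⟩
          r zero * F (us ++ [ coordinates k ])
            ≈⟨ *-congˡ (rotate F-alternating [] (coordinates k) x) ⟩
          r zero * (ε ^ d-1 * E k)
            ≈⟨ *-assoc _ _ _ ⟨
          N * E k ∎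
          where
          x : Fin d-1 → Vector Carrier d
          x j = coordinates (suc (toℕ j) ℕ.+ k)

          us = tabulate x

          v : Vector Carrier d
          v i = r zero * coordinates k i

          expand : ∀ i → coordinates (d ℕ.+ k) i ≈ v i + sum (λ j → r (suc j) * x j i)
          expand = unique (coordinates∈ (d ℕ.+ k))
            (λ i → sum∈ {n = d} (λ j → *∈ (r∈ j) (coordinates∈ (toℕ j ℕ.+ k) i))) (begin
            eval (coordinates (d ℕ.+ k)) y
              ≈⟨ trans (eval-coordinates (d ℕ.+ k)) (^-homo-* y d k) ⟩
            y ^ d * y ^ k
              ≈⟨ *-congʳ yᵈ ⟩
            sum (λ j → r j * y ^ toℕ j) * y ^ k
              ≈⟨ *-distribʳ-sum {d} (y ^ k) (λ j → r j * y ^ toℕ j) ⟩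
            sum {d} (λ j → r j * y ^ toℕ j * y ^ k)
              ≈⟨ sum-cong-≋ {d} (λ j → begin
                r j * y ^ toℕ j * y ^ k                         ≈⟨ *-assoc _ _ _ ⟩
                r j * (y ^ toℕ j * y ^ k)                       ≈⟨ *-congˡ (^-homo-* y (toℕ j) k) ⟨
                r j * y ^ (toℕ j ℕ.+ k)                         ≈⟨ *-congˡ (eval-coordinates (toℕ j ℕ.+ k)) ⟨
                r j * eval (coordinates (toℕ j ℕ.+ k)) y        ≈⟨ *-distribˡ-sum {d} (r j) (λ i → coordinates (toℕ j ℕ.+ k) i * y ^ toℕ i) ⟩
                sum {d} (λ i → r j * (coordinates (toℕ j ℕ.+ k) i * y ^ toℕ i)) ∎) ⟩
            sum {d} (λ j → sum {d} (λ i → r j * (coordinates (toℕ j ℕ.+ k) i * y ^ toℕ i)))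
              ≈⟨ ∑-comm {d} {d} (λ j i → r j * (coordinates (toℕ j ℕ.+ k) i * y ^ toℕ i)) ⟩
            sum {d} (λ i → sum {d} (λ j → r j * (coordinates (toℕ j ℕ.+ k) i * y ^ toℕ i)))
              ≈⟨ sum-cong-≋ {d} (λ i → trans (sum-cong-≋ {d} (λ j → sym (*-assoc (r j) (coordinates (toℕ j ℕ.+ k) i) (y ^ toℕ i))))
                   (sym (*-distribʳ-sum {d} (y ^ toℕ i) (λ j → r j * coordinates (toℕ j ℕ.+ k) i)))) ⟩
            eval (λ i → sum {d} (λ j → r j * coordinates (toℕ j ℕ.+ k) i)) y ∎)

        E-power : ∀ k → E k ≈ N ^ k * E 0
        E-power zero    = sym (*-identityˡ _)
        E-power (suc k) = trans (E-suc k) (trans (*-congˡ (E-power k)) (sym (*-assoc N _ _)))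

        coordinates-unit : ∀ (j : Fin d) i → coordinates (toℕ j ℕ.+ 0) i ≈ unit j i
        coordinates-unit j = unique (coordinates∈ (toℕ j ℕ.+ 0)) (unit∈ j)
          (trans (eval-coordinates (toℕ j ℕ.+ 0)) (trans (^-congʳ y (ℕₚ.+-identityʳ (toℕ j))) (sym (eval-unit j y))))

        E₀≈1 : E 0 ≈ 1#
        E₀≈1 = minor-identity d id (λ j → coordinates (toℕ j ℕ.+ 0))
          (λ i → trans (coordinates-unit i i) (unit-diagonal i))
          (λ i j i≢j → trans (coordinates-unit j i) (unit-off (i≢j ∘ ≡.sym)))

        E-periodic : ∀ m → In (y ^ m) → E m ≈ (y ^ m) ^ d * E 0
        E-periodic m yᵐ∈ = scale-all F-alternating [] {m = d} (λ j →
          unique (coordinates∈ (toℕ j ℕ.+ m)) (λ i → *∈ yᵐ∈ (coordinates∈ (toℕ j ℕ.+ 0) i)) (begin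
            eval (coordinates (toℕ j ℕ.+ m)) y          ≈⟨ eval-coordinates (toℕ j ℕ.+ m) ⟩
            y ^ (toℕ j ℕ.+ m)                           ≈⟨ ^-congʳ y (≡.trans (ℕₚ.+-comm (toℕ j) m) (≡.cong (m ℕ.+_) (≡.sym (ℕₚ.+-identityʳ _)))) ⟩
            y ^ (m ℕ.+ (toℕ j ℕ.+ 0))                   ≈⟨ ^-homo-* y m _ ⟩
            y ^ m * y ^ (toℕ j ℕ.+ 0)                   ≈⟨ *-congˡ (eval-coordinates (toℕ j ℕ.+ 0)) ⟨
            y ^ m * eval (coordinates (toℕ j ℕ.+ 0)) y  ≈⟨ eval-* (y ^ m) (coordinates (toℕ j ℕ.+ 0)) y ⟨
            eval (λ i → y ^ m * coordinates (toℕ j ℕ.+ 0) i) y ∎))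

      -- `N` is the usual norm (-1)^(d-1) r₀. Computing `E m` in both ways compares it with y ^ d
      -- only up to m-th powers.
      norm : ∃[ N ] In N × (∀ m → In (y ^ m) → N ^ m ≈ (y ^ d) ^ m)
      norm = N , *∈ (r∈ zero) (^∈ d-1 (-∈ 1∈)) , λ m yᵐ∈ → begin
        N ^ m                ≈⟨ *-identityʳ _ ⟨
        N ^ m * 1#           ≈⟨ *-congˡ E₀≈1 ⟨
        N ^ m * E 0          ≈⟨ E-power m ⟨
        E m                  ≈⟨ E-periodic m yᵐ∈ ⟩
        (y ^ m) ^ d * E 0    ≈⟨ *-congˡ E₀≈1 ⟩
        (y ^ m) ^ d * 1#     ≈⟨ *-identityʳ _ ⟩
        (y ^ m) ^ d          ≈⟨ ^-assocʳ y m d ⟩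
        y ^ (m ℕ.* d)        ≈⟨ ^-congʳ y (ℕₚ.*-comm m d) ⟩
        y ^ (d ℕ.* m)        ≈⟨ ^-assocʳ y d m ⟨
        (y ^ d) ^ m          ∎

    -- `Conj` is the graph of the M-homomorphism M(y) → L with y ↦ y′, for a second solution y′ of
    -- the relation of y. For y′ = y it is the identity, and its closure properties are those of the
    -- span of the powers of y.
    module Conjugate {y} (D : Degree y) {y′} (y′ᵈ : y′ ^ Degree.d D ≈ eval (Degree.r D) y′) where
      open Degree D

      Conj : Carrier → Carrier → Set (c ⊔ ℓ ⊔ u)
      Conj v v′ = Σ[ a ∈ Vector Carrier d ] AllIn a × v ≈ eval a y × v′ ≈ eval a y′

      conj-resp : ∀ {v v′ w w′} → v ≈ w → v′ ≈ w′ → Conj v v′ → Conj w w′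
      conj-resp v≈w v′≈w′ (a , a∈ , e , e′) = a , a∈ , trans (sym v≈w) e , trans (sym v′≈w′) e′

      conj-scalar : ∀ {x} → In x → Conj x x
      conj-scalar {x} x∈ = constant x , constant∈ x∈ ,
        sym (eval-constant {d-1} {constant x} {y} (λ _ → refl)) , sym (eval-constant {d-1} {constant x} {y′} (λ _ → refl))

      conj-+ : ∀ {v v′ w w′} → Conj v v′ → Conj w w′ → Conj (v + w) (v′ + w′)
      conj-+ (a , a∈ , e , e′) (b , b∈ , f , f′) = (λ i → a i + b i) , (λ i → +∈ (a∈ i) (b∈ i)) ,
        trans (+-cong e f) (sym (eval-+ a b y)) , trans (+-cong e′ f′) (sym (eval-+ a b y′))

      conj-scale : ∀ {x v v′} → In x → Conj v v′ → Conj (x * v) (x * v′)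
      conj-scale {x} x∈ (a , a∈ , e , e′) = (λ i → x * a i) , (λ i → *∈ x∈ (a∈ i)) ,
        trans (*-congˡ e) (sym (eval-* x a y)) , trans (*-congˡ e′) (sym (eval-* x a y′))

      conj-shift : ∀ {v v′} → Conj v v′ → Conj (y * v) (y′ * v′)
      conj-shift (a , a∈ , e , e′) = shift r a , shift∈ r∈ a∈ ,
        trans (*-congˡ e) (sym (eval-shift r a yᵈ)) , trans (*-congˡ e′) (sym (eval-shift r a y′ᵈ))

      -- Horner's scheme reduces multiplication by an expression in y to scaling, addition and
      -- `conj-shift`, so that coefficients need no convolution.
      conj-eval : ∀ {m} (a : Vector Carrier m) → AllIn a → ∀ {v v′} → Conj v v′ → Conj (eval a y * v) (eval a y′ * v′)
      conj-eval {zero}  a a∈ h = conj-resp (sym (zeroˡ _)) (sym (zeroˡ _)) (conj-scalar 0∈)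
      conj-eval {suc m} a a∈ {v} {v′} h =
        conj-resp (horner y v) (horner y′ v′)
          (conj-+ (conj-scale (a∈ zero) h) (conj-shift (conj-eval (tail a) (a∈ ∘ suc) h)))
        where
        horner : ∀ y v → a zero * v + y * (eval (tail a) y * v) ≈ eval a y * v
        horner y v = trans
          (solve 4 (λ a v y e → a :* v :+ y :* (e :* v) := (a :+ y :* e) :* v) refl (a zero) v y (eval (tail a) y))
          (*-congʳ (sym (eval-suc a y)))

      conj-* : ∀ {v v′ w w′} → Conj v v′ → Conj w w′ → Conj (v * w) (v′ * w′)
      conj-* (a , a∈ , e , e′) h = conj-resp (*-congʳ (sym e)) (*-congʳ (sym e′)) (conj-eval a a∈ h)

      conj-^ : ∀ {v v′} n → Conj v v′ → Conj (v ^ n) (v′ ^ n)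
      conj-^ zero    h = conj-scalar 1∈
      conj-^ (suc n) h = conj-* h (conj-^ n h)

      conj-generator : Conj y y′
      conj-generator = conj-resp (*-identityʳ y) (*-identityʳ y′) (conj-shift (conj-scalar 1∈))

      conj-functional : ∀ {v v′ w w′} → Conj v v′ → Conj w w′ → v ≈ w → v′ ≈ w′
      conj-functional (a , a∈ , e , e′) (b , b∈ , f , f′) v≈w = trans e′ (trans
        (eval-cong {y = y′} (unique a∈ b∈ (trans (sym e) (trans v≈w f)))) (sym f′))

    adjoin : ∀ {y} → Degree y → Subfield
    adjoin {y} D = record
      { In   = Span d y
      ; ∈-resp = λ x≈z (a , a∈ , e) → a , a∈ , trans (sym x≈z) e
      ; 1∈   = scalar-span y 1∈
      ; +∈   = λ h k → to (conj-+ (from h) (from k))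
      ; *∈   = span-*
      ; -∈   = λ {x} h → to (conj-resp (ε*≈- x) (ε*≈- x) (conj-scale (-∈ 1∈) (from h)))
      ; inv∈ = span-inverse
      }
      where
      open Degree D
      open Conjugate D yᵈ

      from : ∀ {x} → Span d y x → Conj x x
      from (a , a∈ , e) = a , a∈ , e , e

      to : ∀ {x} → Conj x x → Span d y x
      to (a , a∈ , e , _) = a , a∈ , e

      span-* : ∀ {v w} → Span d y v → Span d y w → Span d y (v * w)
      span-* h k = to (conj-* (from h) (from k))

      ε*≈- : ∀ x → (- 1#) * x ≈ - x
      ε*≈- x = trans (sym (-‿distribˡ-* 1# x)) (-‿cong (*-identityˡ x))

      generator^ : ∀ k → Span d y (y ^ k)
      generator^ k = to (conj-^ k conj-generator)

      -- The d + 1 elements 1, x, x y, ..., x y^(d-1) of the span are dependent. The coefficient of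
      -- 1 is nonzero, as otherwise x would annihilate a nontrivial combination of the independent
      -- powers of y; dividing by it displays the inverse of x.
      span-inverse : ∀ {x z} → x * z ≈ 1# → Span d y x → Span d y z
      span-inverse {x} {z} xz≈1 x∈ = construct (dependent-span d y v v∈)
        where
        v : Fin (suc d) → Carrier
        v zero    = 1#
        v (suc i) = x * y ^ toℕ i

        v∈ : ∀ i → Span d y (v i)
        v∈ zero    = scalar-span y 1∈
        v∈ (suc i) = span-* x∈ (generator^ (toℕ i))

        construct : _ → Span d y z
        construct (a , a∈ , (i , aᵢ≉0) , e) = (λ i → - b * a (suc i)) , (λ i → *∈ (-∈ (inv∈ ab≈1 (a∈ zero))) (a∈ (suc i))) , (begin
            z                       ≈⟨ *-identityˡ z ⟨
            1# * z                  ≈⟨ *-congʳ (trans (sym ab≈1) (*-comm _ _)) ⟩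
            b * a zero * z          ≈⟨ *-congʳ (*-congˡ (+≈0⇒≈- (trans (+-comm _ _) combination))) ⟩
            b * - (x * w) * z       ≈⟨ *-congʳ (trans (sym (-‿distribʳ-* b _)) (-‿distribˡ-* b _)) ⟩
            - b * (x * w) * z       ≈⟨ solve 4 (λ b x w z → b :* (x :* w) :* z := b :* w :* (x :* z)) refl (- b) x w z ⟩
            - b * w * (x * z)       ≈⟨ trans (*-congˡ xz≈1) (*-identityʳ _) ⟩
            - b * w                 ≈⟨ eval-* (- b) (tail a) y ⟨
            eval (λ i → - b * a (suc i)) y ∎)
          where
          w = eval (tail a) y

          combination : a zero + x * w ≈ 0#
          combination = trans (+-cong (sym (*-identityʳ _)) (trans (*-distribˡ-sum {d} x (λ i → a (suc i) * y ^ toℕ i))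
            (sum-cong-≋ {d} (λ i → solve 3 (λ x a z → x :* (a :* z) := a :* (x :* z)) refl x (a (suc i)) (y ^ toℕ i))))) e

          a₀≉0 : ¬ a zero ≈ 0#
          a₀≉0 a₀≈0 = aᵢ≉0 (all-zero i)
            where
            w≈0 : w ≈ 0#
            w≈0 = domain (*-≉0⁻ˡ (≈1⇒≉0 xz≈1)) (trans (sym (+-identityˡ _)) (trans (+-congʳ (sym a₀≈0)) combination))

            all-zero : ∀ i → a i ≈ 0#
            all-zero zero    = a₀≈0
            all-zero (suc i) = independent (tail a) (a∈ ∘ suc) w≈0 i

          b     = proj₁ (inverse a₀≉0)
          ab≈1  = proj₂ (inverse a₀≉0)

    generator^∈ : ∀ {y} (D : Degree y) k → Span (Degree.d D) y (y ^ k)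
    generator^∈ {y} D k = Subfield.^∈ (adjoin D) k
      (let a , a∈ , e , _ = conj-generator in a , a∈ , e)
      where open Conjugate D (Degree.yᵈ D)

    binomial : ∀ {y} (D : Degree y) → let open Degree D in In (y ^ d) → ∀ i → r i ≈ constant (y ^ d) i
    binomial {y} D yᵈ∈ = unique r∈ (constant∈ yᵈ∈) (trans (sym yᵈ) (sym (eval-constant {d-1} {constant (y ^ d)} {y} (λ _ → refl))))
      where open Degree D

    module _ (μ∈ : ∀ {p x} → Prime p → x ^ p ≈ 1# → In x) where

      -- The quotient b / a is a p-th root of unity, hence in M.
      root-ratio∈ : ∀ {p a b} → Prime p → ¬ a ≈ 0# → In b → b ^ p ≈ a ^ p → In a
      root-ratio∈ {zero} (Primality.prime {{()}} _)
      root-ratio∈ {p@(suc _)} {a} {b} p-prime a≉0 b∈ e = let a′ , aa′≈1 = inverse a≉0 in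
        inv∈ (trans (*-comm a′ a) aa′≈1) (div∈ b≉0 b∈ (μ∈ p-prime (begin
          (b * a′) ^ p     ≈⟨ ^-distrib-* b a′ p ⟩
          b ^ p * a′ ^ p   ≈⟨ *-congʳ e ⟩
          a ^ p * a′ ^ p   ≈⟨ ^-distrib-* a a′ p ⟨
          (a * a′) ^ p     ≈⟨ ^-congˡ p aa′≈1 ⟩
          1# ^ p           ≈⟨ ^-zeroˡ p ⟩
          1#               ∎)))
        where
        b≉0 : ¬ b ≈ 0#
        b≉0 b≈0 = ^-≉0 p a≉0 (trans (sym e) (trans (*-congʳ b≈0) (zeroˡ _)))

      -- Once y ^ d ∈ M, a degree d < p would be coprime to p and give y ∈ M.
      kummer : ∀ {p y} → Prime p → ¬ y ≈ 0# → In (y ^ p) → ¬ In y → Σ[ D ∈ Degree y ] Degree.d D ≡ p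
      kummer {zero}  (Primality.prime {{()}} _)
      kummer {suc p} {y} p-prime y≉0 yᵖ∈ y∉ = D , ℕₚ.≤∧≮⇒≡ (proj₂ found) λ d<p →
        y∉ (coprime-powers y≉0 (prime⇒coprime p-prime d<p) yᵖ∈ yᵈ∈)
        where
        found = degree-power yᵖ∈
        D = proj₁ found
        open Degree D using (d)

        yᵈ∈ : In (y ^ d)
        yᵈ∈ = let N , N∈ , e = norm D in root-ratio∈ p-prime (^-≉0 d y≉0) N∈ (e (suc p) yᵖ∈)

  ∏ : ℕ → (ℕ → Carrier) → Carrier
  ∏ zero    f = 1#
  ∏ (suc n) f = ∏ n f * f n

  -- Both sides are f 0 ⋯ f n. If f n = f 0 ≠ 0, the product is thus unchanged by a shift of the
  -- index, without permuting factors.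
  ∏-shift : ∀ n f → f 0 * ∏ n (f ∘ suc) ≈ ∏ n f * f n
  ∏-shift zero    f = *-comm _ _
  ∏-shift (suc n) f = trans (sym (*-assoc _ _ _)) (*-congʳ (∏-shift n f))

  ∏-* : ∀ n {f g h : ℕ → Carrier} → (∀ i → f i * g i ≈ h i) → ∏ n f * ∏ n g ≈ ∏ n h
  ∏-* zero    e = *-identityˡ 1#
  ∏-* (suc n) {f} {g} e = trans
    (solve 4 (λ a b x y → a :* x :* (b :* y) := a :* b :* (x :* y)) refl (∏ n f) (∏ n g) (f n) (g n))
    (*-cong (∏-* n e) (e n))

  ∏-^ : ∀ n f m → ∏ n (λ i → f i ^ m) ≈ ∏ n f ^ m
  ∏-^ zero    f m = sym (^-zeroˡ m)
  ∏-^ (suc n) f m = trans (*-congʳ (∏-^ n f m)) (sym (^-distrib-* (∏ n f) (f n) m))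

  ∏-constant : ∀ n x → ∏ n (λ _ → x) ≈ x ^ n
  ∏-constant zero    x = refl
  ∏-constant (suc n) x = trans (*-congʳ (∏-constant n x)) (*-comm _ x)

  ∏-geometric : ∀ n ζ y → ∏ n (λ i → ζ ^ i * y) ≈ ζ ^ triangular n * y ^ n
  ∏-geometric zero    ζ y = sym (*-identityˡ 1#)
  ∏-geometric (suc n) ζ y = begin
    ∏ n (λ i → ζ ^ i * y) * (ζ ^ n * y)          ≈⟨ *-congʳ (∏-geometric n ζ y) ⟩
    ζ ^ triangular n * y ^ n * (ζ ^ n * y)       ≈⟨ solve 4 (λ a b c y → a :* b :* (c :* y) := a :* c :* (y :* b)) refl (ζ ^ triangular n) (y ^ n) (ζ ^ n) y ⟩
    ζ ^ triangular n * ζ ^ n * (y * y ^ n)       ≈⟨ *-congʳ (^-homo-* ζ (triangular n) n) ⟨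
    ζ ^ (triangular n ℕ.+ n) * (y * y ^ n)       ∎

  -- Radical extensions of prime degree

  module Trace (M : Subfield) where
    open Subfield M
    open Extension M
    open Simple M

    module _ {y} (D : Degree y) (yᵈ∈ : In (y ^ Degree.d D)) {z} (z∈ : Span (Degree.d D) y z) where
      open Degree D

      multiples : ℕ → Vector Carrier d
      multiples zero    = proj₁ z∈
      multiples (suc k) = shift r (multiples k)

      multiples∈ : ∀ k → AllIn (multiples k)
      multiples∈ zero    = proj₁ (proj₂ z∈)
      multiples∈ (suc k) = shift∈ r∈ (multiples∈ k)

      eval-multiples : ∀ k → eval (multiples k) y ≈ y ^ k * z
      eval-multiples zero    = trans (sym (proj₂ (proj₂ z∈))) (sym (*-identityˡ z))
      eval-multiples (suc k) = trans (eval-shift r (multiples k) yᵈ) (trans (*-congˡ (eval-multiples k)) (sym (*-assoc y _ z)))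

      -- As y ^ d ∈ M, `shift` moves every entry up by one and wraps around into entry zero alone.
      -- With k = 0 all diagonal entries of multiplication by z equal a₀, so its trace is d a₀.
      multiples-diagonal : ∀ j i k → toℕ i ≡ toℕ k ℕ.+ j → multiples j i ≈ multiples 0 k
      multiples-diagonal zero    i k e = reflexive (≡.cong (multiples 0) (Finₚ.toℕ-injective (≡.trans e (ℕₚ.+-identityʳ _))))
      multiples-diagonal (suc j) zero k e = case ≡.trans e (ℕₚ.+-suc (toℕ k) j) of λ ()
      multiples-diagonal (suc j) (suc i) k e = begin
        multiples j (inject₁ i) + r (suc i) * last (multiples j)
          ≈⟨ +-cong (multiples-diagonal j (inject₁ i) k (≡.trans (toℕ-inject₁ i) (ℕₚ.suc-injective (≡.trans e (ℕₚ.+-suc (toℕ k) j)))))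
                    (trans (*-congʳ (binomial D yᵈ∈ (suc i))) (zeroˡ _)) ⟩
        multiples 0 k + 0#  ≈⟨ +-identityʳ _ ⟩
        multiples 0 k       ∎

    -- Both sides of the resulting identity d a₀ = 0 compute the trace of
    -- multiplication by z on M[y] = M[z], in the bases (yⁱ) and (zᵏ).
    trace-zero : ∀ {y z} (D : Degree y) (D′ : Degree z) (let open Degree) →
                 In (y ^ d D) → In (z ^ d D′) → ¬ In z → (z∈ : Span (d D) y z) → Span (d D′) z y →
                 d D ·× proj₁ z∈ zero ≈ 0#
    trace-zero {y} {z} D D′ yᵈ∈ zᵈ∈ z∉ z∈ y∈ = begin
      d ·× a₀                                              ≈⟨ sum-replicate d ⟨
      sum {d} (λ i → a₀)                                   ≈⟨ sum-cong-≋ {d} (λ i → sym (multiples-diagonal D yᵈ∈ z∈ (toℕ i) i zero ≡.refl)) ⟩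
      sum {d} (λ i → C (toℕ i) i)                          ≈⟨ sum-cong-≋ {d} C-expand ⟩
      sum {d} (λ i → sum {d′} (λ k → B i k * A (suc (toℕ k)) i)) ≈⟨ ∑-comm {d} {d′} (λ i k → B i k * A (suc (toℕ k)) i) ⟩
      sum {d′} (λ k → sum {d} (λ i → B i k * A (suc (toℕ k)) i)) ≈⟨ sum-zero {d′} vanish ⟩
      0#                                                   ∎
      where
      open Degree D
      module D′ = Degree D′
      d′ = D′.d
      a₀ = proj₁ z∈ zero
      C = multiples D yᵈ∈ z∈

      z^∈ : ∀ k → Span d y (z ^ k)
      z^∈ k = Subfield.^∈ (adjoin D) k z∈

      A : ℕ → Vector Carrier d
      A k = proj₁ (z^∈ k)

      y^∈ : ∀ (i : Fin d) → Span d′ z (y ^ toℕ i)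
      y^∈ i = Subfield.^∈ (adjoin D′) (toℕ i) y∈

      B : Fin d → Vector Carrier d′
      B i = proj₁ (y^∈ i)

      C-expand : ∀ i → C (toℕ i) i ≈ sum {d′} (λ k → B i k * A (suc (toℕ k)) i)
      C-expand i = unique (multiples∈ D yᵈ∈ z∈ (toℕ i))
        (λ m → sum∈ {d′} (λ k → *∈ (proj₁ (proj₂ (y^∈ i)) k) (proj₁ (proj₂ (z^∈ (suc (toℕ k)))) m))) (begin
        eval (C (toℕ i)) y
          ≈⟨ eval-multiples D yᵈ∈ z∈ (toℕ i) ⟩
        y ^ toℕ i * z
          ≈⟨ trans (*-congʳ (proj₂ (proj₂ (y^∈ i)))) (*-distribʳ-sum {d′} z (λ k → B i k * z ^ toℕ k)) ⟩
        sum {d′} (λ k → B i k * z ^ toℕ k * z)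
          ≈⟨ sum-cong-≋ {d′} (λ k → begin
            B i k * z ^ toℕ k * z                                  ≈⟨ solve 3 (λ b x z → b :* x :* z := b :* (z :* x)) refl (B i k) (z ^ toℕ k) z ⟩
            B i k * z ^ suc (toℕ k)                                ≈⟨ *-congˡ (proj₂ (proj₂ (z^∈ (suc (toℕ k))))) ⟩
            B i k * eval (A (suc (toℕ k))) y                       ≈⟨ *-distribˡ-sum {d} (B i k) (λ m → A (suc (toℕ k)) m * y ^ toℕ m) ⟩
            sum {d} (λ m → B i k * (A (suc (toℕ k)) m * y ^ toℕ m)) ∎) ⟩
        sum {d′} (λ k → sum {d} (λ m → B i k * (A (suc (toℕ k)) m * y ^ toℕ m)))
          ≈⟨ ∑-comm {d′} {d} (λ k m → B i k * (A (suc (toℕ k)) m * y ^ toℕ m)) ⟩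
        sum {d} (λ m → sum {d′} (λ k → B i k * (A (suc (toℕ k)) m * y ^ toℕ m)))
          ≈⟨ sum-cong-≋ {d} (λ m → trans (sum-cong-≋ {d′} (λ k → sym (*-assoc (B i k) (A (suc (toℕ k)) m) (y ^ toℕ m))))
               (sym (*-distribʳ-sum {d′} (y ^ toℕ m) (λ k → B i k * A (suc (toℕ k)) m)))) ⟩
        eval (λ m → sum {d′} (λ k → B i k * A (suc (toℕ k)) m)) y ∎) i

      shift-unit : ∀ k → shift D′.r (unit k) k ≈ 0#
      -- The entry is `r zero` if d′ = 1 and 0 otherwise; d′ = 1 would mean z ∈ M.
      shift-unit zero    = trans (*-congˡ (last≈0 D′.d-1 (λ d′≡1 → z∉ (∈-resp (*-identityʳ z) (≡.subst (In ∘ (z ^_) ∘ suc) d′≡1 zᵈ∈))))) (zeroʳ _)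
        where
        last≈0 : ∀ n → n ≢ 0 → last (unit {suc n} zero) ≈ 0#
        last≈0 zero    n≢0 = ⊥-elim (n≢0 ≡.refl)
        last≈0 (suc n) n≢0 = unit-off {i = zero} {j = fromℕ (suc n)} λ ()
      shift-unit (suc k) = trans (+-cong (unit-off (λ e → ℕₚ.1+n≢n (≡.trans (≡.cong toℕ e) (toℕ-inject₁ k))))
        (trans (*-congʳ (binomial D′ zᵈ∈ (suc k))) (zeroˡ _))) (+-identityʳ 0#)

      -- This sum is the coordinate of z^(k+1) at z^k in the basis of the powers of z.
      vanish : ∀ k → sum {d} (λ i → B i k * A (suc (toℕ k)) i) ≈ 0#
      vanish k = trans (D′.unique {λ m → sum {d} (λ i → B i m * A (suc (toℕ k)) i)}
        (λ m → sum∈ {d} (λ i → *∈ (proj₁ (proj₂ (y^∈ i)) m) (proj₁ (proj₂ (z^∈ (suc (toℕ k)))) i)))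
        (shift∈ D′.r∈ (unit∈ k)) (begin
        sum {d′} (λ m → sum {d} (λ i → B i m * A (suc (toℕ k)) i) * z ^ toℕ m)
          ≈⟨ sum-cong-≋ {d′} (λ m → *-distribʳ-sum {d} (z ^ toℕ m) (λ i → B i m * A (suc (toℕ k)) i)) ⟩
        sum {d′} (λ m → sum {d} (λ i → B i m * A (suc (toℕ k)) i * z ^ toℕ m))
          ≈⟨ ∑-comm {d′} {d} (λ m i → B i m * A (suc (toℕ k)) i * z ^ toℕ m) ⟩
        sum {d} (λ i → sum {d′} (λ m → B i m * A (suc (toℕ k)) i * z ^ toℕ m))
          ≈⟨ sum-cong-≋ {d} (λ i → begin
            sum {d′} (λ m → B i m * A (suc (toℕ k)) i * z ^ toℕ m)
              ≈⟨ sum-cong-≋ {d′} (λ m → solve 3 (λ b a z → b :* a :* z := a :* (b :* z)) refl (B i m) (A (suc (toℕ k)) i) (z ^ toℕ m)) ⟩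
            sum {d′} (λ m → A (suc (toℕ k)) i * (B i m * z ^ toℕ m))
              ≈⟨ *-distribˡ-sum {d′} (A (suc (toℕ k)) i) (λ m → B i m * z ^ toℕ m) ⟨
            A (suc (toℕ k)) i * eval (B i) z
              ≈⟨ *-congˡ (proj₂ (proj₂ (y^∈ i))) ⟨
            A (suc (toℕ k)) i * y ^ toℕ i ∎) ⟩
        eval (A (suc (toℕ k))) y        ≈⟨ proj₂ (proj₂ (z^∈ (suc (toℕ k)))) ⟨
        z ^ suc (toℕ k)                 ≈⟨ *-congˡ (eval-unit k z) ⟨
        z * eval (unit k) z             ≈⟨ eval-shift D′.r (unit k) D′.yᵈ ⟨
        eval (shift D′.r (unit k)) z    ∎) k) (shift-unit k)

  module Radical (M : Subfield)
    (μ∈ : ∀ {p x} → Prime p → x ^ p ≈ 1# → Subfield.In M x)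
    (μ₄∈ : ∀ {x} → x ^ 4 ≈ 1# → Subfield.In M x)
    {y} (D : Extension.Degree M y)
    (d-prime : Prime (Extension.Degree.d D))
    (yᵈ∈ : Subfield.In M (y ^ Extension.Degree.d D))
    (d≉0 : ¬ Extension.Degree.d D ·× 1# ≈ 0#)
    where

    open Subfield M
    open Extension M
    open Simple M
    open Trace M
    open Degree D

    1<d : 1 < d
    1<d = ℕ.nonTrivial⇒n>1 d {{prime⇒nonTrivial d-prime}}

    y∉ : ¬ In y
    y∉ y∈ = minimal 1<d (resp′ (scalar-span y y∈))
      where
      resp′ : Span 1 y y → Span 1 y (y ^ 1)
      resp′ (a , a∈ , e) = a , a∈ , trans (*-identityʳ y) e

    y≉0 : ¬ y ≈ 0#
    y≉0 y≈0 = y∉ (∈-resp (sym y≈0) 0∈)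

    module M[y] = Subfield (adjoin D)

    -- If y ∉ M(z), then 1, y, …, yᵈ⁻¹ are independent over M(z), so the expansion
    -- of z in powers of y reduces to its constant term.
    generator-exchange : ∀ {z} (D′ : Degree z) → Span d y z → ¬ In z → Span (Degree.d D′) z y
    generator-exchange {z} D′ (a , a∈ , e) z∉ = stable λ y∉′ →
      let D″ , d″≡d = Simple.kummer (adjoin D′) (λ p-prime → M⊆M[z] ∘ μ∈ p-prime) d-prime y≉0 (M⊆M[z] yᵈ∈) y∉′
          b₀≈0 = Extension.independent-below (adjoin D′) (Extension.Degree.minimal D″)
                   (ℕₚ.≤-reflexive (≡.sym d″≡d)) b b∈ b≈0 zero
      in z∉ (∈-resp (begin
           a zero                ≈⟨ +-identityʳ _ ⟨
           a zero + 0#           ≈⟨ +-congˡ (-‿inverseˡ z) ⟨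
           a zero + (- z + z)    ≈⟨ +-assoc _ _ _ ⟨
           (a zero + - z) + z    ≈⟨ +-congʳ b₀≈0 ⟩
           0# + z                ≈⟨ +-identityˡ z ⟩
           z                     ∎) (a∈ zero))
      where
      M⊆M[z] : ∀ {x} → In x → Span (Degree.d D′) z x
      M⊆M[z] = scalar-span z

      b : Vector Carrier d
      b zero    = a zero + - z
      b (suc i) = a (suc i)

      b∈ : ∀ i → Span (Degree.d D′) z (b i)
      b∈ zero    = Subfield.+∈ (adjoin D′) (M⊆M[z] (a∈ zero))
        (Subfield.-∈ (adjoin D′) (Subfield.∈-resp (adjoin D′) (*-identityʳ z) (generator^∈ D′ 1)))
      b∈ (suc i) = M⊆M[z] (a∈ (suc i))

      b≈0 : eval b y ≈ 0#
      b≈0 = begin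
        eval b y                                   ≈⟨ eval-suc b y ⟩
        (a zero + - z) + y * eval (tail a) y       ≈⟨ solve 3 (λ a z w → a :+ z :+ w := a :+ w :+ z) refl (a zero) (- z) _ ⟩
        (a zero + y * eval (tail a) y) + - z       ≈⟨ +-congʳ (trans (sym (eval-suc a y)) (sym e)) ⟩
        z + - z                                    ≈⟨ -‿inverseʳ z ⟩
        0#                                         ∎

    degree-exchange : ∀ {z} (D′ : Degree z) → Span d y z → ¬ In z → Degree.d D′ ≡ d
    degree-exchange D′ z∈ z∉ = ℕₚ.≤-antisym
      (degree-≤ D′ (λ k → M[y].^∈ k z∈))
      (degree-≤ D (λ k → Subfield.^∈ (adjoin D′) k (generator-exchange D′ z∈ z∉)))

    radical-norm : ∀ {z n} → Span d y z → ¬ In z → In (z ^ suc n) →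
                   ∃[ N ] In N × (∀ m → In (z ^ m) → N ^ m ≈ (z ^ d) ^ m)
    radical-norm {z} {n} z∈ z∉ zⁿ∈ =
      let D′ , _     = degree-power {n = n} zⁿ∈
          N , N∈ , e = norm D′
      in N , N∈ , λ m zᵐ∈ → trans (e m zᵐ∈) (^-congˡ m (^-congʳ z (degree-exchange D′ z∈ z∉)))

    -- If z ∉ M, then z has degree d and its norm is z ^ d up to a q-th root of unity. So z ^ d ∈ M,
    -- and as z ^ q ∈ M with q ≠ d, also z ∈ M.
    coprime-radical : ∀ {q z} → Prime q → q ≢ d → ¬ z ≈ 0# → Span d y z → In (z ^ q) → In z
    coprime-radical {zero}  (Primality.prime {{()}} _)
    coprime-radical {suc q} {z} q-prime q≢d z≉0 z∈ zq∈ = stable λ z∉ →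
      let N , N∈ , e = radical-norm {n = q} z∈ z∉ zq∈ in
      z∉ (coprime-powers z≉0 (distinct-primes q-prime d-prime q≢d) zq∈
           (root-ratio∈ μ∈ q-prime (^-≉0 d z≉0) N∈ (e (suc q) zq∈)))

    -- The trace of multiplication by z is d times this coefficient and vanishes by `trace-zero`;
    -- `d≉0` permits the division.
    radical-constant : ∀ {z} (z∈ : Span d y z) → In (z ^ d) → ¬ In z → proj₁ z∈ zero ≈ 0#
    radical-constant {z} z∈ zᵈ∈ z∉ = domain d≉0 (trans (trans (×-assoc-* d 1# _) (×-congʳ d (*-identityˡ _)))
      (trace-zero D D′ yᵈ∈ (≡.subst (In ∘ (z ^_)) (≡.sym (degree-exchange D′ z∈ z∉)) zᵈ∈) z∉ z∈
        (generator-exchange D′ z∈ z∉)))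
      where D′ = proj₁ (degree-power {n = d-1} zᵈ∈)

    -- If aₖ ≠ 0, multiplication by y^(d-k) turns aₖ yᵏ into the constant term aₖ yᵈ ≠ 0. By
    -- `radical-constant` the product y^(d-k) z cannot lie outside M.
    kummer-radical : ∀ {z} → ¬ z ≈ 0# → Span d y z → In (z ^ d) → ∃[ j ] In (y ^ j * z)
    kummer-radical {z} z≉0 z∈@(a , a∈ , e) zᵈ∈ with em {P = ∃[ k ] ¬ a k ≈ 0#}
    ... | no all-zero    = ⊥-elim (z≉0 (trans e (eval-zero {y = y} (λ k → stable (λ aₖ≉0 → all-zero (k , aₖ≉0))))))
    ... | yes (k , aₖ≉0) = suc i , stable λ w∉ → constant≉0 (radical-constant w∈ wᵈ∈ w∉)
      where
      i : ℕ
      -- After i shifts aₖ is the last entry; shift number `suc i` carries it to entry zero.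
      i = d-1 ℕ.∸ toℕ k

      w∈ : Span d y (y ^ suc i * z)
      w∈ = multiples D yᵈ∈ z∈ (suc i) , multiples∈ D yᵈ∈ z∈ (suc i) , sym (eval-multiples D yᵈ∈ z∈ (suc i))

      wᵈ∈ : In ((y ^ suc i * z) ^ d)
      wᵈ∈ = ∈-resp (trans (*-congʳ (begin
          (y ^ d) ^ suc i       ≈⟨ ^-assocʳ y d (suc i) ⟩
          y ^ (d ℕ.* suc i)     ≈⟨ ^-congʳ y (ℕₚ.*-comm d (suc i)) ⟩
          y ^ (suc i ℕ.* d)     ≈⟨ ^-assocʳ y (suc i) d ⟨
          (y ^ suc i) ^ d       ∎)) (sym (^-distrib-* (y ^ suc i) z d))) (*∈ (^∈ (suc i) yᵈ∈) zᵈ∈)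

      constant≉0 : ¬ r zero * last (multiples D yᵈ∈ z∈ i) ≈ 0#
      constant≉0 = *-≉0 (λ r₀≈0 → ^-≉0 d y≉0 (trans (sym (binomial D yᵈ∈ zero)) r₀≈0))
        (λ l≈0 → aₖ≉0 (trans (sym (multiples-diagonal D yᵈ∈ z∈ i (fromℕ d-1) k
          (≡.trans (toℕ-fromℕ d-1) (≡.sym (ℕₚ.m+[n∸m]≡n (ℕₚ.≤-pred (toℕ<n k))))))) l≈0))

    -- With σ : y ↦ ζy the product P = ∏ σⁱ(z) is fixed by σ, hence in M, and
    -- Pᵈ = (zᵈ)ᵈ up to a power of ζ^(0 + 1 + ⋯ + (d-1)) = 1.
    module _ {ζ} (ζ∈ : In ζ) (ζᵈ≈1 : ζ ^ d ≈ 1#) (ζ≉1 : ¬ ζ ≈ 1#) (d≢2 : d ≢ 2)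
             {z} (z≉0 : ¬ z ≈ 0#) (z∈ : Span d y z) {j} (e∈ : In (y ^ j * z ^ d)) where

      private
        a = proj₁ z∈
        e = y ^ j * z ^ d

        r-constant : ∀ i → r i ≈ constant (y ^ d) i
        r-constant = binomial D yᵈ∈

        [ζy]ᵈ : (ζ * y) ^ d ≈ eval r (ζ * y)
        [ζy]ᵈ = begin
          (ζ * y) ^ d         ≈⟨ ^-distrib-* ζ y d ⟩
          ζ ^ d * y ^ d       ≈⟨ trans (*-congʳ ζᵈ≈1) (*-identityˡ _) ⟩
          y ^ d               ≈⟨ r-constant zero ⟨
          r zero              ≈⟨ eval-constant {d-1} {r} {ζ * y} (r-constant ∘ suc) ⟨
          eval r (ζ * y)      ∎

        open Conjugate D [ζy]ᵈ

        twist : Carrier → Vector Carrier d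
        twist ω i = a i * ω ^ toℕ i

        twist-eval : ∀ ω x → eval (twist ω) x ≈ eval a (ω * x)
        twist-eval ω x = sum-cong-≋ {d} (λ i → trans (*-assoc (a i) _ _) (*-congˡ (sym (^-distrib-* ω x (toℕ i)))))

        eval-congʳ : ∀ {x x′} → x ≈ x′ → eval a x ≈ eval a x′
        eval-congʳ x≈x′ = sum-cong-≋ {d} (λ i → *-congˡ {a i} (^-congˡ (toℕ i) x≈x′))

        η σz : ℕ → Carrier
        η i  = ζ ^ i * y
        σz i = eval a (η i)

        ζη : ∀ i → ζ ^ i * (ζ * y) ≈ η (suc i)
        ζη i = solve 3 (λ x z y → x :* (z :* y) := z :* x :* y) refl (ζ ^ i) ζ y

        conj-η : ∀ i → Conj (η i) (η (suc i))
        conj-η i = conj-resp refl (ζη i) (conj-scale (^∈ i ζ∈) conj-generator)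

        conj-σz : ∀ i → Conj (σz i) (σz (suc i))
        conj-σz i = twist (ζ ^ i) , (λ k → *∈ (proj₁ (proj₂ z∈) k) (^∈ (toℕ k) (^∈ i ζ∈))) ,
          sym (twist-eval (ζ ^ i) y) , trans (eval-congʳ (sym (ζη i))) (sym (twist-eval (ζ ^ i) (ζ * y)))

        z≈σz₀ : z ≈ σz 0
        z≈σz₀ = trans (proj₂ (proj₂ z∈)) (eval-congʳ (sym (*-identityˡ y)))

        σz-periodic : σz d ≈ σz 0
        σz-periodic = eval-congʳ (*-congʳ ζᵈ≈1)

        P = ∏ d σz

        P-fixed : ∏ d (σz ∘ suc) ≈ P
        P-fixed = *-cancelˡ (z≉0 ∘ trans z≈σz₀) (trans (∏-shift d σz) (trans (*-congˡ σz-periodic) (*-comm _ _)))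

        conj-∏ : ∀ n → Conj (∏ n σz) (∏ n (σz ∘ suc))
        conj-∏ zero    = conj-scalar 1∈
        conj-∏ (suc n) = conj-* (conj-∏ n) (conj-σz n)

        -- Comparing coordinates gives bᵢ = bᵢ ζⁱ, and ζⁱ ≠ 1 for 0 < i < d since d is prime.
        fixed⇒∈ : ∀ {x} → Conj x x → In x
        fixed⇒∈ {x} (b , b∈ , e , e′) = ∈-resp (sym (trans e (eval-constant {d-1} {b} {y} bᵢ≈0))) (b∈ zero)
          where
          ζⁱ≉1 : ∀ (i : Fin d-1) → ¬ ζ ^ suc (toℕ i) ≈ 1#
          ζⁱ≉1 i ζⁱ≈1 = ζ≉1 (coprime-orders *-monoid (prime⇒coprime d-prime (s≤s (toℕ<n i))) ζᵈ≈1 ζⁱ≈1)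

          b-fixed : ∀ i → b i ≈ b i * ζ ^ toℕ i
          b-fixed = unique b∈ (λ i → *∈ (b∈ i) (^∈ (toℕ i) ζ∈)) (trans (sym e) (trans e′
            (sum-cong-≋ {d} (λ i → trans (*-congˡ (^-distrib-* ζ y (toℕ i))) (sym (*-assoc (b i) _ _))))))

          bᵢ≈0 : ∀ i → b (suc i) ≈ 0#
          bᵢ≈0 i = stable λ b≉0 → ζⁱ≉1 i (*-cancelˡ b≉0 (trans (sym (b-fixed (suc i))) (sym (*-identityʳ _))))

        P∈ : In P
        P∈ = fixed⇒∈ (conj-resp refl P-fixed (conj-∏ d))

        -- As e ∈ M is conjugate only to itself, repeated application of σ to e = y ^ j z ^ d keeps
        -- the value.
        conjugates : ∀ i → η i ^ j * σz i ^ d ≈ e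
        conjugates zero    = *-cong (^-congˡ j (*-identityˡ y)) (^-congˡ d (sym z≈σz₀))
        conjugates (suc i) = conj-functional
          (conj-* (conj-^ j (conj-η i)) (conj-^ d (conj-σz i))) (conj-scalar e∈) (conjugates i)

        ∏η : ∏ d η ≈ y ^ d
        ∏η = begin
          ∏ d η                         ≈⟨ ∏-geometric d ζ y ⟩
          ζ ^ triangular d * y ^ d      ≈⟨ *-congʳ (ζ^multiple (odd-prime∣triangular d-prime d≢2)) ⟩
          1# * y ^ d                    ≈⟨ *-identityˡ _ ⟩
          y ^ d                         ∎
          where
          ζ^multiple : ∀ {n} → d ∣ n → ζ ^ n ≈ 1#
          ζ^multiple {n} (divides q n≡qd) = begin
            ζ ^ n           ≈⟨ ^-congʳ ζ (≡.trans n≡qd (ℕₚ.*-comm q d)) ⟩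
            ζ ^ (d ℕ.* q)   ≈⟨ ^-assocʳ ζ d q ⟨
            (ζ ^ d) ^ q     ≈⟨ trans (^-congˡ q ζᵈ≈1) (^-zeroˡ q) ⟩
            1#              ∎

        Pᵈ : P ^ d ≈ (z ^ d) ^ d
        Pᵈ = *-cancelˡ (^-≉0 j (^-≉0 d y≉0)) (begin
          (y ^ d) ^ j * P ^ d                            ≈⟨ *-congʳ (^-congˡ j ∏η) ⟨
          ∏ d η ^ j * P ^ d                              ≈⟨ *-cong (∏-^ d η j) (∏-^ d σz d) ⟨
          ∏ d (λ i → η i ^ j) * ∏ d (λ i → σz i ^ d)     ≈⟨ ∏-* d conjugates ⟩
          ∏ d (λ _ → e)                                  ≈⟨ ∏-constant d e ⟩
          e ^ d                                          ≈⟨ ^-distrib-* (y ^ j) (z ^ d) d ⟩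
          (y ^ j) ^ d * (z ^ d) ^ d                      ≈⟨ *-congʳ (trans (^-assocʳ y j d) (trans (^-congʳ y (ℕₚ.*-comm j d)) (sym (^-assocʳ y d j)))) ⟩
          (y ^ d) ^ j * (z ^ d) ^ d                      ∎)

      odd-twisted-power∈ : In (z ^ d)
      odd-twisted-power∈ = root-ratio∈ μ∈ d-prime (^-≉0 d z≉0) P∈ Pᵈ

    -- If zᵈ ∉ M, the norm N of z satisfies zᵈ = θN with θ ∉ M a root of unity
    -- of order dividing d², so that θᵈ is a primitive d-th root of unity in M.
    twisted-power∈ : ∀ {z j} → ¬ z ≈ 0# → Span d y z → In (y ^ j * z ^ d) → In (z ^ d)
    twisted-power∈ {z} {j} z≉0 z∈ e∈ = stable λ zᵈ∉ →
      let N , N∈ , N-power = radical-norm {n = d-1 ℕ.+ d-1 ℕ.* d} z∈ (zᵈ∉ ∘ ^∈ d) zᵈᵈ∈ in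
      roots-of-unity zᵈ∉ N∈ (N-power (d ℕ.* d) zᵈᵈ∈)
      where
      zᵈᵈ∈ : In (z ^ (d ℕ.* d))
      zᵈᵈ∈ = div∈ (^-≉0 j (^-≉0 d y≉0)) (^∈ j yᵈ∈) (∈-resp (begin
        (y ^ j * z ^ d) ^ d             ≈⟨ ^-distrib-* (y ^ j) (z ^ d) d ⟩
        (y ^ j) ^ d * (z ^ d) ^ d       ≈⟨ *-cong (^-assocʳ y j d) (^-assocʳ z d d) ⟩
        y ^ (j ℕ.* d) * z ^ (d ℕ.* d)   ≈⟨ *-congʳ (^-congʳ y (ℕₚ.*-comm j d)) ⟩
        y ^ (d ℕ.* j) * z ^ (d ℕ.* d)   ≈⟨ *-congʳ (^-assocʳ y d j) ⟨
        (y ^ d) ^ j * z ^ (d ℕ.* d)     ∎) (^∈ d e∈))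

      roots-of-unity : ∀ {N} → ¬ In (z ^ d) → In N → ¬ N ^ (d ℕ.* d) ≈ (z ^ d) ^ (d ℕ.* d)
      roots-of-unity {N} zᵈ∉ N∈ Nᵈᵈ = case d ℕₚ.≟ 2 of λ where
          -- For d = 2 the conjugates of y have product -y², so the argument for odd d would fail by
          -- a sign; but θ ^ 4 = 1 already places θ in M.
          (yes d≡2) → θ∉ (μ₄∈ (≡.subst (λ n → θ ^ (n ℕ.* n) ≈ 1#) d≡2 θᵈᵈ≈1))
          (no  d≢2) → zᵈ∉ (odd-twisted-power∈ (μ∈ d-prime ζᵈ≈1) ζᵈ≈1 (θ∉ ∘ μ∈ d-prime) d≢2 z≉0 z∈ {j} e∈)
        where
        N≉0 : ¬ N ≈ 0#
        N≉0 N≈0 = ^-≉0 (d ℕ.* d) (^-≉0 d z≉0) (trans (sym Nᵈᵈ) (trans (*-congʳ N≈0) (zeroˡ _)))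

        N′    = proj₁ (inverse N≉0)
        NN′≈1 = proj₂ (inverse N≉0)

        θ = z ^ d * N′

        θ∉ : ¬ In θ
        θ∉ θ∈ = zᵈ∉ (∈-resp (begin
          z ^ d * N′ * N     ≈⟨ trans (*-assoc _ _ _) (*-congˡ (trans (*-comm N′ N) NN′≈1)) ⟩
          z ^ d * 1#         ≈⟨ *-identityʳ _ ⟩
          z ^ d              ∎) (*∈ θ∈ N∈))

        θᵈᵈ≈1 : θ ^ (d ℕ.* d) ≈ 1#
        θᵈᵈ≈1 = begin
          (z ^ d * N′) ^ (d ℕ.* d)                 ≈⟨ ^-distrib-* (z ^ d) N′ (d ℕ.* d) ⟩
          (z ^ d) ^ (d ℕ.* d) * N′ ^ (d ℕ.* d)     ≈⟨ *-congʳ Nᵈᵈ ⟨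
          N ^ (d ℕ.* d) * N′ ^ (d ℕ.* d)           ≈⟨ ^-distrib-* N N′ (d ℕ.* d) ⟨
          (N * N′) ^ (d ℕ.* d)                     ≈⟨ trans (^-congˡ (d ℕ.* d) NN′≈1) (^-zeroˡ (d ℕ.* d)) ⟩
          1#                                       ∎

        ζᵈ≈1 : (θ ^ d) ^ d ≈ 1#
        ζᵈ≈1 = trans (^-assocʳ θ d d) θᵈᵈ≈1

    -- Induction gives y ^ j z ^ q ∈ M, and z ^ d ∈ M follows: by `twisted-power∈` if q = d, and
    -- otherwise because (z ^ d) ^ q ∈ M with q ≠ d. Then `kummer-radical` applies.
    radical∈ : ∀ {qs z} → All Prime qs → ¬ z ≈ 0# → Span d y z → In (z ^ product qs) → ∃[ j ] In (y ^ j * z)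
    radical∈ {[]} {z} [] z≉0 z∈ h = 0 , ∈-resp (trans (*-identityʳ z) (sym (*-identityˡ z))) h
    radical∈ {q ∷ qs} {z} (q-prime ∷ qs-prime) z≉0 z∈ h
      with radical∈ qs-prime (^-≉0 q z≉0) (M[y].^∈ q z∈) (∈-resp (sym (^-assocʳ z q (product qs))) h) | q ℕₚ.≟ d
    ... | j , e∈ | yes ≡.refl = kummer-radical z≉0 z∈ (twisted-power∈ {j = j} z≉0 z∈ e∈)
    ... | j , e∈ | no q≢d     = kummer-radical z≉0 z∈ (coprime-radical q-prime q≢d (^-≉0 d z≉0) (M[y].^∈ d z∈)
      (div∈ (^-≉0 j (^-≉0 d y≉0)) (^∈ j yᵈ∈) (∈-resp (begin
        (y ^ j * z ^ q) ^ d             ≈⟨ ^-distrib-* (y ^ j) (z ^ q) d ⟩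
        (y ^ j) ^ d * (z ^ q) ^ d       ≈⟨ *-cong (trans (^-assocʳ y j d) (^-congʳ y (ℕₚ.*-comm j d)))
                                             (trans (^-assocʳ z q d) (^-congʳ z (ℕₚ.*-comm q d))) ⟩
        y ^ (d ℕ.* j) * z ^ (d ℕ.* q)   ≈⟨ *-cong (^-assocʳ y d j) (^-assocʳ z d q) ⟨
        (y ^ d) ^ j * (z ^ d) ^ q       ∎) (^∈ d e∈))))

  -- Towers of radical extensions

  module ClassSum (M : Subfield) where
    open Subfield M

    Torsion : Pred Carrier (c ⊔ ℓ ⊔ u)
    Torsion x = ¬ x ≈ 0# × ∃[ n ] In (x ^ suc n)

    infix 4 _~_
    -- For h ≠ 0 the factor m is automatically nonzero, so that this is congruence modulo Mˣ.
    _~_ : Carrier → Carrier → Set (c ⊔ ℓ ⊔ u)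
    h ~ g = ∃[ m ] In m × h ≈ m * g

    select : ∀ {a} {P : Set a} → Dec P → Carrier → Carrier
    select (yes _) x = x
    select (no  _) x = 0#

    select-yes : ∀ {a} {P : Set a} (P? : Dec P) {x} → P → select P? x ≈ x
    select-yes (yes _) p = refl
    select-yes (no ¬p) p = ⊥-elim (¬p p)

    select-no : ∀ {a} {P : Set a} (P? : Dec P) {x} → ¬ P → select P? x ≈ 0#
    select-no (yes p) ¬p = ⊥-elim (¬p p)
    select-no (no _)  ¬p = refl

    -- A list of pairs (a , h) stands for Σ a h; classSum g is the part of this
    -- sum over the h in the class of g modulo Mˣ.
    classSum : Carrier → List (Carrier × Carrier) → Carrier
    classSum g []             = 0#
    classSum g ((a , h) ∷ ts) = select (em {P = h ~ g}) (a * h) + classSum g ts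

    classSum-yes : ∀ {a h g ts} → h ~ g → classSum g ((a , h) ∷ ts) ≈ a * h + classSum g ts
    classSum-yes h~g = +-congʳ (select-yes em h~g)

    classSum-no : ∀ {a h g ts} → ¬ h ~ g → classSum g ((a , h) ∷ ts) ≈ classSum g ts
    classSum-no h≁g = trans (+-congʳ (select-no em h≁g)) (+-identityˡ _)

  total : List (Carrier × Carrier) → Carrier
  total []             = 0#
  total ((a , h) ∷ ts) = a * h + total ts

  module Tower (K : Subfield)
    (μ∈ : ∀ {p x} → Prime p → x ^ p ≈ 1# → Subfield.In K x)
    (μ₄∈ : ∀ {x} → x ^ 4 ≈ 1# → Subfield.In K x)
    (separable : ∀ {p x} → Prime p → p ·× 1# ≈ 0# → ¬ x ≈ 0# → Subfield.In K (x ^ p) → Subfield.In K x)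
    where

    private module K = Subfield K
    open ClassSum K using (Torsion)

    torsion-/ : ∀ {x y z} → Torsion x → Torsion z → x ≈ y * z → Torsion y
    torsion-/ {x} {y} {z} (x≉0 , m , xᵐ∈) (z≉0 , n , zⁿ∈) x≈yz =
      *-≉0⁻ˡ (x≉0 ∘ trans x≈yz) , n ℕ.+ m ℕ.* suc n ,
      K.div∈ (^-≉0 (suc n) (^-≉0 (suc m) z≉0)) (K.∈-resp (begin
          (z ^ suc n) ^ suc m     ≈⟨ ^-assocʳ z (suc n) (suc m) ⟩
          z ^ (suc n ℕ.* suc m)   ≈⟨ ^-congʳ z (ℕₚ.*-comm (suc n) (suc m)) ⟩
          z ^ (suc m ℕ.* suc n)   ≈⟨ ^-assocʳ z (suc m) (suc n) ⟨
          (z ^ suc m) ^ suc n     ∎) (K.^∈ (suc m) zⁿ∈))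
        (K.∈-resp (begin
          (x ^ suc m) ^ suc n                           ≈⟨ ^-congˡ (suc n) (^-congˡ (suc m) (trans x≈yz (*-comm y z))) ⟩
          ((z * y) ^ suc m) ^ suc n                     ≈⟨ ^-congˡ (suc n) (^-distrib-* z y (suc m)) ⟩
          (z ^ suc m * y ^ suc m) ^ suc n               ≈⟨ ^-distrib-* (z ^ suc m) (y ^ suc m) (suc n) ⟩
          (z ^ suc m) ^ suc n * (y ^ suc m) ^ suc n     ≈⟨ *-congˡ (^-assocʳ y (suc m) (suc n)) ⟩
          (z ^ suc m) ^ suc n * y ^ (suc m ℕ.* suc n)   ∎) (K.^∈ (suc n) xᵐ∈))

    torsion-^ : ∀ {x} k → Torsion x → Torsion (x ^ k)
    torsion-^ {x} k (x≉0 , m , xᵐ∈) = ^-≉0 k x≉0 , m , K.∈-resp (begin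
      (x ^ suc m) ^ k     ≈⟨ ^-assocʳ x (suc m) k ⟩
      x ^ (suc m ℕ.* k)   ≈⟨ ^-congʳ x (ℕₚ.*-comm (suc m) k) ⟩
      x ^ (k ℕ.* suc m)   ≈⟨ ^-assocʳ x k (suc m) ⟨
      (x ^ k) ^ suc m     ∎) (K.^∈ k xᵐ∈)

    open ClassSum using (classSum)

    IsTerm : Pred (Carrier × Carrier) (c ⊔ ℓ ⊔ u)
    IsTerm (a , h) = K.In a × Torsion h

    -- The invariant carried up the tower. `descend` composes all steps down to `K`; separability is
    -- stated for elements that are torsion over `K`, because its transfer to M[y] rests on
    -- `power∈`, which concerns these.
    record Admissible (M : Subfield) : Set (c ⊔ ℓ ⊔ u) where
      private module M = Subfield M
      field
        K⊆M         : ∀ {x} → K.In x → M.In x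
        separable-M : ∀ {p x} → Prime p → p ·× 1# ≈ 0# → Torsion x → M.In (x ^ p) → M.In x
        descend     : ∀ {ts} → All IsTerm ts → (∀ {g} → Torsion g → classSum M g ts ≈ 0#) →
                      ∀ {g} → Torsion g → classSum K g ts ≈ 0#

    K-admissible : Admissible K
    K-admissible = record
      { K⊆M         = id
      ; separable-M = λ p-prime p≈0 (x≉0 , _) → separable p-prime p≈0 x≉0
      ; descend     = λ _ h → h
      }

    module _ {M : Subfield} (admissible : Admissible M) {y} (y∈T : Torsion y)
             (D : Extension.Degree M y) (d-prime : Prime (Extension.Degree.d D))
             (yᵈ∈ : Subfield.In M (y ^ Extension.Degree.d D)) (y∉ : ¬ Subfield.In M y) where

      private module M = Subfield M
      open Admissible admissible
      open Extension M
      open Degree D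

      private
        d≉0 : ¬ d ·× 1# ≈ 0#
        d≉0 d≈0 = y∉ (separable-M d-prime d≈0 y∈T yᵈ∈)

        open Radical M (λ p-prime → K⊆M ∘ μ∈ p-prime) (K⊆M ∘ μ₄∈) D d-prime yᵈ∈ d≉0
          using (module M[y]; radical∈; radical-constant; y≉0)

        N = Simple.adjoin M D

        -- From y ^ j x ∈ M by `radical∈`; taking d-th powers removes y.
        power∈ : ∀ {x} → Torsion x → M[y].In x → M.In (x ^ d)
        power∈ {x} (x≉0 , n , xⁿ∈) x∈ =
          let open PrimeFactorisation (factorise (suc n))
              j , e∈ = radical∈ factorsPrime x≉0 x∈ (M.∈-resp (^-congʳ x isFactorisation) (K⊆M xⁿ∈))
          in M.div∈ (^-≉0 j (^-≉0 d y≉0)) (M.^∈ j yᵈ∈) (M.∈-resp (begin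
            (y ^ j * x) ^ d         ≈⟨ ^-distrib-* (y ^ j) x d ⟩
            (y ^ j) ^ d * x ^ d     ≈⟨ *-congʳ (^-assocʳ y j d) ⟩
            y ^ (j ℕ.* d) * x ^ d   ≈⟨ *-congʳ (^-congʳ y (ℕₚ.*-comm j d)) ⟩
            y ^ (d ℕ.* j) * x ^ d   ≈⟨ *-congʳ (^-assocʳ y d j) ⟨
            (y ^ d) ^ j * x ^ d     ∎) (M.^∈ d e∈))

        M⊆M[y] : ∀ {x} → M.In x → M[y].In x
        M⊆M[y] = scalar-span y

        -- The d-th power of x ^ q lies in M, where separability gives x ^ d ∈ M. Here q ≠ d because
        -- d is nonzero in the field, so x ^ d and x ^ q together yield x.
        separable-M[y] : ∀ {q x} → Prime q → q ·× 1# ≈ 0# → Torsion x → M[y].In (x ^ q) → M[y].In x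
        separable-M[y] {q} {x} q-prime q≈0 x∈T@(x≉0 , _) xq∈ =
          M[y].coprime-powers x≉0 (distinct-primes q-prime d-prime (λ { ≡.refl → d≉0 q≈0 })) xq∈
            (M⊆M[y] (separable-M q-prime q≈0 (torsion-^ d x∈T) (M.∈-resp (begin
              (x ^ q) ^ d      ≈⟨ ^-assocʳ x q d ⟩
              x ^ (q ℕ.* d)    ≈⟨ ^-congʳ x (ℕₚ.*-comm q d) ⟩
              x ^ (d ℕ.* q)    ≈⟨ ^-assocʳ x d q ⟨
              (x ^ d) ^ q      ∎) (power∈ (torsion-^ q x∈T) xq∈))))

        module CM = ClassSum M
        module CN = ClassSum N

        -- The part of the sum in the class of g modulo M[y]ˣ is g times an element of M[y], whose
        -- constant coefficient comes from the class modulo Mˣ alone: a torsion element of M[y]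
        -- outside M has constant coefficient zero. Independence then passes the vanishing of the
        -- coarse part on to the fine one.
        Expansion : Carrier → List (Carrier × Carrier) → Set (c ⊔ ℓ ⊔ u)
        Expansion g ts = Σ[ α ∈ Vector Carrier d ]
          AllIn α × CN.classSum g ts ≈ eval α y * g × CM.classSum g ts ≈ α zero * g

        collect : ∀ a m g x → a * (m * g) + x * g ≈ (a * m + x) * g
        collect = solve 4 (λ a m g x → a :* (m :* g) :+ x :* g := (a :* m :+ x) :* g) refl

        extend : ∀ {a h g ts} → K.In a → Torsion h → Torsion g → Dec (h CM.~ g) → Dec (h CN.~ g) →
                 Expansion g ts → Expansion g ((a , h) ∷ ts)
        extend {ts = ts} a∈ h∈T g∈T (no h≁g) (no h≁g′) (α , α∈ , e , f) =
          α , α∈ , trans (CN.classSum-no {ts = ts} h≁g′) e , trans (CM.classSum-no {ts = ts} h≁g) f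
        extend a∈ h∈T g∈T (yes (m , m∈ , h≈mg)) (no h≁g′) _ = ⊥-elim (h≁g′ (m , M⊆M[y] m∈ , h≈mg))
        extend {a} {h} {g} {ts} a∈ h∈T g∈T (yes h~g@(m , m∈ , h≈mg)) (yes h~g′) (α , α∈ , e , f) =
          β , (λ i → M.+∈ (constant∈ (M.*∈ (K⊆M a∈) m∈) i) (α∈ i)) ,
          (begin
            CN.classSum g ((a , h) ∷ ts)          ≈⟨ CN.classSum-yes {ts = ts} h~g′ ⟩
            a * h + CN.classSum g ts              ≈⟨ +-cong (*-congˡ h≈mg) e ⟩
            a * (m * g) + eval α y * g            ≈⟨ collect a m g (eval α y) ⟩
            (a * m + eval α y) * g                ≈⟨ *-congʳ (+-congʳ (eval-constant {d-1} {constant (a * m)} {y} (λ _ → refl))) ⟨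
            (eval {d} (constant (a * m)) y + eval α y) * g ≈⟨ *-congʳ (eval-+ (constant (a * m)) α y) ⟨
            eval β y * g                          ∎) ,
          (begin
            CM.classSum g ((a , h) ∷ ts)          ≈⟨ CM.classSum-yes {ts = ts} h~g ⟩
            a * h + CM.classSum g ts              ≈⟨ +-cong (*-congˡ h≈mg) f ⟩
            a * (m * g) + α zero * g              ≈⟨ collect a m g (α zero) ⟩
            β zero * g                            ∎)
          where
          β : Vector Carrier d
          β i = constant (a * m) i + α i
        extend {a} {h} {g} {ts} a∈ h∈T g∈T (no h≁g) (yes h~g′@(m , m∈@(b , b∈ , m≈b) , h≈mg)) (α , α∈ , e , f) =
          β , (λ i → M.+∈ (M.*∈ (K⊆M a∈) (b∈ i)) (α∈ i)) ,
          (begin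
            CN.classSum g ((a , h) ∷ ts)          ≈⟨ CN.classSum-yes {ts = ts} h~g′ ⟩
            a * h + CN.classSum g ts              ≈⟨ +-cong (*-congˡ (trans h≈mg (*-congʳ m≈b))) e ⟩
            a * (eval b y * g) + eval α y * g     ≈⟨ collect a (eval b y) g (eval α y) ⟩
            (a * eval b y + eval α y) * g         ≈⟨ *-congʳ (trans (eval-+ (λ i → a * b i) α y) (+-congʳ (eval-* a b y))) ⟨
            eval β y * g                          ∎) ,
          (begin
            CM.classSum g ((a , h) ∷ ts)          ≈⟨ trans (CM.classSum-no {ts = ts} h≁g) f ⟩
            α zero * g                            ≈⟨ *-congʳ (+-identityˡ _) ⟨
            (0# + α zero) * g                     ≈⟨ *-congʳ (+-congʳ (trans (*-congˡ b₀≈0) (zeroʳ a))) ⟨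
            β zero * g                            ∎)
          where
          β : Vector Carrier d
          β i = a * b i + α i

          b₀≈0 : b zero ≈ 0#
          -- The factor m = h / g is torsion over K, so m ^ d ∈ M; it lies outside M since h and g
          -- differ modulo Mˣ.
          b₀≈0 = radical-constant m∈ (power∈ (torsion-/ h∈T g∈T h≈mg) m∈) (λ m∈M → h≁g (m , m∈M , h≈mg))

        expand : ∀ {g ts} → Torsion g → All IsTerm ts → Expansion g ts
        expand {g} g∈T [] = constant 0# , constant∈ M.0∈ ,
          sym (trans (*-congʳ (eval-constant {d-1} {constant 0#} {y} (λ _ → refl))) (zeroˡ g)) , sym (zeroˡ g)
        expand {g} {_ ∷ ts} g∈T ((a∈ , h∈T) ∷ ts∈) = extend {ts = ts} a∈ h∈T g∈T em em (expand g∈T ts∈)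

        descend-step : ∀ {g ts} → Torsion g → All IsTerm ts → CN.classSum g ts ≈ 0# → CM.classSum g ts ≈ 0#
        descend-step {g} g∈T@(g≉0 , _) ts∈ zero-sum =
          let α , α∈ , e , f = expand g∈T ts∈ in
          trans f (trans (*-congʳ (independent α α∈ (domain g≉0 (trans (*-comm g _) (trans (sym e) zero-sum))) zero)) (zeroˡ g))

      adjoin-admissible : Admissible N
      adjoin-admissible = record
        { K⊆M         = M⊆M[y] ∘ K⊆M
        ; separable-M = separable-M[y]
        ; descend     = λ ts∈ zero-sums → descend ts∈ (λ g∈T → descend-step g∈T ts∈ (zero-sums g∈T))
        }

    Extends : Subfield → Subfield → Set (c ⊔ ℓ ⊔ u)
    Extends M N = ∀ {x} → Subfield.In M x → Subfield.In N x

    Reached : Subfield → Carrier → Set (lsuc (c ⊔ ℓ ⊔ u))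
    Reached M x = Σ[ N ∈ Subfield ] Admissible N × Extends M N × Subfield.In N x

    adjoin-root : ∀ {q w} M → Admissible M → Torsion w → Prime q → Subfield.In M (w ^ q) → Reached M w
    adjoin-root {q} {w} M admissible w∈T q-prime wq∈ = cases em
      where
      module M = Subfield M

      adjoined : ¬ M.In w → Σ[ D ∈ Extension.Degree M w ] Extension.Degree.d D ≡ q → Reached M w
      adjoined w∉ (D , ≡.refl) =
        Simple.adjoin M D , adjoin-admissible admissible w∈T D q-prime wq∈ w∉ , Extension.scalar-span M w ,
        Subfield.∈-resp (Simple.adjoin M D) (*-identityʳ w) (Simple.generator^∈ M D 1)

      cases : Dec (M.In w) → Reached M w
      cases (yes w∈) = M , admissible , id , w∈
      cases (no  w∉) = adjoined w∉ (Simple.kummer M (λ p-prime → Admissible.K⊆M admissible ∘ μ∈ p-prime) q-prime (proj₁ w∈T) wq∈ w∉)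

    -- Each prime factor of the exponent costs at most one step: x ^ product qs has its q-th power
    -- in M, and adjoining it leaves the exponent `product qs`.
    reach-power : ∀ {qs x} M → All Prime qs → Admissible M → Torsion x → Subfield.In M (x ^ product qs) → Reached M x
    reach-power M [] admissible x∈T h = M , admissible , id , Subfield.∈-resp M (*-identityʳ _) h
    reach-power {q ∷ qs} {x} M (q-prime ∷ qs-prime) admissible x∈T h =
      let M′ , admissible′ , M⊆M′ , w∈M′ = adjoin-root M admissible (torsion-^ (product qs) x∈T) q-prime
            (Subfield.∈-resp M (trans (^-congʳ x (ℕₚ.*-comm q (product qs))) (sym (^-assocʳ x (product qs) q))) h)
          N , N-admissible , M′⊆N , x∈N = reach-power M′ qs-prime admissible′ x∈T w∈M′
      in N , N-admissible , M′⊆N ∘ M⊆M′ , x∈N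

    reach : ∀ {ts} → All IsTerm ts → Σ[ M ∈ Subfield ] Admissible M × All (λ (a , h) → Subfield.In M h) ts
    reach [] = K , K-admissible , []
    reach {(a , h) ∷ ts} ((a∈ , h∈T@(_ , n , hⁿ∈)) ∷ ts∈) =
      let M , M-admissible , ts∈M = reach ts∈
          open PrimeFactorisation (factorise (suc n))
          N , N-admissible , M⊆N , h∈N = reach-power M factorsPrime M-admissible h∈T
            (Subfield.∈-resp M (^-congʳ h isFactorisation) (Admissible.K⊆M M-admissible hⁿ∈))
      in N , N-admissible , h∈N ∷ All.map M⊆N ts∈M

    module _ (M : Subfield) where
      private module M = Subfield M
      open ClassSum M using (_~_; classSum-yes; classSum-no)

      classSum-total : ∀ {g ts} → ¬ g ≈ 0# → M.In g → All (λ (a , h) → M.In h) ts → classSum M g ts ≈ total ts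
      classSum-total g≉0 g∈ [] = refl
      classSum-total {g} {(a , h) ∷ ts} g≉0 g∈ (h∈ ∷ ts∈) = let g′ , gg′≈1 = inverse g≉0 in
        trans (classSum-yes {ts = ts} (h * g′ , M.*∈ h∈ (M.inv∈ gg′≈1 g∈) , sym (begin
            h * g′ * g     ≈⟨ solve 3 (λ h g′ g → h :* g′ :* g := h :* (g :* g′)) refl h g′ g ⟩
            h * (g * g′)   ≈⟨ trans (*-congˡ gg′≈1) (*-identityʳ h) ⟩
            h              ∎))) (+-congˡ (classSum-total g≉0 g∈ ts∈))

      classSum-empty : ∀ {g ts} → ¬ M.In g → All (λ (a , h) → ¬ h ≈ 0# × M.In h) ts → classSum M g ts ≈ 0#
      classSum-empty g∉ [] = refl
      classSum-empty {ts = _ ∷ ts} g∉ ((h≉0 , h∈) ∷ ts∈) = trans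
        (classSum-no {ts = ts} λ (m , m∈ , h≈mg) → g∉ (M.div∈ (*-≉0⁻ˡ (h≉0 ∘ trans h≈mg)) m∈ (M.∈-resp h≈mg h∈)))
        (classSum-empty g∉ ts∈)

    -- Over a field M of the tower that contains every h there is just one class: for g ∈ M the
    -- class sum is the whole sum, for g ∉ M it is empty.
    classSums-vanish : ∀ {ts} → All IsTerm ts → total ts ≈ 0# → ∀ {g} → Torsion g → classSum K g ts ≈ 0#
    classSums-vanish {ts} ts∈ total≈0 = Admissible.descend admissible ts∈ λ {g} (g≉0 , _) →
      case em {P = Subfield.In M g} of λ where
        (yes g∈) → trans (classSum-total M g≉0 g∈ ts∈M) total≈0
        (no g∉)  → classSum-empty M g∉ (All.zipWith (λ ((_ , h≉0 , _) , h∈) → h≉0 , h∈) (ts∈ , ts∈M))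
      where
      reached    = reach ts∈
      M          = proj₁ reached
      admissible = proj₁ (proj₂ reached)
      ts∈M       = proj₂ (proj₂ reached)

-- Binomial coefficients and the Frobenius identity

absorption : ∀ n k → suc k ℕ.* (suc n choose suc k) ≡ suc n ℕ.* (n choose k)
absorption zero    zero    = ≡.refl
absorption zero    (suc k) = ℕₚ.*-zeroʳ k
absorption (suc n) zero    = begin
  1 ℕ.* (suc (suc n) choose 1)      ≡⟨ ℕₚ.*-identityˡ _ ⟩
  suc (suc n) choose 1              ≡⟨ nC1≡n (suc (suc n)) ⟩
  suc (suc n)                  ≡⟨ ℕₚ.*-identityʳ _ ⟨
  suc (suc n) ℕ.* 1            ∎
  where open ≡.≡-Reasoning
absorption (suc n) (suc k) = begin
  (2 + k) * (suc (suc n) choose (2 + k))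
    ≡⟨ ≡.cong ((2 + k) *_) (nCk+nC[k+1]≡[n+1]C[k+1] (suc n) (suc k)) ⟨
  (2 + k) * ((suc n choose suc k) + (suc n choose (2 + k)))
    ≡⟨ ℕₚ.*-distribˡ-+ (2 + k) (suc n choose suc k) _ ⟩
  (a + suc k * a) + (2 + k) * (suc n choose (2 + k))
    ≡⟨ ≡.cong₂ (λ s t → (a + s) + t) (absorption n k) (absorption n (suc k)) ⟩
  (a + suc n * (n choose k)) + suc n * (n choose suc k)
    ≡⟨ ℕₚ.+-assoc a _ _ ⟩
  a + (suc n * (n choose k) + suc n * (n choose suc k))
    ≡⟨ ≡.cong (a +_) (ℕₚ.*-distribˡ-+ (suc n) (n choose k) _) ⟨
  a + suc n * ((n choose k) + (n choose suc k))
    ≡⟨ ≡.cong (λ t → a + suc n * t) (nCk+nC[k+1]≡[n+1]C[k+1] n k) ⟩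
  a + suc n * a ∎
  where
  open ≡.≡-Reasoning
  open import Data.Nat.Base using (_+_; _*_)
  a = suc n choose suc k

-- With p = n + 1, absorption gives p ∣ (k + 1) · C(p, k + 1), while 0 < k + 1 < p.
prime∣C : ∀ {n k} → Prime (suc n) → k < n → suc n ∣ suc n choose suc k
prime∣C {n} {k} p-prime k<n with euclidsLemma (suc k) (suc n choose suc k) p-prime (≡.subst (suc n ∣_) (≡.sym (absorption n k)) (m∣m*n _))
... | inj₁ p∣k = ⊥-elim (ℕₚ.<⇒≱ (s<s k<n) (∣⇒≤ p∣k))
... | inj₂ p∣C = p∣C

module _ {c ℓ} (R : CommutativeSemiring c ℓ) where
  open CommutativeSemiring R hiding (zero)
  open Exp R using (_^_)
  open SemiringMult semiring using (×-congˡ; ×-congʳ; ×-assocˡ; ×-homo-1; ×-assoc-*) renaming (_×_ to _·×_)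
  open Sum semiring using (sum; sum-cong-≋; sum-init-last; sum-replicate-zero)
  open Binomial R using (binomialTerm; theorem)
  open SetoidReasoning setoid

  frobenius : ∀ {p} → Prime p → p ·× 1# ≈ 0# → ∀ x y → (x + y) ^ p ≈ y ^ p + x ^ p
  frobenius {zero}  (Primality.prime {{()}} _)
  frobenius {suc n} p-prime p≈0 x y = begin
    (x + y) ^ suc n
      ≈⟨ theorem (suc n) x y ⟩
    t zero + sum (t ∘ suc)
      ≈⟨ +-congˡ (sum-init-last (t ∘ suc)) ⟩
    t zero + (sum (t ∘ suc ∘ inject₁) + t (suc (fromℕ n)))
      ≈⟨ +-cong (trans (×-homo-1 _) (*-identityˡ _)) (+-cong (trans (sum-cong-≋ middle) (sum-replicate-zero n)) final) ⟩
    y ^ suc n + (0# + x ^ suc n)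
      ≈⟨ +-congˡ (+-identityˡ _) ⟩
    y ^ suc n + x ^ suc n ∎
    where
    t = binomialTerm x y (suc n)

    multiple≈0 : ∀ {m} z → suc n ∣ m → m ·× z ≈ 0#
    multiple≈0 {m} z (divides q m≡qp) = begin
      m ·× z                    ≈⟨ ×-congˡ m≡qp ⟩
      (q ℕ.* suc n) ·× z        ≈⟨ ×-assocˡ z q (suc n) ⟨
      q ·× (suc n ·× z)         ≈⟨ ×-congʳ q (×-congʳ (suc n) (*-identityˡ z)) ⟨
      q ·× (suc n ·× (1# * z))  ≈⟨ ×-congʳ q (×-assoc-* (suc n) 1# z) ⟨
      q ·× ((suc n ·× 1#) * z)  ≈⟨ ×-congʳ q (trans (*-congʳ p≈0) (zeroˡ z)) ⟩
      q ·× 0#                   ≈⟨ ×-ε +-monoid q ⟩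
      0#                        ∎

    middle : ∀ i → t (suc (inject₁ i)) ≈ 0#
    middle i = multiple≈0 _ (prime∣C p-prime (≡.subst (_< n) (≡.sym (toℕ-inject₁ i)) (toℕ<n i)))

    final : t (suc (fromℕ n)) ≈ x ^ suc n
    final rewrite toℕ-fromℕ n | nCn≡1 (suc n) | ℕₚ.n∸n≡0 n = trans (×-homo-1 _) (*-identityʳ _)

-- Heyting fields as classical fields

module _ (em : ∀ {a} → ExcludedMiddle a) {c ℓ₁ ℓ₂} (F : HeytingField c ℓ₁ ℓ₂) where
  open HeytingField F

  -- If 1 = 0, every element is invertible, also a difference of equal elements, against
  -- irreflexivity of apartness.
  nontrivial : ¬ 1# ≈ 0#
  nontrivial 1≈0 = #-irrefl {0#} refl (invertible⇒# (1# , everything≈1 , everything≈1))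
    where
    everything≈1 : ∀ {x} → x ≈ 1#
    everything≈1 {x} = trans (trans (sym (*-identityʳ x)) (trans (*-congˡ 1≈0) (zeroʳ x))) (sym 1≈0)

  invertible : ∀ {x} → ¬ x ≈ 0# → ∃[ x′ ] x * x′ ≈ 1#
  invertible {x} x≉0 with em {P = x # 0#}
  ... | no ¬x#0 = ⊥-elim (x≉0 (proj₁ (tight x 0#) ¬x#0))
  ... | yes x#0 = let x′ , _ , e = #⇒invertible x#0 in
    x′ , trans (*-congʳ (trans (sym (+-identityʳ x)) (+-congˡ (trans (sym (-‿inverseʳ 0#)) (+-identityˡ _))))) e

  fieldRing-isField : IsField (fieldRing F)
  fieldRing-isField = record { 1≉0 = nontrivial ; inverse = invertible }

cofactor≡1 : ∀ {p q m} .{{_ : ℕ.NonZero p}} → p ≡ q ℕ.* m → p ∣ q → m ≡ 1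
cofactor≡1 {p} {q} {m} p≡qm (divides r q≡rp) = ℕₚ.m*n≡1⇒n≡1 r m (ℕₚ.*-cancelʳ-≡ (r ℕ.* m) 1 p (begin
  r ℕ.* m ℕ.* p     ≡⟨ ℕₚ.*-assoc r m p ⟩
  r ℕ.* (m ℕ.* p)   ≡⟨ ≡.cong (r ℕ.*_) (ℕₚ.*-comm m p) ⟩
  r ℕ.* (p ℕ.* m)   ≡⟨ ℕₚ.*-assoc r p m ⟨
  r ℕ.* p ℕ.* m     ≡⟨ ≡.cong (ℕ._* m) q≡rp ⟨
  q ℕ.* m           ≡⟨ p≡qm ⟨
  p                 ≡⟨ ℕₚ.*-identityˡ p ⟨
  1 ℕ.* p           ∎))
  where open ≡.≡-Reasoning

prime∤⇒coprime : ∀ {p n} → Prime p → ¬ p ∣ n → Coprime p n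
prime∤⇒coprime p-prime p∤n (d∣p , d∣n) with prime⇒irreducible p-prime d∣p
... | inj₁ d≡1    = d≡1
... | inj₂ ≡.refl = ⊥-elim (p∤n d∣n)

-- Absolutely co-Galois extensions

module CoGalois (em : ∀ {a} → ExcludedMiddle a)
  {k ℓk k′ l ℓl l′} (KF : HeytingField k ℓk k′) (LF : HeytingField l ℓl l′)
  (φ : RingHomomorphism (CommutativeRing.rawRing (fieldRing KF)) (CommutativeRing.rawRing (fieldRing LF)))
  where

  module FE = FieldExtension KF LF φ
  module K = CommutativeRing (fieldRing KF)
  module φ = RingHomomorphism φ
  module T = AbelianGroup FE.T
  module Lˣ = AbelianGroup FE.Lˣ
  open CommutativeRing (fieldRing LF) hiding (zero)
  open IsField (fieldRing-isField em LF)
  open FieldTheory em (fieldRing LF) (fieldRing-isField em LF) k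
  module IsFieldK = IsField (fieldRing-isField em KF)
  module FK = FieldTheory em (fieldRing KF) (fieldRing-isField em KF) k
  open SemiringSolver commutativeSemiring using (solve; _:+_; _:*_; _:=_; con)
  module Kₘ = SemiringMult K.semiring
  open CrossedGroupAlgebra (fieldRing KF) FE.T FE.Kˣ→T
    using (FormalSum; _∼_; ∼-refl; ∼-sym; ∼-trans; ++-cong; ++-comm; ⊗-cong; ⊗-+; ⊗-0; balanced)
  open SetoidReasoning setoid

  φ-≉0 : ∀ {a} → ¬ a K.≈ K.0# → ¬ φ.⟦ a ⟧ ≈ 0#
  φ-≉0 {a} a≉0 = let a′ , aa′≈1 = IsFieldK.inverse a≉0 in
    *-≉0⁻ˡ (≈1⇒≉0 (trans (sym (φ.*-homo a a′)) (trans (φ.⟦⟧-cong aa′≈1) φ.1#-homo)))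

  φ≈0 : ∀ {a} → φ.⟦ a ⟧ ≈ 0# → a K.≈ K.0#
  φ≈0 φa≈0 = FK.stable (λ a≉0 → φ-≉0 a≉0 φa≈0)

  -- The image of `K` in `L`; `Lift` only adjusts the universe level.
  base : Subfield
  base = record
    { In   = λ x → Lift (l ⊔ ℓl ⊔ k) (∃[ a ] φ.⟦ a ⟧ ≈ x)
    ; ∈-resp = λ x≈y (lift (a , e)) → lift (a , trans e x≈y)
    ; 1∈   = lift (K.1# , φ.1#-homo)
    ; +∈   = λ (lift (a , e)) (lift (b , f)) → lift (a K.+ b , trans (φ.+-homo a b) (+-cong e f))
    ; *∈   = λ (lift (a , e)) (lift (b , f)) → lift (a K.* b , trans (φ.*-homo a b) (*-cong e f))
    ; -∈   = λ (lift (a , e)) → lift (K.- a , trans (φ.-‿homo a) (-‿cong e))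
    ; inv∈ = λ {x} {y} xy≈1 (lift (a , e)) →
        let x≉0 = *-≉0⁻ˡ (≈1⇒≉0 xy≈1)
            a′ , aa′≈1 = IsFieldK.inverse {a} (λ a≈0 → x≉0 (trans (sym e) (trans (φ.⟦⟧-cong a≈0) φ.0#-homo)))
        in lift (a′ , *-cancelˡ x≉0 (begin
          x * φ.⟦ a′ ⟧           ≈⟨ *-congʳ e ⟨
          φ.⟦ a ⟧ * φ.⟦ a′ ⟧     ≈⟨ φ.*-homo a a′ ⟨
          φ.⟦ a K.* a′ ⟧         ≈⟨ trans (φ.⟦⟧-cong aa′≈1) φ.1#-homo ⟩
          1#                     ≈⟨ xy≈1 ⟨
          x * y                  ∎))
    }

  open Subfield base using (In; ∈-resp; 1∈; +∈; *∈; -∈; div∈; ^∈)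

  toUnit : ∀ {x} → ¬ x ≈ 0# → Lˣ.Carrier
  toUnit {x} x≉0 = let x′ , xx′≈1 = inverse x≉0 in x , x′ , trans (*-comm x′ x) xx′≈1 , xx′≈1

  unit≉0 : (x : Lˣ.Carrier) → ¬ proj₁ x ≈ 0#
  unit≉0 (x , x′ , _ , xx′≈1) = *-≉0⁻ˡ (≈1⇒≉0 xx′≈1)

  InKˣ⇒In : ∀ {x} → FE.InKˣ x → In (proj₁ x)
  InKˣ⇒In ((a , _) , e) = lift (a , e)

  In⇒InKˣ : ∀ {x} → In (proj₁ x) → FE.InKˣ x
  In⇒InKˣ {x} (lift (a , e)) =
    let a′ , aa′≈1 = IsFieldK.inverse {a} (λ a≈0 → unit≉0 x (trans (sym e) (trans (φ.⟦⟧-cong a≈0) φ.0#-homo)))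
    in (a , a′ , K.trans (K.*-comm a′ a) aa′≈1 , aa′≈1) , e

  power≡^ : ∀ x n → proj₁ (power FE.Lˣ x n) ≡ proj₁ x ^ n
  power≡^ x zero    = ≡.refl
  power≡^ x (suc n) = ≡.cong (proj₁ x *_) (power≡^ x n)

  quotient-power≡^ : ∀ x n → proj₁ (power FE.Lˣ/Kˣ x n) ≡ proj₁ x ^ n
  quotient-power≡^ x zero    = ≡.refl
  quotient-power≡^ x (suc n) = ≡.cong (proj₁ x *_) (quotient-power≡^ x n)

  torsion-power≡^ : ∀ t n → proj₁ (proj₁ (power FE.T t n)) ≡ proj₁ (proj₁ t) ^ n
  torsion-power≡^ t zero    = ≡.refl
  torsion-power≡^ t (suc n) = ≡.cong (proj₁ (proj₁ t) *_) (torsion-power≡^ t n)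

  open ClassSum base

  ⌜_⌝ : T.Carrier → Carrier
  ⌜ t ⌝ = proj₁ (proj₁ t)

  T⇒Torsion : ∀ t → Torsion ⌜ t ⌝
  T⇒Torsion (x , suc n , _ , h) = unit≉0 x , n , ≡.subst In (power≡^ x (suc n)) (InKˣ⇒In {power FE.Lˣ x (suc n)} h)

  torsion : ∀ {x} → Torsion x → T.Carrier
  torsion {x} (x≉0 , n , h) = toUnit x≉0 , suc n , ℕ.s≤s ℕ.z≤n ,
    In⇒InKˣ {power FE.Lˣ (toUnit x≉0) (suc n)} (≡.subst In (≡.sym (power≡^ (toUnit x≉0) (suc n))) h)

  term : K.Carrier × T.Carrier → Carrier × Carrier
  term (a , v) = φ.⟦ a ⟧ , ⌜ v ⌝

  canonical-total : ∀ z → FE.K⟨T⟩→L z ≡ total (map term z)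
  canonical-total []      = ≡.refl
  canonical-total (t ∷ z) = ≡.cong (_ +_) (canonical-total z)

  formal-classSum : Carrier → FormalSum → Carrier
  formal-classSum g z = classSum g (map term z)

  ~-respˡ : ∀ {h h′ g} → h ≈ h′ → h ~ g → h′ ~ g
  ~-respˡ h≈h′ (m , m∈ , e) = m , m∈ , trans (sym h≈h′) e

  ~-scale : ∀ {m h g} → In m → h ~ g → (m * h) ~ g
  ~-scale {m} m∈ (n , n∈ , e) = m * n , *∈ m∈ n∈ , trans (*-congˡ e) (sym (*-assoc m n _))

  ~-trans : ∀ {h g f} → h ~ g → g ~ f → h ~ f
  ~-trans (m , m∈ , e) g~f = ~-respˡ (sym e) (~-scale m∈ g~f)

  ~-sym : ∀ {h g} → ¬ h ≈ 0# → h ~ g → g ~ h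
  ~-sym {h} {g} h≉0 (m , m∈ , h≈mg) =
    let m′ , mm′≈1 = inverse (*-≉0⁻ˡ (h≉0 ∘ trans h≈mg)) in
    m′ , Subfield.inv∈ base mm′≈1 m∈ , sym (begin
      m′ * h         ≈⟨ *-congˡ h≈mg ⟩
      m′ * (m * g)   ≈⟨ solve 3 (λ m′ m g → m′ :* (m :* g) := m :* m′ :* g) refl m′ m g ⟩
      m * m′ * g     ≈⟨ trans (*-congʳ mm′≈1) (*-identityˡ g) ⟩
      g              ∎)

  select-cong : ∀ {a b} {P : Set a} {Q : Set b} (P? : Dec P) (Q? : Dec Q) {x y} →
                (P → Q) → (Q → P) → x ≈ y → select P? x ≈ select Q? y
  select-cong (yes p) Q? P⇒Q Q⇒P x≈y = trans x≈y (sym (select-yes Q? (P⇒Q p)))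
  select-cong (no ¬p) Q? P⇒Q Q⇒P x≈y = sym (select-no Q? (¬p ∘ Q⇒P))

  select-+ : ∀ {a} {P : Set a} (P? : Dec P) {x y} → select P? (x + y) ≈ select P? x + select P? y
  select-+ (yes _) = refl
  select-+ (no  _) = sym (+-identityˡ 0#)

  select-0 : ∀ {a} {P : Set a} (P? : Dec P) {x} → x ≈ 0# → select P? x ≈ 0#
  select-0 (yes _) x≈0 = x≈0
  select-0 (no  _) x≈0 = refl

  classSum-++ : ∀ g x y → formal-classSum g (x ++ y) ≈ formal-classSum g x + formal-classSum g y
  classSum-++ g []      y = sym (+-identityˡ _)
  classSum-++ g (t ∷ x) y = trans (+-congˡ (classSum-++ g x y)) (sym (+-assoc _ _ _))

  -- The class sums are the images in L of the components in ⊕ K x_d, obtained without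
  -- representatives. For `balanced`, the elements v and c v lie in the same class.
  classSum-∼ : ∀ g {x y} → x ∼ y → formal-classSum g x ≈ formal-classSum g y
  classSum-∼ g ∼-refl        = refl
  classSum-∼ g (∼-sym e)     = sym (classSum-∼ g e)
  classSum-∼ g (∼-trans e f) = trans (classSum-∼ g e) (classSum-∼ g f)
  classSum-∼ g (++-cong {x} {x′} {y} {y′} e f) =
    trans (classSum-++ g x y) (trans (+-cong (classSum-∼ g e) (classSum-∼ g f)) (sym (classSum-++ g x′ y′)))
  classSum-∼ g (++-comm x y) = trans (classSum-++ g x y) (trans (+-comm _ _) (sym (classSum-++ g y x)))
  classSum-∼ g (⊗-cong {v = v} {w = w} a≈b v≈w) = +-congʳ (select-cong em em
    (~-respˡ v≈w) (~-respˡ (sym v≈w)) (*-cong (φ.⟦⟧-cong a≈b) v≈w))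
  classSum-∼ g (⊗-+ a b v) = trans (+-congʳ (trans (select-cong em em id id
    (trans (*-congʳ (φ.+-homo a b)) (distribʳ _ _ _))) (select-+ em))) (+-assoc _ _ _)
  classSum-∼ g (⊗-0 v) = trans (+-identityʳ _) (select-0 em (trans (*-congʳ φ.0#-homo) (zeroˡ _)))
  classSum-∼ g (balanced a (c , c′ , c′c , cc′) v) = +-congʳ (select-cong em em
    (~-scale (lift (c , refl)))
    (λ h → ~-respˡ (begin
      φ.⟦ c′ ⟧ * (φ.⟦ c ⟧ * ⌜ v ⌝)   ≈⟨ *-assoc _ _ _ ⟨
      φ.⟦ c′ ⟧ * φ.⟦ c ⟧ * ⌜ v ⌝     ≈⟨ *-congʳ (φ.*-homo c′ c) ⟨
      φ.⟦ c′ K.* c ⟧ * ⌜ v ⌝         ≈⟨ *-congʳ (trans (φ.⟦⟧-cong c′c) φ.1#-homo) ⟩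
      1# * ⌜ v ⌝                     ≈⟨ *-identityˡ _ ⟩
      ⌜ v ⌝                          ∎) (~-scale (lift (c′ , refl)) h))
    (trans (*-congʳ (φ.*-homo a c)) (*-assoc _ _ _)))

  classSum-none : ∀ {g ts} → All (λ (_ , h) → ¬ h ~ g) ts → classSum g ts ≈ 0#
  classSum-none []                            = refl
  classSum-none {ts = _ ∷ ts} (h≁g ∷ ts≁g) = trans (classSum-no {ts = ts} h≁g) (classSum-none ts≁g)

  open IsAlgebraHomomorphism FE.K⟨T⟩→L-isAlgebraHomomorphism using (isRingHomomorphism)
  module canonical = IsRingHomomorphism isRingHomomorphism

  -- From the isomorphism to the conditions

  module _ (coGalois : FE.AbsolutelyCoGalois) where
    open IsAlgebraIsomorphism coGalois using (isRingIsomorphism)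
    open IsRingIsomorphism isRingIsomorphism using (injective; surjective)

    relation⇒classSum≈0 : ∀ z → FE.K⟨T⟩→L z ≈ 0# → ∀ g → formal-classSum g z ≈ 0#
    relation⇒classSum≈0 z z≈0 g = classSum-∼ g (injective {z} {[]} z≈0)

    private
      1~1 : 1# ~ 1#
      1~1 = 1# , 1∈ , sym (*-identityˡ 1#)

      ~1⇒In : ∀ {x} → x ~ 1# → In x
      ~1⇒In (m , m∈ , e) = ∈-resp (sym (trans e (*-identityʳ m))) m∈

    -- Otherwise 1, x and 1 + x lie in distinct classes modulo Kˣ.
    successor∈ : ∀ {x} → Torsion x → Torsion (1# + x) → In x
    successor∈ {x} x∈T 1+x∈T = stable λ x∉ → 1≉0 (begin
        1#                    ≈⟨ trans (*-congʳ φ.1#-homo) (*-identityˡ 1#) ⟨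
        φ.⟦ K.1# ⟧ * 1#       ≈⟨ +-identityʳ _ ⟨
        φ.⟦ K.1# ⟧ * 1# + 0#  ≈⟨ +-congˡ (classSum-none ((x∉ ∘ ~1⇒In) ∷ (x∉ ∘ 1+x∈⇒x∈ ∘ ~1⇒In) ∷ [])) ⟨
        φ.⟦ K.1# ⟧ * 1# + classSum 1# (map term (summands x∈T 1+x∈T)) ≈⟨ classSum-yes {ts = map term (summands x∈T 1+x∈T)} 1~1 ⟨
        formal-classSum 1# z  ≈⟨ relation⇒classSum≈0 z z≈0 1# ⟩
        0#                    ∎)
      where
      summands : Torsion x → Torsion (1# + x) → FormalSum
      summands x∈T 1+x∈T = (K.1# , torsion x∈T) ∷ (K.- K.1# , torsion 1+x∈T) ∷ []

      z : FormalSum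
      z = (K.1# , T.ε) ∷ summands x∈T 1+x∈T

      z≈0 : FE.K⟨T⟩→L z ≈ 0#
      z≈0 = begin
        φ.⟦ K.1# ⟧ * 1# + (φ.⟦ K.1# ⟧ * x + (φ.⟦ K.- K.1# ⟧ * (1# + x) + 0#))
          ≈⟨ +-cong (*-congʳ φ.1#-homo) (+-cong (*-congʳ φ.1#-homo) (+-congʳ (*-congʳ (trans (φ.-‿homo K.1#) (-‿cong φ.1#-homo))))) ⟩
        1# * 1# + (1# * x + ((- 1#) * (1# + x) + 0#))
          ≈⟨ solve 3 (λ o x e → o :* o :+ (o :* x :+ (e :* (con 1 :+ x) :+ con 0)) := o :* (o :+ x) :+ e :* (con 1 :+ x)) refl 1# x (- 1#) ⟩
        1# * (1# + x) + (- 1#) * (1# + x)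
          ≈⟨ distribʳ (1# + x) 1# (- 1#) ⟨
        (1# + - 1#) * (1# + x)
          ≈⟨ trans (*-congʳ (-‿inverseʳ 1#)) (zeroˡ _) ⟩
        0# ∎

      1+x∈⇒x∈ : In (1# + x) → In x
      1+x∈⇒x∈ h = ∈-resp (trans (sym (+-assoc _ _ _)) (trans (+-congʳ (-‿inverseˡ 1#)) (+-identityˡ x))) (+∈ (-∈ 1∈) h)

    root-of-unity∈ : ∀ {p w} → Prime p → w ^ p ≈ 1# → ¬ w ≈ 1# → In w
    root-of-unity∈ {zero}  (Primality.prime {{()}} _)
    root-of-unity∈ {p@(suc n)} {w} p-prime wᵖ≈1 w≉1 = stable λ w∉ → 1≉0 (begin
        1#                           ≈⟨ classSum-geometric w∉ n ℕₚ.≤-refl ⟨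
        formal-classSum 1# (geometric p) ≈⟨ relation⇒classSum≈0 (geometric p) (canonical-geometric wᵖ≈1) 1# ⟩
        0#                           ∎)
      where
      w≉0 : ¬ w ≈ 0#
      w≉0 = *-≉0⁻ˡ (≈1⇒≉0 wᵖ≈1)

      w^∈T : ∀ i → Torsion (w ^ i)
      w^∈T i = ^-≉0 i w≉0 , n , ∈-resp (sym (trans (^-assocʳ w i p) (trans (^-congʳ w (ℕₚ.*-comm i p))
        (trans (sym (^-assocʳ w p i)) (trans (^-congˡ i wᵖ≈1) (^-zeroˡ i)))))) 1∈

      geometric : ℕ → FormalSum
      geometric zero    = []
      geometric (suc i) = (K.1# , torsion (w^∈T i)) ∷ geometric i

      -- The telescoping identity for geometric sums without subtraction. For w ^ p = 1 it gives w S
      -- = S, hence S = 0 as w ≠ 1.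
      recurrence : ∀ i → 1# + w * FE.K⟨T⟩→L (geometric i) ≈ FE.K⟨T⟩→L (geometric i) + w ^ i
      recurrence zero    = trans (+-congˡ (zeroʳ w)) (+-comm _ _)
      recurrence (suc i) = begin
        1# + w * (φ.⟦ K.1# ⟧ * w ^ i + S)   ≈⟨ +-congˡ (*-congˡ (+-congʳ (trans (*-congʳ φ.1#-homo) (*-identityˡ _)))) ⟩
        1# + w * (w ^ i + S)                ≈⟨ solve 4 (λ o w x s → o :+ w :* (x :+ s) := (o :+ w :* s) :+ w :* x) refl 1# w (w ^ i) S ⟩
        1# + w * S + w * w ^ i              ≈⟨ +-congʳ (trans (recurrence i) (+-comm _ _)) ⟩
        w ^ i + S + w * w ^ i               ≈⟨ +-congʳ (+-congʳ (trans (*-congʳ φ.1#-homo) (*-identityˡ _))) ⟨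
        φ.⟦ K.1# ⟧ * w ^ i + S + w * w ^ i  ∎
        where S = FE.K⟨T⟩→L (geometric i)

      canonical-geometric : w ^ p ≈ 1# → FE.K⟨T⟩→L (geometric p) ≈ 0#
      canonical-geometric wᵖ≈1 = stable λ S≉0 → w≉1 (*-cancelˡ S≉0 (begin
          S * w                 ≈⟨ +-identityˡ _ ⟨
          0# + S * w            ≈⟨ +-cong (sym (-‿inverseˡ 1#)) (*-comm S w) ⟩
          (- 1# + 1#) + w * S   ≈⟨ +-assoc _ _ _ ⟩
          - 1# + (1# + w * S)   ≈⟨ +-congˡ (trans (recurrence p) (trans (+-congˡ wᵖ≈1) (+-comm _ _))) ⟩
          - 1# + (1# + S)       ≈⟨ +-assoc _ _ _ ⟨
          (- 1# + 1#) + S       ≈⟨ trans (+-congʳ (-‿inverseˡ 1#)) (+-identityˡ S) ⟩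
          S                     ≈⟨ *-identityʳ S ⟨
          S * 1#                ∎))
        where S = FE.K⟨T⟩→L (geometric p)

      -- Only w ^ 0 is in the class of 1: w ^ i ∈ K with 0 < i < p would, with w ^ p = 1, give w ∈
      -- K.
      classSum-geometric : ¬ In w → ∀ i → i ≤ n → formal-classSum 1# (geometric (suc i)) ≈ 1#
      classSum-geometric w∉ zero    i≤n = trans (classSum-yes {ts = []} 1~1) (trans (+-identityʳ _) (trans (*-identityʳ _) φ.1#-homo))
      classSum-geometric w∉ (suc i) i<n = trans (classSum-no {ts = map term (geometric (suc i))} λ wⁱ~1 →
          w∉ (Subfield.coprime-powers base w≉0 (prime⇒coprime p-prime (ℕ.s≤s i<n))
            (∈-resp (sym wᵖ≈1) 1∈) (~1⇒In wⁱ~1)))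
        (classSum-geometric w∉ i (ℕₚ.<⇒≤ i<n))

    generates : Generates FE.algebra FE.TinL
    generates x = let z , e = surjective x in resp (e ∼-refl) (span z)
      where
      span : ∀ z → Adjoin FE.algebra FE.TinL (FE.K⟨T⟩→L z)
      span []            = resp φ.0#-homo (scalar K.0#)
      span ((a , v) ∷ z) = add (multiply (scalar a) (generator (v , refl))) (span z)

    -- Some power of t lies in both F and K and is therefore 1. The prime factors of its exponent
    -- are then removed one by one: an element of F of prime order is in K by `root-of-unity∈`,
    -- hence trivial.
    essential : Essential FE.T FE.KˣinT
    essential F F-subgroup F∩K-trivial {t} t∈F =
      let n , tⁿ∈K = proj₂ (T⇒Torsion t)
          open PrimeFactorisation (factorise (suc n))
          tⁿ≈1 = F∩K-trivial (power∈F (suc n) t∈F , In⇒InKˣ {proj₁ (power FE.T t (suc n))} (≡.subst In (≡.sym (torsion-power≡^ t (suc n))) tⁿ∈K))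
      in no-torsion factorsPrime t∈F (trans (^-congʳ ⌜ t ⌝ (≡.sym isFactorisation))
           (trans (reflexive (≡.sym (torsion-power≡^ t (suc n)))) tⁿ≈1))
      where
      open IsSubgroup F-subgroup using (ε-closed; ∙-closed)

      power∈F : ∀ n {t} → F t → F (power FE.T t n)
      power∈F zero    t∈F = ε-closed
      power∈F (suc n) {t} t∈F = ∙-closed {t} {power FE.T t n} t∈F (power∈F n t∈F)

      no-torsion : ∀ {qs t} → All Prime qs → F t → ⌜ t ⌝ ^ product qs ≈ 1# → ⌜ t ⌝ ≈ 1#
      no-torsion [] t∈F e = trans (sym (*-identityʳ _)) e
      no-torsion {q ∷ qs} {t} (q-prime ∷ qs-prime) t∈F e = no-torsion qs-prime t∈F (stable λ w≉1 →
        w≉1 (trans (reflexive (≡.sym w≡)) (F∩K-trivial {w}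
          (power∈F (product qs) t∈F , In⇒InKˣ {proj₁ w} (≡.subst In (≡.sym w≡) (root-of-unity∈ q-prime wq≈1 w≉1))))))
        where
        w = power FE.T t (product qs)
        w≡ = torsion-power≡^ t (product qs)

        wq≈1 : (⌜ t ⌝ ^ product qs) ^ q ≈ 1#
        wq≈1 = trans (^-assocʳ ⌜ t ⌝ (product qs) q) (trans (^-congʳ ⌜ t ⌝ (ℕₚ.*-comm (product qs) q)) e)

    order-four : ∀ i → HasOrder FE.Lˣ i 4 → FE.InKˣ i
    order-four iˣ hasOrder = In⇒InKˣ {iˣ} (successor∈ i∈T 1+i∈T)
      where
      i = proj₁ iˣ
      i⁴≈1 : i ^ 4 ≈ 1#
      i⁴≈1 = Equivalence.from (hasOrder 4) ∣-refl

      i²≉1 : ¬ i * i ≈ 1#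
      i²≉1 e = case ∣⇒≤ (Equivalence.to (hasOrder 2) (trans (*-congˡ (*-identityʳ i)) e)) of λ { (ℕ.s≤s (ℕ.s≤s ())) }

      1+i²≈0 : 1# + i * i ≈ 0#
      1+i²≈0 = stable λ h → i²≉1 (*-cancelˡ h (begin
        (1# + i * i) * (i * i)          ≈⟨ solve 1 (λ i → (con 1 :+ i :* i) :* (i :* i) := i :* i :+ i :* (i :* (i :* (i :* con 1)))) refl i ⟩
        i * i + i ^ 4                   ≈⟨ +-congˡ i⁴≈1 ⟩
        i * i + 1#                      ≈⟨ +-comm _ _ ⟩
        1# + i * i                      ≈⟨ *-identityʳ _ ⟨
        (1# + i * i) * 1#               ∎))

      i∈T : Torsion i
      i∈T = unit≉0 iˣ , 3 , ∈-resp (sym i⁴≈1) 1∈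

      [1+i]² : (1# + i) * (1# + i) ≈ i + i
      [1+i]² = begin
        (1# + i) * (1# + i)          ≈⟨ solve 1 (λ i → (con 1 :+ i) :* (con 1 :+ i) := (con 1 :+ i :* i) :+ (i :+ i)) refl i ⟩
        (1# + i * i) + (i + i)       ≈⟨ trans (+-congʳ 1+i²≈0) (+-identityˡ _) ⟩
        i + i                        ∎

      1+i∈T : Torsion (1# + i)
      1+i∈T = (λ 1+i≈0 → i²≉1 (begin
          i * i                             ≈⟨ +-identityˡ _ ⟨
          0# + i * i                        ≈⟨ +-congʳ (trans (*-congʳ 1+i≈0) (zeroˡ _)) ⟨
          (1# + i) * 1# + i * i             ≈⟨ solve 1 (λ i → (con 1 :+ i) :* con 1 :+ i :* i := con 1 :+ i :* (con 1 :+ i)) refl i ⟩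
          1# + i * (1# + i)                 ≈⟨ +-congˡ (trans (*-congˡ 1+i≈0) (zeroʳ i)) ⟩
          1# + 0#                           ≈⟨ +-identityʳ 1# ⟩
          1#                                ∎))
        , 3 , ∈-resp (begin
          (1# + 1#) * (1# + 1#) * (i * i)           ≈⟨ solve 1 (λ i → (con 1 :+ con 1) :* (con 1 :+ con 1) :* (i :* i) := (i :+ i) :* (i :+ i)) refl i ⟩
          (i + i) * (i + i)                         ≈⟨ *-cong [1+i]² [1+i]² ⟨
          (1# + i) * (1# + i) * ((1# + i) * (1# + i)) ≈⟨ solve 1 (λ x → x :* x :* (x :* x) := x :* (x :* (x :* (x :* con 1)))) refl (1# + i) ⟩
          (1# + i) ^ 4                              ∎)
          (*∈ (*∈ (+∈ 1∈ 1∈) (+∈ 1∈ 1∈)) (∈-resp (sym (+≈0⇒≈- 1+i²≈0)) (-∈ 1∈)))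

  φ-multiple : ∀ n → φ.⟦ n Kₘ.× K.1# ⟧ ≈ n ·× 1#
  φ-multiple zero    = φ.0#-homo
  φ-multiple (suc n) = trans (φ.+-homo K.1# _) (+-cong φ.1#-homo (φ-multiple n))

  characteristic-prime : ∀ {p} → p > 0 → HasCharacteristic (fieldRing KF) p → Prime p
  characteristic-prime {1} _ hasChar = ⊥-elim (IsFieldK.1≉0 (K.trans (K.sym (K.+-identityʳ _)) (Equivalence.from (hasChar 1) ∣-refl)))
  characteristic-prime {p@(suc (suc _))} _ hasChar = irreducible⇒prime irreducible
    where
    irreducible : Primality.Irreducible p
    irreducible {m} m∣p@(divides q p≡qm) with em {P = q Kₘ.× K.1# K.≈ K.0#}
    ... | no q≉0 = inj₂ (∣-antisym m∣p (Equivalence.to (hasChar m) (FK.domain q≉0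
            (K.trans (K.sym (Kₘ.×1-homo-* q m)) (≡.subst (λ n → n Kₘ.× K.1# K.≈ K.0#) p≡qm (Equivalence.from (hasChar p) ∣-refl))))))
    ... | yes q≈0 = inj₁ (cofactor≡1 p≡qm (Equivalence.to (hasChar q) q≈0))

  coGalois⇒root∈ : FE.AbsolutelyCoGalois → ∀ {p} → p > 0 → HasCharacteristic (fieldRing KF) p →
                   ∀ {x} → ¬ x ≈ 0# → In (x ^ p) → In x
  coGalois⇒root∈ coGalois {p@(suc n)} p>0 hasChar {x} x≉0 xᵖ∈ = case em {P = 1# + x ≈ 0#} of λ where
      -- `successor∈` requires 1 + x to be a unit; the exception x = -1 lies in K.
      (yes 1+x≈0) → ∈-resp (sym (+≈0⇒≈- 1+x≈0)) (-∈ 1∈)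
      (no  1+x≉0) → successor∈ coGalois (x≉0 , n , xᵖ∈) (1+x≉0 , n , ∈-resp
          (sym (trans (frobenius commutativeSemiring (characteristic-prime p>0 hasChar) p≈0 1# x) (+-congˡ (^-zeroˡ p))))
          (+∈ xᵖ∈ 1∈))
    where
    p≈0 : p ·× 1# ≈ 0#
    p≈0 = trans (sym (φ-multiple p)) (trans (φ.⟦⟧-cong (Equivalence.from (hasChar p) ∣-refl)) φ.0#-homo)

  coGalois⇒primary-trivial : FE.AbsolutelyCoGalois → ∀ p → p > 0 → HasCharacteristic (fieldRing KF) p →
                             Trivial FE.Lˣ/Kˣ (Primary FE.Lˣ/Kˣ p)
  coGalois⇒primary-trivial coGalois p p>0 hasChar {x} (n , h) =
    In⇒InKˣ {x Lˣ.∙ Lˣ.ε Lˣ.⁻¹} (∈-resp (sym (*-identityʳ _)) (iterate n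
      (≡.subst In (quotient-power≡^ x (p ℕ.^ n)) (∈-resp (*-identityʳ _) (InKˣ⇒In {power FE.Lˣ/Kˣ x (p ℕ.^ n) Lˣ.∙ Lˣ.ε Lˣ.⁻¹} h)))))
    where
    iterate : ∀ n → In (proj₁ x ^ (p ℕ.^ n)) → In (proj₁ x)
    iterate zero    h = ∈-resp (*-identityʳ _) h
    iterate (suc n) h = iterate n (coGalois⇒root∈ coGalois p>0 hasChar (^-≉0 (p ℕ.^ n) (unit≉0 x))
      (∈-resp (trans (^-congʳ (proj₁ x) (ℕₚ.*-comm p (p ℕ.^ n))) (sym (^-assocʳ (proj₁ x) (p ℕ.^ n) p))) h))

  -- From the conditions to the isomorphism

  module _ (essential : Essential FE.T FE.KˣinT) where

    -- If x ∉ K, the group of powers of x meets K trivially, because x ^ n ∈ K with n prime to p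
    -- would give x ∈ K. Essentiality then forces x = 1.
    essential⇒μ∈ : ∀ {p x} → Prime p → x ^ p ≈ 1# → In x
    essential⇒μ∈ {zero}  (Primality.prime {{()}} _)
    essential⇒μ∈ {p@(suc m)} {x} p-prime xᵖ≈1 = stable λ x∉ →
      x∉ (∈-resp (sym (essential F F-isSubgroup (λ {t} → F∩K-trivial x∉ {t}) {torsion x∈T} (lift (1 , sym (*-identityʳ x))))) 1∈)
      where
      x≉0 : ¬ x ≈ 0#
      x≉0 = *-≉0⁻ˡ (≈1⇒≉0 xᵖ≈1)

      x∈T : Torsion x
      x∈T = x≉0 , m , ∈-resp (sym xᵖ≈1) 1∈

      F : Pred T.Carrier (k ⊔ ℓk ⊔ l ⊔ ℓl)
      F t = Lift (k ⊔ ℓk ⊔ l ⊔ ℓl) (∃[ n ] ⌜ t ⌝ ≈ x ^ n)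

      F-isSubgroup : IsSubgroup FE.T F
      F-isSubgroup = record
        { resp      = λ s≈t (lift (n , e)) → lift (n , trans (sym s≈t) e)
        ; ε-closed  = lift (0 , refl)
        ; ∙-closed  = λ (lift (n , e)) (lift (j , f)) → lift (n ℕ.+ j , trans (*-cong e f) (sym (^-homo-* x n j)))
        -- As x ^ p = 1 with p = m + 1, the inverse of x ^ n is x ^ (n m), so exponents in ℕ
        -- suffice.
        ; ⁻¹-closed = λ {t} (lift (n , e)) → lift (n ℕ.* m , *-cancelˡ (unit≉0 (proj₁ t)) (begin
            ⌜ t ⌝ * ⌜ t T.⁻¹ ⌝              ≈⟨ proj₂ (proj₂ (proj₂ (proj₁ t))) ⟩
            1#                              ≈⟨ trans (sym (^-zeroˡ n)) (^-congˡ n (sym xᵖ≈1)) ⟩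
            (x ^ p) ^ n                     ≈⟨ ^-assocʳ x p n ⟩
            x ^ (p ℕ.* n)                   ≈⟨ ^-congʳ x (≡.cong (n ℕ.+_) (ℕₚ.*-comm m n)) ⟩
            x ^ (n ℕ.+ n ℕ.* m)             ≈⟨ ^-homo-* x n (n ℕ.* m) ⟩
            x ^ n * x ^ (n ℕ.* m)           ≈⟨ *-congʳ e ⟨
            ⌜ t ⌝ * x ^ (n ℕ.* m)           ∎))
        }

      F∩K-trivial : ¬ In x → Trivial FE.T (F ∩ FE.KˣinT)
      F∩K-trivial x∉ {t} (lift (n , e) , t∈K) = case p ∣? n of λ where
        (yes (divides q n≡qp)) → trans e (trans (^-congʳ x (≡.trans n≡qp (ℕₚ.*-comm q p)))
          (trans (sym (^-assocʳ x p q)) (trans (^-congˡ q xᵖ≈1) (^-zeroˡ q))))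
        (no p∤n) → ⊥-elim (x∉ (Subfield.coprime-powers base x≉0 (prime∤⇒coprime p-prime p∤n)
          (∈-resp (sym xᵖ≈1) 1∈) (∈-resp e (InKˣ⇒In {proj₁ t} t∈K))))

    -- If x ∉ K, then x² ≠ 1, as square roots of 1 lie in K; so x has order exactly 4 and
    -- `order-four` applies.
    order-four⇒μ₄∈ : (∀ i → HasOrder FE.Lˣ i 4 → FE.InKˣ i) → ∀ {x} → x ^ 4 ≈ 1# → In x
    order-four⇒μ₄∈ order-four {x} x⁴≈1 = stable λ x∉ → let x²≉1 = x∉ ∘ essential⇒μ∈ prime[2] in
      x∉ (InKˣ⇒In {i} (order-four i λ m → mk⇔ (to x²≉1 m) (from m)))
      where
      i : Lˣ.Carrier
      i = toUnit (*-≉0⁻ˡ (≈1⇒≉0 x⁴≈1))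

      remainder : ¬ x ^ 2 ≈ 1# → ∀ r → r < 4 → x ^ r ≈ 1# → r ≡ 0
      remainder x²≉1 0 _ _ = ≡.refl
      remainder x²≉1 1 _ e = ⊥-elim (x²≉1 (trans (^-congˡ 2 (trans (sym (*-identityʳ x)) e)) (^-zeroˡ 2)))
      remainder x²≉1 2 _ e = ⊥-elim (x²≉1 e)
      remainder x²≉1 3 _ e = ⊥-elim (x²≉1 (trans (^-congˡ 2 (trans (trans (sym (*-identityʳ x)) (*-congˡ (sym e))) x⁴≈1)) (^-zeroˡ 2)))
      remainder x²≉1 (suc (suc (suc (suc r)))) (s≤s (s≤s (s≤s (s≤s ())))) e

      multiple-of-4 : ∀ q → x ^ (q ℕ.* 4) ≈ 1#
      multiple-of-4 q = trans (^-congʳ x (ℕₚ.*-comm q 4)) (trans (sym (^-assocʳ x 4 q)) (trans (^-congˡ q x⁴≈1) (^-zeroˡ q)))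

      to : ¬ x ^ 2 ≈ 1# → ∀ m → proj₁ (power FE.Lˣ i m) ≈ 1# → 4 ∣ m
      to x²≉1 m e = divides (m / 4) (≡.trans (m≡m%n+[m/n]*n m 4) (≡.cong (ℕ._+ m / 4 ℕ.* 4)
        (remainder x²≉1 (m % 4) (m%n<n m 4) (begin
          x ^ (m % 4)                           ≈⟨ *-identityʳ _ ⟨
          x ^ (m % 4) * 1#                      ≈⟨ *-congˡ (multiple-of-4 (m / 4)) ⟨
          x ^ (m % 4) * x ^ (m / 4 ℕ.* 4)       ≈⟨ ^-homo-* x (m % 4) (m / 4 ℕ.* 4) ⟨
          x ^ (m % 4 ℕ.+ m / 4 ℕ.* 4)           ≈⟨ ^-congʳ x (m≡m%n+[m/n]*n m 4) ⟨
          x ^ m                                 ≡⟨ power≡^ i m ⟨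
          proj₁ (power FE.Lˣ i m)               ≈⟨ e ⟩
          1#                                    ∎))))

      from : ∀ m → 4 ∣ m → proj₁ (power FE.Lˣ i m) ≈ 1#
      from m (divides q m≡q4) = trans (reflexive (power≡^ i m)) (trans (^-congʳ x m≡q4) (multiple-of-4 q))

  -- A prime that is zero in L is the characteristic of K, and x then represents a p-primary class,
  -- with exponent p ^ 1.
  separable : (∀ p → p > 0 → HasCharacteristic (fieldRing KF) p → Trivial FE.Lˣ/Kˣ (Primary FE.Lˣ/Kˣ p)) →
              ∀ {p x} → Prime p → p ·× 1# ≈ 0# → ¬ x ≈ 0# → In (x ^ p) → In x
  separable trivial {zero}  (Primality.prime {{()}} _)
  separable trivial {p@(suc _)} {x} p-prime p≈0 x≉0 xᵖ∈ = ∈-resp (*-identityʳ x)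
    (InKˣ⇒In {y Lˣ.∙ Lˣ.ε Lˣ.⁻¹} (trivial p z<s hasChar {y} (1 , In⇒InKˣ {power FE.Lˣ/Kˣ y (p ℕ.^ 1) Lˣ.∙ Lˣ.ε Lˣ.⁻¹}
      (∈-resp (sym (*-identityʳ _)) (≡.subst In (≡.sym (quotient-power≡^ y (p ℕ.^ 1)))
        (∈-resp (^-congʳ x (≡.sym (ℕₚ.*-identityʳ p))) xᵖ∈))))))
    where
    y = toUnit x≉0

    p≈0ᴷ : p Kₘ.× K.1# K.≈ K.0#
    p≈0ᴷ = φ≈0 (trans (φ-multiple p) p≈0)

    hasChar : HasCharacteristic (fieldRing KF) p
    hasChar n = mk⇔
      (λ n≈0 → case p ∣? n of λ where
        (yes p∣n) → p∣n
        (no  p∤n) → ⊥-elim (IsFieldK.1≉0 (coprime-orders K.+-monoid (prime∤⇒coprime p-prime p∤n) p≈0ᴷ n≈0)))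
      (λ { (divides q n≡qp) → K.trans (K.reflexive (≡.cong (Kₘ._× K.1#) n≡qp))
             (K.trans (Kₘ.×1-homo-* q p) (K.trans (K.*-congˡ p≈0ᴷ) (K.zeroʳ _))) })

  -- The terms of z in the class of v modulo Kˣ are collected into b ⊗ v.
  record Split (v : T.Carrier) (z : FormalSum) : Set (k ⊔ ℓk ⊔ l ⊔ ℓl) where
    field
      b       : K.Carrier
      rest    : FormalSum
      z∼      : z ∼ (b , v) ∷ rest
      shorter : length rest ≤ length z
      value   : φ.⟦ b ⟧ * ⌜ v ⌝ ≈ formal-classSum ⌜ v ⌝ z
      none    : All (λ (_ , h) → ¬ h ~ ⌜ v ⌝) (map term rest)
      others  : ∀ {g} → ¬ ⌜ v ⌝ ~ g → formal-classSum g rest ≈ formal-classSum g z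

  ~-refl : ∀ {g} → g ~ g
  ~-refl = 1# , 1∈ , sym (*-identityˡ _)

  skip : ∀ {v a w z} → ¬ ⌜ w ⌝ ~ ⌜ v ⌝ → Split v z → Split v ((a , w) ∷ z)
  skip {v} {a} {w} {z} w≁v S = record
    { z∼      = ∼-trans (++-cong {[ a , w ]} ∼-refl z∼) (++-cong (++-comm [ a , w ] [ b , v ]) (∼-refl {rest}))
    ; shorter = s≤s shorter
    ; value   = trans value (sym (classSum-no {ts = map term z} w≁v))
    ; none    = w≁v ∷ none
    ; others  = λ v≁g → +-congˡ (others v≁g)
    }
    where open Split S

  absorb : ∀ {v a w z} → ⌜ w ⌝ ~ ⌜ v ⌝ → Split v z → Split v ((a , w) ∷ z)
  absorb {v} {a} {w} {z} w~v@(m , lift (c , φc≈m) , w≈mv) S = record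
    { b       = a K.* c K.+ b
    ; z∼      = ∼-trans (++-cong {[ a , w ]} absorbed z∼) (++-cong (∼-sym (⊗-+ (a K.* c) b v)) (∼-refl {rest}))
    ; shorter = ℕₚ.m≤n⇒m≤1+n shorter
    ; value   = begin
      φ.⟦ a K.* c K.+ b ⟧ * ⌜ v ⌝                            ≈⟨ *-congʳ (trans (φ.+-homo _ b) (+-congʳ (φ.*-homo a c))) ⟩
      (φ.⟦ a ⟧ * φ.⟦ c ⟧ + φ.⟦ b ⟧) * ⌜ v ⌝                  ≈⟨ distribʳ _ _ _ ⟩
      φ.⟦ a ⟧ * φ.⟦ c ⟧ * ⌜ v ⌝ + φ.⟦ b ⟧ * ⌜ v ⌝            ≈⟨ +-cong (trans (*-assoc _ _ _) (*-congˡ (trans (*-congʳ φc≈m) (sym w≈mv)))) value ⟩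
      φ.⟦ a ⟧ * ⌜ w ⌝ + formal-classSum ⌜ v ⌝ z              ≈⟨ classSum-yes {ts = map term z} w~v ⟨
      formal-classSum ⌜ v ⌝ ((a , w) ∷ z)                    ∎
    ; none    = none
    ; others  = λ v≁g → trans (others v≁g) (sym (classSum-no {ts = map term z} λ w~g →
        v≁g (~-trans (~-sym (unit≉0 (proj₁ w)) w~v) w~g)))
    }
    where
    open Split S

    m≉0 : ¬ m ≈ 0#
    m≉0 = *-≉0⁻ˡ (unit≉0 (proj₁ w) ∘ trans w≈mv)

    cˣ : AbelianGroup.Carrier FE.Kˣ
    cˣ = let c′ , cc′≈1 = IsFieldK.inverse {c} (λ c≈0 → m≉0 (trans (sym φc≈m) (trans (φ.⟦⟧-cong c≈0) φ.0#-homo)))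
         in c , c′ , K.trans (K.*-comm c′ c) cc′≈1 , cc′≈1

    absorbed : [ a , w ] ∼ [ a K.* c , v ]
    absorbed = ∼-trans (⊗-cong K.refl (trans w≈mv (*-congʳ (sym φc≈m)))) (∼-sym (balanced a cˣ v))

  split : ∀ v z → Split v z
  split v [] = record
    { z∼      = ∼-sym (⊗-0 v)
    ; shorter = z≤n
    ; value   = trans (*-congʳ φ.0#-homo) (zeroˡ _)
    ; none    = []
    ; others  = λ _ → refl
    }
  split v ((a , w) ∷ z) = case em {P = ⌜ w ⌝ ~ ⌜ v ⌝} of λ where
    (yes w~v) → absorb w~v (split v z)
    (no  w≁v) → skip w≁v (split v z)

  -- The terms in the class of v combine to (a + b) ⊗ v, and the class sum at v makes the
  -- coefficient zero. The other terms keep their class sums and are fewer; the bound n drives the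
  -- induction, since `rest` is not a sublist known to the termination checker.
  collapse : ∀ n z → length z ≤ n → (∀ {g} → Torsion g → formal-classSum g z ≈ 0#) → z ∼ []
  collapse n       []            _         sums = ∼-refl
  collapse (suc n) ((a , v) ∷ z) (s≤s bound) sums =
    ∼-trans (++-cong {[ a , v ]} ∼-refl z∼)
      (∼-trans (++-cong (∼-trans (∼-sym (⊗-+ a b v)) (∼-trans (⊗-cong (φ≈0 φ[a+b]≈0) (T.refl {v})) (⊗-0 v))) (∼-refl {rest}))
        (collapse n rest (ℕₚ.≤-trans shorter bound) rest-sums))
    where
    open Split (split v z)

    φ[a+b]≈0 : φ.⟦ a K.+ b ⟧ ≈ 0#
    φ[a+b]≈0 = domain (unit≉0 (proj₁ v)) (begin
      ⌜ v ⌝ * φ.⟦ a K.+ b ⟧                         ≈⟨ trans (*-comm _ _) (*-congʳ (φ.+-homo a b)) ⟩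
      (φ.⟦ a ⟧ + φ.⟦ b ⟧) * ⌜ v ⌝                   ≈⟨ trans (distribʳ _ _ _) (+-congˡ value) ⟩
      φ.⟦ a ⟧ * ⌜ v ⌝ + formal-classSum ⌜ v ⌝ z     ≈⟨ classSum-yes {ts = map term z} ~-refl ⟨
      formal-classSum ⌜ v ⌝ ((a , v) ∷ z)           ≈⟨ sums (T⇒Torsion v) ⟩
      0#                                            ∎)

    rest-sums : ∀ {g} → Torsion g → formal-classSum g rest ≈ 0#
    rest-sums {g} g∈T = case em {P = ⌜ v ⌝ ~ g} of λ where
      (yes v~g) → classSum-none (All.map (λ h≁v h~g → h≁v (~-trans h~g (~-sym (unit≉0 (proj₁ v)) v~g))) none)
      (no  v≁g) → trans (others v≁g) (trans (sym (classSum-no {ts = map term z} v≁g)) (sums g∈T))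

  terms : ∀ {p} {P : Pred (Carrier × Carrier) p} z → (∀ t → P (term t)) → All P (map term z)
  terms []      h = []
  terms (t ∷ z) h = h t ∷ terms z h

  module _
    (generates : Generates FE.algebra FE.TinL)
    (essential : Essential FE.T FE.KˣinT)
    (trivial : ∀ p → p > 0 → HasCharacteristic (fieldRing KF) p → Trivial FE.Lˣ/Kˣ (Primary FE.Lˣ/Kˣ p))
    (order-four : ∀ i → HasOrder FE.Lˣ i 4 → FE.InKˣ i)
    where

    open Tower base (essential⇒μ∈ essential) (order-four⇒μ₄∈ essential order-four) (separable trivial)
      using (classSums-vanish)
    open GroupProperties (CommutativeRing.+-group (CrossedGroupAlgebra.commutativeRing (fieldRing KF) FE.T FE.Kˣ→T))
      using (x∙y⁻¹≈ε⇒x≈y)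
    open CrossedGroupAlgebra (fieldRing KF) FE.T FE.Kˣ→T using (⊖_)

    kernel-trivial : ∀ z → FE.K⟨T⟩→L z ≈ 0# → z ∼ []
    kernel-trivial z z≈0 = collapse (length z) z ℕₚ.≤-refl (classSums-vanish
      (terms z λ (a , v) → lift (a , refl) , T⇒Torsion v)
      (trans (reflexive (≡.sym (canonical-total z))) z≈0))

    canonical-injective : ∀ {x y} → FE.K⟨T⟩→L x ≈ FE.K⟨T⟩→L y → x ∼ y
    canonical-injective {x} {y} e = x∙y⁻¹≈ε⇒x≈y x y (kernel-trivial (x ++ ⊖ y) (begin
      FE.K⟨T⟩→L (x ++ ⊖ y)                 ≈⟨ canonical.+-homo x (⊖ y) ⟩
      FE.K⟨T⟩→L x + FE.K⟨T⟩→L (⊖ y)        ≈⟨ +-cong e (canonical.-‿homo y) ⟩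
      FE.K⟨T⟩→L y + - FE.K⟨T⟩→L y          ≈⟨ -‿inverseʳ _ ⟩
      0#                                   ∎))

    preimage : ∀ {x} → Adjoin FE.algebra FE.TinL x → ∃[ z ] FE.K⟨T⟩→L z ≈ x
    preimage (generator (v , v≈x)) = [ K.1# , v ] ,
      trans (+-identityʳ _) (trans (*-congʳ φ.1#-homo) (trans (*-identityˡ _) v≈x))
    preimage (scalar a)     = [ a , T.ε ] , trans (+-identityʳ _) (*-identityʳ _)
    preimage (add s t)      = let x , e = preimage s ; y , f = preimage t in
      x ++ y , trans (canonical.+-homo x y) (+-cong e f)
    preimage (multiply s t) = let x , e = preimage s ; y , f = preimage t in
      CrossedGroupAlgebra._⊛_ (fieldRing KF) FE.T FE.Kˣ→T x y , trans (canonical.*-homo x y) (*-cong e f)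
    preimage (resp x≈y s)   = let z , e = preimage s in z , trans e x≈y

    conditions⇒coGalois : FE.AbsolutelyCoGalois
    conditions⇒coGalois = record
      { isRingIsomorphism = record
        { isRingMonomorphism = record
          { isRingHomomorphism = isRingHomomorphism
          ; injective          = canonical-injective
          }
        ; surjective = λ x → let z , e = preimage (generates x) in z , λ z′∼z → trans (canonical.⟦⟧-cong z′∼z) e
        }
      ; algebraMap-homo = IsAlgebraHomomorphism.algebraMap-homo FE.K⟨T⟩→L-isAlgebraHomomorphism
      }

theorem3p5 : (∀ {a} → ExcludedMiddle a) →
    ∀ {k ℓk k′ l ℓl l′}
    (K : HeytingField k ℓk k′) (L : HeytingField l ℓl l′)
    (φ : RingHomomorphism (CommutativeRing.rawRing (fieldRing K)) (CommutativeRing.rawRing (fieldRing L))) →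
    let open FieldExtension K L φ in
    AbsolutelyCoGalois
    ⇔
    ( ( Generates algebra TinL
    × Essential T KˣinT
    × (∀ (ℓ : ℕ) → ℓ > 0 → HasCharacteristic (fieldRing K) ℓ → Trivial Lˣ/Kˣ (Primary Lˣ/Kˣ ℓ)) )
    × (∀ (i : AbelianGroup.Carrier Lˣ) → HasOrder Lˣ i 4 → InKˣ i) )
theorem3p5 em K L φ = mk⇔
  (λ coGalois → ( CG.generates coGalois , (λ F → CG.essential coGalois F) , CG.coGalois⇒primary-trivial coGalois )
              , CG.order-four coGalois)
  (λ ((generates , essential , trivial) , order-four) → CG.conditions⇒coGalois generates essential trivial order-four)
  where module CG = CoGalois em K L φ
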